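{- Consider the equation $$\varphi(|x^{m}-y^{m}|)=|x^{n}-y^{n}|$$ in integers $x,y,m,n$ with $xy\neq 0$, $m>0$, $n>0$, where $\varphi$ is Euler's totient function. Call a solution trivial if it is of the form $(x,y,m,n)=(a\pm 1,a,1,1)$ with $a$ an integer. Then every nontrivial solution is one of $$(x,y,m,n)=\big(2^{t-1}\pm 1,\,-(2^{t-1}\mp 1),\,2,\,1\big)\quad\text{or}\quad (x,y,m,n)=\big(-(2^{t-1}\pm 1),\,2^{t-1}\mp 1,\,2,\,1\big),$$ where $t$ is an integer with $t\geq 2$.
   Context: $\varphi(k)$ denotes Euler's totient function, the number of integers $r$ with $1\le r\le k$ and $\gcd(r,k)=1$.
   Formalization: The formal theorem adds the hypothesis x^m ≠ y^m, so that φ is evaluated at a positive integer; without it φ(0)=0 makes every x=y (e.g. x=y=m=n=1) a solution that is neither trivial nor in the listed families. -}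

module Defs where

open import Data.Nat using (ℕ; suc; _≟_)
open import Data.Nat.GCD using (gcd)
open import Data.List using (List; length; filter; map; upTo)

φ : ℕ → ℕ
φ k = length (filter (λ r → gcd r k ≟ 1) (map suc (upTo k)))

{-# OPTIONS --safe #-}
-- Write U k = ∣x^k - y^k∣.  If m ≤ n then U m ≤ U n = φ (U m) forces U m = 1, the trivial solutions.
-- If n < m, replace x, y by x^d, y^d with d = gcd m n, so that m and n become coprime, and put x = g a,
-- y = g b with a, b coprime and V k = ∣a^k - b^k∣.  Comparing powers of 2 in φ (g^m V m) = g^n V n settles
-- every parity pattern but one: if m is even, U m has no odd prime factor, which gives the family, and if m, n
-- are odd, U m has at most one, so that U m ≤ 3 φ (U m) = 3 U n, which is too small.
--
-- Let m be odd and n even.  For a prime q dividing m, comparing powers of q shows q ∤ V 1; hence W = V m / V 1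
-- is squarefree and prime to g and V 1, and each prime p ∣ W is ≡ 1 mod some prime q ∣ m.  The s primes
-- p ∣ W with p ≡ 1 mod 2q satisfy q^s ∣ V n, whence q^(2s) ≤ ∣a∣^q; on the other hand, if m has k prime
-- factors, then s ≥ 1 + k(k-1)/2, since W contains a prime whose order is exactly q, q r or q r t for distinct
-- primes q, r, t ∣ m.  As these p are distinct multiples of 2q plus 1, the product of p/(p-1) over them is at
-- most (3s)^(1/2q).  Multiplying over the q gives W/φ(W) ≤ ∣x∣^(3/7), and even ≤ ∣x∣^(3/10) if 3 ∤ m, which is
-- incompatible with U m / φ (U m) = U m / U n ≥ ∣x∣, because U 1 < 2∣x∣ and 2 (U 1)³ ≤ 27 φ(U 1)⁴.
module Submission where

open import Defs
open import Data.Nat.GCD using (gcd; gcd-GCD; module Bézout; gcd[m,n]∣m; gcd[m,n]∣n; gcd-greatest; c*gcd[m,n]≡gcd[cm,cn])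
open import Data.Nat.Coprimality as Coprimality using (Coprime; coprime⇒gcd≡1; gcd≡1⇒coprime; coprime-divisor)
open import Data.Nat.Primality using (Prime; prime?; prime[2]; ¬prime[1]; prime⇒irreducible; prime⇒nonZero; prime⇒nonTrivial; euclidsLemma)
open import Data.Nat.Primality.Factorisation using (factorise)
open import Data.Nat.Induction using (<-rec)
open import Data.Nat.ListAction using (product; sum)
open import Data.Nat.Tactic.RingSolver using (solve-∀)
import Data.Integer.Properties as ℤₚ
import Data.Integer.Divisibility.Signed as S
import Data.Integer.Tactic.RingSolver as ℤSolver
open import Data.List using (List; []; _∷_; _++_; _∷ʳ_; length; filter; map; upTo)
open import Data.List.Properties using (map-id; map-++; length-++; upTo-∷ʳ; filter-++; filter-all; filter-accept; filter-reject)
open import Data.List.Membership.Propositional using (_∈_; find)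
open import Data.List.Membership.Propositional.Properties using (∈-filter⁺; ∈-upTo⁺)
open import Data.List.Relation.Unary.All as All using (All; []; _∷_; all?)
import Data.List.Relation.Unary.All.Properties as Allₚ
open import Data.List.Relation.Unary.Any as Any using (Any; here; there; any?)
open import Data.List.Relation.Unary.AllPairs as AllPairs using (AllPairs; []; _∷_)
import Data.List.Relation.Unary.AllPairs.Properties as AllPairsₚ
open import Data.List.Relation.Unary.Unique.Propositional using (Unique)
open import Data.List.Relation.Unary.Unique.Propositional.Properties using () renaming (++⁺ to Unique-++⁺)
open import Data.Product using (Σ; ∃; ∃₂; _×_; _,_; proj₁; proj₂)
open import Data.Sum using (_⊎_; inj₁; inj₂; [_,_]′)
open import Data.Empty using (⊥; ⊥-elim)
open import Data.Unit using (⊤; tt)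
open import Function using (_∘_)
open import Relation.Nullary using (¬_; Dec; yes; no; ¬?; contradiction)
open import Relation.Nullary.Decidable using (toWitness; _×-dec_; _⊎-dec_)
open import Relation.Binary.Definitions using (tri<; tri≈; tri>)
open import Relation.Binary.PropositionalEquality using (_≡_; _≢_; refl; sym; trans; cong; cong₂; subst; subst₂; module ≡-Reasoning)

-- For odd `m` and even `n` powers of 2 decide nothing, because `V n` may contain arbitrarily many
-- more factors 2 than `V 1`. What remains is a contest of sizes: `X = g ∣a∣` against the product of
-- `W/φ(W)` and `U 1/φ(U 1)`. The danger is an `m` with many prime factors, since each of its k
-- primes q contributes a factor `(3s)^(1/2q)`. To keep the product below `∣a∣^(3/E)`, each factor
-- may use only a k-th part of that exponent; given `q^(2s) ≤ ∣a∣^q`, this follows from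
-- `(3s)^(Ek) ≤ q^(12s)`. A number s merely proportional to k would fail for large k, whereas the
-- quadratic count obtained from the orders q, q r, q r t suffices. E = 7 and E = 10 are the largest
-- integers for which the base cases of that inequality hold with q replaced by 3 and by 5. As
-- `U 1/φ(U 1)` is below `(27X)^(1/4)`, the exponent `1 - 3/E - 1/4` left on X is positive, and only
-- small X have to be inspected. Fractional exponents are avoided by raising every estimate to a
-- common power.

module Totient where

  open import Data.Nat
  open import Data.Nat.Properties
  open import Data.Nat.Divisibility

  -- Primes, Euler's totient, and the prime powers that it inherits from its argument.

  prime>1 : ∀ {p} → Prime p → 1 < p
  prime>1 {p} pr = nonTrivial⇒n>1 p {{prime⇒nonTrivial pr}}

  prime>0 : ∀ {p} → Prime p → 0 < p
  prime>0 pr = <-trans (s≤s z≤n) (prime>1 pr)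

  prime∤1 : ∀ {p} → Prime p → ¬ p ∣ 1
  prime∤1 pr p∣1 = ¬prime[1] (subst Prime (∣1⇒≡1 p∣1) pr)

  primeDivisor : ∀ {n} → 1 < n → ∃ λ p → Prime p × p ∣ n
  primeDivisor {n} 1<n with factorise n {{>-nonZero (<-trans (s≤s z≤n) 1<n)}}
  ... | record { factors = [] ; isFactorisation = eq } = contradiction 1<n
      (subst (λ k → ¬ 1 < k) (sym eq) (<-irrefl refl))
  ... | record { factors = p ∷ ps ; isFactorisation = eq ; factorsPrime = pr ∷ _ } =
    p , pr , subst (p ∣_) (sym eq) (m∣m*n (product ps))

  noPrimeDivisor⇒≡1 : ∀ {n} → 0 < n → (∀ p → Prime p → ¬ p ∣ n) → n ≡ 1
  noPrimeDivisor⇒≡1 {suc zero} _ _ = refl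
  noPrimeDivisor⇒≡1 {suc (suc n)} _ h with primeDivisor {suc (suc n)} (s≤s (s≤s z≤n))
  ... | p , pr , p∣ = ⊥-elim (h p pr p∣)

  prime∣prime : ∀ {p q} → Prime p → Prime q → p ∣ q → p ≡ q
  prime∣prime pp pq p∣q with prime⇒irreducible pq p∣q
  ... | inj₁ refl = ⊥-elim (¬prime[1] pp)
  ... | inj₂ eq = eq

  prime∣^ : ∀ {p} → Prime p → ∀ a k → p ∣ a ^ k → p ∣ a
  prime∣^ pr a zero p∣ = ⊥-elim (prime∤1 pr p∣)
  prime∣^ pr a (suc k) p∣ = [ (λ z → z) , prime∣^ pr a k ]′ (euclidsLemma a (a ^ k) pr p∣)

  prime∤⇒coprime : ∀ {p M} → Prime p → ¬ p ∣ M → Coprime p M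
  prime∤⇒coprime pr p∤M {d} (d∣p , d∣M) with prime⇒irreducible pr d∣p
  ... | inj₁ eq = eq
  ... | inj₂ refl = ⊥-elim (p∤M d∣M)

  Σ₁ : (ℕ → ℕ) → ℕ → ℕ
  Σ₁ f zero = 0
  Σ₁ f (suc n) = Σ₁ f n + f (suc n)

  Σ₁-cong : ∀ {f g : ℕ → ℕ} → (∀ r → f r ≡ g r) → ∀ n → Σ₁ f n ≡ Σ₁ g n
  Σ₁-cong e zero = refl
  Σ₁-cong e (suc n) = cong₂ _+_ (Σ₁-cong e n) (e (suc n))

  Σ₁-+ : ∀ (f g : ℕ → ℕ) n → Σ₁ (λ r → f r + g r) n ≡ Σ₁ f n + Σ₁ g n
  Σ₁-+ f g zero = refl
  Σ₁-+ f g (suc n) rewrite Σ₁-+ f g n = lem (Σ₁ f n) (Σ₁ g n) (f (suc n)) (g (suc n))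
    where
    lem : ∀ a b c d → a + b + (c + d) ≡ a + c + (b + d)
    lem = solve-∀

  Σ₁-shift : ∀ f n k → Σ₁ f (n + k) ≡ Σ₁ f n + Σ₁ (λ r → f (n + r)) k
  Σ₁-shift f n zero = trans (cong (Σ₁ f) (+-identityʳ n)) (sym (+-identityʳ _))
  Σ₁-shift f n (suc k) rewrite +-suc n k | Σ₁-shift f n k = +-assoc (Σ₁ f n) _ _

  Σ₁-periodic : ∀ f M → (∀ r → f (M + r) ≡ f r) → ∀ p → Σ₁ f (p * M) ≡ p * Σ₁ f M
  Σ₁-periodic f M per zero = refl
  Σ₁-periodic f M per (suc p) = trans (Σ₁-shift f M (p * M))
    (cong (Σ₁ f M +_) (trans (Σ₁-cong per (p * M)) (Σ₁-periodic f M per p)))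

  ind : ∀ {P : Set} → Dec P → ℕ
  ind (yes _) = 1
  ind (no _) = 0

  ind-⇔ : ∀ {P Q : Set} (P? : Dec P) (Q? : Dec Q) → (P → Q) → (Q → P) → ind P? ≡ ind Q?
  ind-⇔ (yes _) (yes _) f g = refl
  ind-⇔ (yes p) (no ¬q) f g = ⊥-elim (¬q (f p))
  ind-⇔ (no ¬p) (yes q) f g = ⊥-elim (¬p (g q))
  ind-⇔ (no _) (no _) f g = refl

  mult : ℕ → (ℕ → ℕ) → ℕ → ℕ
  mult p f r = ind (p ∣? r) * f r

  Σ₁-zero : ∀ f k → (∀ r → 0 < r → r ≤ k → f r ≡ 0) → Σ₁ f k ≡ 0
  Σ₁-zero f zero h = refl
  Σ₁-zero f (suc k) h rewrite Σ₁-zero f k (λ r r>0 r≤k → h r r>0 (≤-trans r≤k (n≤1+n k))) = h (suc k) (s≤s z≤n) ≤-refl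

  -- In each block of `p` consecutive arguments only the last one is a multiple of `p`.
  Σ₁-multiples : ∀ p → 0 < p → ∀ f M → Σ₁ (mult p f) (M * p) ≡ Σ₁ (λ r → f (r * p)) M
  Σ₁-multiples p p>0 f zero = refl
  Σ₁-multiples p@(suc p-1) p>0 f (suc M) = begin
    Σ₁ (mult p f) (p + M * p) ≡⟨ cong (Σ₁ (mult p f)) (+-comm p (M * p)) ⟩
    Σ₁ (mult p f) (M * p + p) ≡⟨ Σ₁-shift (mult p f) (M * p) p ⟩
    Σ₁ (mult p f) (M * p) + (Σ₁ (λ r → mult p f (M * p + r)) p-1 + mult p f (M * p + p))
      ≡⟨ cong₂ _+_ (Σ₁-multiples p p>0 f M) (cong₂ _+_ (Σ₁-zero _ p-1 small) last) ⟩
    Σ₁ (λ r → f (r * p)) M + f (suc M * p) ∎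
    where
    open ≡-Reasoning
    small : ∀ r → 0 < r → r ≤ p-1 → mult p f (M * p + r) ≡ 0
    small r@(suc _) _ r≤ with p ∣? (M * p + r)
    ... | no _ = refl
    ... | yes d = ⊥-elim (>⇒∤ (s≤s r≤) (∣m+n∣m⇒∣n d (n∣m*n M)))
    last : mult p f (M * p + p) ≡ f (suc M * p)
    last rewrite +-comm (M * p) p with p ∣? (p + M * p)
    ... | yes _ = *-identityˡ _
    ... | no ¬d = ⊥-elim (¬d (n∣m*n (suc M)))

  copInd : ℕ → ℕ → ℕ
  copInd k r = ind (gcd r k ≟ 1)

  length-filter-upTo : ∀ {P : ℕ → Set} (P? : ∀ r → Dec (P r)) j →
    length (filter P? (map suc (upTo j))) ≡ Σ₁ (λ r → ind (P? r)) j
  length-filter-upTo P? zero = refl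
  length-filter-upTo P? (suc j) = begin
    length (filter P? (map suc (upTo (suc j))))
      ≡⟨ cong (λ l → length (filter P? l)) (trans (cong (map suc) (sym (upTo-∷ʳ j))) (map-++ suc (upTo j) (j ∷ []))) ⟩
    length (filter P? (map suc (upTo j) ∷ʳ suc j))
      ≡⟨ trans (cong length (filter-++ P? (map suc (upTo j)) (suc j ∷ [])))
          (length-++ (filter P? (map suc (upTo j)))) ⟩
    length (filter P? (map suc (upTo j))) + length (filter P? (suc j ∷ []))
      ≡⟨ cong₂ _+_ (length-filter-upTo P? j) last ⟩
    Σ₁ (λ r → ind (P? r)) j + ind (P? (suc j)) ∎
    where
    open ≡-Reasoning
    last : length (filter P? (suc j ∷ [])) ≡ ind (P? (suc j))
    last with P? (suc j)
    ... | yes e = refl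
    ... | no e = refl

  φ≡Σ : ∀ k → φ k ≡ Σ₁ (copInd k) k
  φ≡Σ k = length-filter-upTo (λ r → gcd r k ≟ 1) k

  copInd-⇔ : ∀ k r k′ r′ → (Coprime r k → Coprime r′ k′) → (Coprime r′ k′ → Coprime r k) → copInd k r ≡ copInd k′ r′
  copInd-⇔ k r k′ r′ f g = ind-⇔ (gcd r k ≟ 1) (gcd r′ k′ ≟ 1)
    (λ e → coprime⇒gcd≡1 (f (gcd≡1⇒coprime {r} e))) (λ e → coprime⇒gcd≡1 (g (gcd≡1⇒coprime {r′} e)))

  copInd-periodic : ∀ M r → copInd M (M + r) ≡ copInd M r
  copInd-periodic M r = copInd-⇔ M (M + r) M r (λ c (d∣r , d∣M) → c (∣m∣n⇒∣m+n d∣M d∣r , d∣M))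
      (λ c (d∣ , d∣M) → c (∣m+n∣m⇒∣n d∣ d∣M , d∣M))

  ΣcopInd : ∀ p M → Σ₁ (copInd M) (p * M) ≡ p * φ M
  ΣcopInd p M = trans (Σ₁-periodic (copInd M) M (copInd-periodic M) p) (cong (p *_) (sym (φ≡Σ M)))

  Coprime-mulʳ : ∀ {r a b} → Coprime r a → Coprime r b → Coprime r (a * b)
  Coprime-mulʳ {r} {a} {b} ca cb {d} (d∣r , d∣ab) = cb (d∣r , coprime-divisor
      (λ { (e∣d , e∣a) → ca (∣-trans e∣d d∣r , e∣a) }) d∣ab)

  -- Being prime to `p * M` and being prime to `M` agree here, and the latter has period `M`. This
  -- rule and the next replace general multiplicativity: φ is always evaluated by splitting off one
  -- prime at a time.
  φ-*-∣ : ∀ {p M} → Prime p → p ∣ M → φ (p * M) ≡ p * φ M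
  φ-*-∣ {p} {M} pr p∣M = trans (φ≡Σ (p * M)) (trans (Σ₁-cong eq (p * M)) (ΣcopInd p M))
    where
    eq : ∀ r → copInd (p * M) r ≡ copInd M r
    eq r = copInd-⇔ (p * M) r M r (λ c (d∣r , d∣M) → c (d∣r , ∣n⇒∣m*n p d∣M))
      (λ c → Coprime-mulʳ (λ (d∣r , d∣p) → c (d∣r , ∣-trans d∣p p∣M)) c)

  -- Up to `p * M` there are `p * φ M` numbers prime to `M`. Those among them divisible by `p` are
  -- the `r * p` with `r ≤ M` prime to `M`, which are `φ M` in number; the others are prime to
  -- `p * M`.
  φ-*-∤ : ∀ {p M} → Prime p → ¬ p ∣ M → φ (p * M) ≡ (p ∸ 1) * φ M
  φ-*-∤ {p} {M} pr p∤M = begin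
    φ (p * M)            ≡⟨ sym (m+n∸n≡m (φ (p * M)) (φ M)) ⟩
    φ (p * M) + φ M ∸ φ M ≡⟨ cong (_∸ φ M) key ⟩
    p * φ M ∸ φ M        ≡⟨ cong (p * φ M ∸_) (sym (*-identityˡ (φ M))) ⟩
    p * φ M ∸ 1 * φ M    ≡⟨ sym (*-distribʳ-∸ (φ M) p 1) ⟩
    (p ∸ 1) * φ M        ∎
    where
    open ≡-Reasoning
    split : ∀ r → copInd M r ≡ copInd (p * M) r + mult p (copInd M) r
    split r with p ∣? r
    ... | no p∤r = trans (copInd-⇔ M r (p * M) r (λ c → Coprime-mulʳ (Coprimality.sym (prime∤⇒coprime pr p∤r)) c)
                                 (λ c (d∣r , d∣M) → c (d∣r , ∣n⇒∣m*n p d∣M))) (sym (+-identityʳ _))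
    ... | yes p∣r with gcd r (p * M) ≟ 1
    ...   | no _ = sym (+-identityʳ _)
    ...   | yes e = ⊥-elim (prime∤1 pr (∣-reflexive (gcd≡1⇒coprime {r} e (p∣r , m∣m*n M))))
    mulp : ∀ r → copInd M (r * p) ≡ copInd M r
    mulp r = copInd-⇔ M (r * p) M r (λ c (d∣r , d∣M) → c (∣m⇒∣m*n p d∣r , d∣M))
       (λ c → λ {d} (d∣rp , d∣M) → c (coprime-divisor (λ (e∣d , e∣p) → prime∤⇒coprime pr p∤M (e∣p , ∣-trans e∣d d∣M))
           (subst (d ∣_) (*-comm r p) d∣rp) , d∣M))
    key : φ (p * M) + φ M ≡ p * φ M
    key = begin
      φ (p * M) + φ M
        ≡⟨ cong₂ _+_ (φ≡Σ (p * M)) (trans (φ≡Σ M) (sym (trans (Σ₁-multiples p (prime>0 pr) (copInd M) M)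
            (Σ₁-cong mulp M)))) ⟩
      Σ₁ (copInd (p * M)) (p * M) + Σ₁ (mult p (copInd M)) (M * p)
        ≡⟨ cong (λ k → Σ₁ (copInd (p * M)) (p * M) + Σ₁ (mult p (copInd M)) k) (*-comm M p) ⟩
      Σ₁ (copInd (p * M)) (p * M) + Σ₁ (mult p (copInd M)) (p * M)
        ≡⟨ sym (Σ₁-+ (copInd (p * M)) (mult p (copInd M)) (p * M)) ⟩
      Σ₁ (λ r → copInd (p * M) r + mult p (copInd M) r) (p * M)
        ≡⟨ Σ₁-cong (sym ∘ split) (p * M) ⟩
      Σ₁ (copInd M) (p * M) ≡⟨ ΣcopInd p M ⟩
      p * φ M ∎

  *-pos : ∀ {a b} → 0 < a → 0 < b → 0 < a * b
  *-pos {suc a} {suc b} _ _ = s≤s z≤n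

  ^-pos : ∀ {a} k → 0 < a → 0 < a ^ k
  ^-pos zero _ = s≤s z≤n
  ^-pos (suc k) a>0 = *-pos a>0 (^-pos k a>0)

  ^-distribʳ-* : ∀ k x y → (x * y) ^ k ≡ x ^ k * y ^ k
  ^-distribʳ-* zero x y = refl
  ^-distribʳ-* (suc k) x y = trans (cong (x * y *_) (^-distribʳ-* k x y)) (l x y (x ^ k) (y ^ k))
    where
    l : ∀ a b c d → a * b * (c * d) ≡ a * c * (b * d)
    l = solve-∀

  *-posʳ : ∀ a {b} → 0 < a * b → 0 < b
  *-posʳ a {zero} h = ⊥-elim (<-irrefl (sym (*-zeroʳ a)) h)
  *-posʳ a {suc b} _ = s≤s z≤n

  *-posˡ : ∀ {a} b → 0 < a * b → 0 < a
  *-posˡ {a} b h = *-posʳ b (subst (0 <_) (*-comm a b) h)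

  ∣-pos : ∀ {a b} → 0 < b → a ∣ b → 0 < a
  ∣-pos {zero} b>0 a∣b = ⊥-elim (<-irrefl (sym (0∣⇒≡0 a∣b)) b>0)
  ∣-pos {suc a} _ _ = s≤s z≤n

  ∣⇒≤′ : ∀ {a b} → 0 < b → a ∣ b → a ≤ b
  ∣⇒≤′ b>0 a∣b = ∣⇒≤ {{>-nonZero b>0}} a∣b

  ^-∣ : ∀ p {i j} → i ≤ j → p ^ i ∣ p ^ j
  ^-∣ p {i} {j} i≤j = subst (λ k → p ^ i ∣ p ^ k) (m+[n∸m]≡n i≤j)
      (subst (p ^ i ∣_) (sym (^-distribˡ-+-* p i (j ∸ i))) (m∣m*n (p ^ (j ∸ i))))

  prime[3] : Prime 3
  prime[3] = toWitness {a? = prime? 3} _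

  odd-prime≥3 : ∀ {p} → Prime p → ¬ p ≡ 2 → 3 ≤ p
  odd-prime≥3 pr p≢2 = ≤∧≢⇒< (prime>1 pr) (p≢2 ∘ sym)

  odd-prime≥5 : ∀ {p} → Prime p → ¬ p ≡ 2 → ¬ p ≡ 3 → 5 ≤ p
  odd-prime≥5 {p} pr p≢2 p≢3 = ≤∧≢⇒< (≤∧≢⇒< (odd-prime≥3 pr p≢2) (p≢3 ∘ sym)) λ
      { refl → p≢2 (sym (prime∣prime prime[2] pr (divides 2 refl))) }

  strip : ∀ {p} → 1 < p → ∀ n → 0 < n → ∃₂ λ c n′ → n ≡ p ^ c * n′ × ¬ p ∣ n′
  strip {p} p>1 = <-rec _ go
    where
    go : ∀ n → (∀ {k} → k < n → 0 < k → ∃₂ λ c n′ → k ≡ p ^ c * n′ × ¬ p ∣ n′) →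
         0 < n → ∃₂ λ c n′ → n ≡ p ^ c * n′ × ¬ p ∣ n′
    go n rec n>0 with p ∣? n
    ... | no p∤n = 0 , n , sym (+-identityʳ n) , p∤n
    ... | yes (divides k refl) with rec {k} k<n k>0
      where
      k>0 : 0 < k
      k>0 = *-posˡ p n>0
      k<n : k < k * p
      k<n = m<m*n k p {{>-nonZero k>0}} p>1
    ...   | c , n′ , eq , p∤n′ = suc c , n′ , trans (cong (_* p) eq) (lem (p ^ c) n′ p) , p∤n′
      where
      lem : ∀ a b c → a * b * c ≡ c * a * b
      lem = solve-∀

  p^∣*-cancelʳ : ∀ {p v} → Prime p → ¬ p ∣ v → ∀ J u → p ^ J ∣ u * v → p ^ J ∣ u
  p^∣*-cancelʳ pr p∤v zero u _ = 1∣ u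
  p^∣*-cancelʳ {p} {v} pr p∤v (suc J) u h with euclidsLemma u v pr (m*n∣⇒m∣ p (p ^ J) h)
  ... | inj₂ p∣v = ⊥-elim (p∤v p∣v)
  ... | inj₁ (divides k refl) = subst (p * p ^ J ∣_) (*-comm p k) (*-monoʳ-∣ p
        (p^∣*-cancelʳ pr p∤v J k (*-cancelˡ-∣ p {{prime⇒nonZero pr}} (subst (p * p ^ J ∣_) (lem k p v) h))))
    where
    lem : ∀ k p v → k * p * v ≡ p * (k * v)
    lem = solve-∀

  p^∣p^⇒≤ : ∀ {p} → 1 < p → ∀ J c → p ^ J ∣ p ^ c → J ≤ c
  p^∣p^⇒≤ {p} p>1 J c h with J ≤? c
  ... | yes J≤c = J≤c
  ... | no J≰c = ⊥-elim (<⇒≱ (^-monoʳ-< p p>1 (≰⇒> J≰c)) (∣⇒≤′ (^-pos c (<-trans (s≤s z≤n) p>1)) h))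

  p^∣⇒≤ : ∀ {p v} → Prime p → ¬ p ∣ v → ∀ J c → p ^ J ∣ p ^ c * v → J ≤ c
  p^∣⇒≤ {p} pr p∤v J c h = p^∣p^⇒≤ (prime>1 pr) J c (p^∣*-cancelʳ pr p∤v J (p ^ c) h)

  prime∤* : ∀ {p a b} → Prime p → ¬ p ∣ a → ¬ p ∣ b → ¬ p ∣ a * b
  prime∤* {p} {a} {b} pr na nb h = [ na , nb ]′ (euclidsLemma a b pr h)

  prime∤product : ∀ {p qs} → Prime p → All Prime qs → All (λ q → ¬ p ≡ q) qs → ¬ p ∣ product qs
  prime∤product pr [] [] d = prime∤1 pr d
  prime∤product {qs = q ∷ qs} pr (q-pr ∷ qs-pr) (n ∷ ns) d =
    [ (λ p∣q → n (prime∣prime pr q-pr p∣q)) , prime∤product pr qs-pr ns ]′ (euclidsLemma q (product qs) pr d)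

  product-∣ : ∀ {ps N} → All Prime ps → Unique ps → All (_∣ N) ps → product ps ∣ N
  product-∣ {[]} {N} _ _ _ = 1∣ N
  product-∣ {p ∷ ps} (pr ∷ prs) (ne ∷ u) (divides k refl ∷ ds) =
    subst (p * product ps ∣_) (*-comm p k) (*-monoʳ-∣ p (product-∣ prs u (rest prs ne ds)))
    where
    rest : ∀ {qs} → All Prime qs → All (λ q → ¬ p ≡ q) qs → All (_∣ k * p) qs → All (_∣ k) qs
    rest [] [] [] = []
    rest (q ∷ qs) (n ∷ ns) (d ∷ ds) =
      [ (λ z → z) , (λ q∣p → ⊥-elim (n (sym (prime∣prime q pr q∣p)))) ]′ (euclidsLemma k p q d) ∷ rest qs ns ds

  -- For distinct primes `ps`, `product (preds ps)` is the totient of `product ps`.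
  preds : List ℕ → List ℕ
  preds = map (_∸ 1)

  Σ₁-≤ : ∀ f → (∀ r → f r ≤ 1) → ∀ n → Σ₁ f n ≤ n
  Σ₁-≤ f h zero = z≤n
  Σ₁-≤ f h (suc n) = subst (Σ₁ f n + f (suc n) ≤_) (+-comm n 1) (+-mono-≤ (Σ₁-≤ f h n) (h (suc n)))

  φ-< : ∀ {n} → 1 < n → φ n < n
  φ-< {suc n} 1<n = s≤s (begin
    φ (suc n)                                    ≡⟨ φ≡Σ (suc n) ⟩
    Σ₁ (copInd (suc n)) n + copInd (suc n) (suc n)      ≤⟨ +-mono-≤
        (Σ₁-≤ (copInd (suc n)) (λ r → ind≤1 (gcd r (suc n) ≟ 1)) n) (≤-reflexive last) ⟩
    n + 0                                         ≡⟨ +-identityʳ n ⟩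
    n                                             ∎)
    where
    open ≤-Reasoning
    ind≤1 : ∀ {P : Set} (d : Dec P) → ind d ≤ 1
    ind≤1 (yes _) = ≤-refl
    ind≤1 (no _) = z≤n
    last : copInd (suc n) (suc n) ≡ 0
    last with gcd (suc n) (suc n) ≟ 1
    ... | no _ = refl
    ... | yes e = ⊥-elim (<⇒≱ 1<n (∣⇒≤ (subst (suc n ∣_) e (gcd-greatest (∣-refl {suc n}) ∣-refl))))

  φ-pos : ∀ {n} → 0 < n → 0 < φ n
  φ-pos {n} n>0 with factorise n {{>-nonZero n>0}}
  ... | record { factors = ps ; isFactorisation = eq ; factorsPrime = prs } = subst (λ k → 0 < φ k) (sym eq) (go prs)
    where
    go : ∀ {ps} → All Prime ps → 0 < φ (product ps)
    go [] = s≤s z≤n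
    go {p ∷ ps} (pr ∷ prs) with p ∣? product ps
    ... | yes d = subst (0 <_) (sym (φ-*-∣ pr d)) (*-pos (prime>0 pr) (go prs))
    ... | no d = subst (0 <_) (sym (φ-*-∤ pr d)) (*-pos (m<n⇒0<n∸m (prime>1 pr)) (go prs))

  φ-∣ : ∀ {a b} → 0 < b → a ∣ b → φ a ∣ φ b
  φ-∣ {a} b>0 (divides k refl) with factorise k {{>-nonZero (*-posˡ a b>0)}}
  ... | record { factors = ps ; isFactorisation = refl ; factorsPrime = prs } = go prs
    where
    go : ∀ {ps} → All Prime ps → φ a ∣ φ (product ps * a)
    go [] = ∣-reflexive (cong φ (sym (+-identityʳ a)))
    go {p ∷ ps} (pr ∷ prs) with p ∣? (product ps * a)
    ... | yes d = subst (φ a ∣_) (trans (sym (φ-*-∣ pr d)) (cong φ (sym (*-assoc p (product ps) a))))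
        (∣n⇒∣m*n p (go prs))
    ... | no d = subst (φ a ∣_) (trans (sym (φ-*-∤ pr d)) (cong φ (sym (*-assoc p (product ps) a))))
        (∣n⇒∣m*n (p ∸ 1) (go prs))

  φ-*-supported : ∀ {c M} → 0 < c → (∀ p → Prime p → p ∣ c → p ∣ M) → φ (c * M) ≡ c * φ M
  φ-*-supported {c} {M} c>0 h with factorise c {{>-nonZero c>0}}
  ... | record { factors = ps ; isFactorisation = refl ; factorsPrime = prs } = go prs h
    where
    go : ∀ {ps} → All Prime ps → (∀ p → Prime p → p ∣ product ps → p ∣ M) → φ (product ps * M) ≡ product ps * φ M
    go [] _ = trans (cong φ (+-identityʳ M)) (sym (+-identityʳ (φ M)))
    go {p ∷ ps} (pr ∷ prs) h = begin
      φ (p * product ps * M)     ≡⟨ cong φ (*-assoc p (product ps) M) ⟩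
      φ (p * (product ps * M))   ≡⟨ φ-*-∣ pr (∣n⇒∣m*n (product ps) (h p pr (m∣m*n (product ps)))) ⟩
      p * φ (product ps * M)     ≡⟨ cong (p *_) (go prs (λ q q-pr d → h q q-pr (∣n⇒∣m*n p d))) ⟩
      p * (product ps * φ M)     ≡⟨ sym (*-assoc p (product ps) (φ M)) ⟩
      p * product ps * φ M       ∎
      where open ≡-Reasoning

  φ-^-* : ∀ {p M} → Prime p → ¬ p ∣ M → ∀ j → φ (p ^ suc j * M) ≡ p ^ j * ((p ∸ 1) * φ M)
  φ-^-* {p} {M} pr p∤M j = begin
    φ (p ^ suc j * M)       ≡⟨ cong φ (lem p (p ^ j) M) ⟩
    φ (p ^ j * (p * M))     ≡⟨ φ-*-supported (^-pos j (prime>0 pr)) (λ q q-pr d → ∣m⇒∣m*n M (prime∣^ q-pr p j d)) ⟩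
    p ^ j * φ (p * M)       ≡⟨ cong (p ^ j *_) (φ-*-∤ pr p∤M) ⟩
    p ^ j * ((p ∸ 1) * φ M) ∎
    where
    open ≡-Reasoning
    lem : ∀ a b c → a * b * c ≡ b * (a * c)
    lem = solve-∀

  φ-product-* : ∀ {ps M} → All Prime ps → Unique ps → All (λ p → ¬ p ∣ M) ps →
    φ (product ps * M) ≡ product (preds ps) * φ M
  φ-product-* {[]} {M} _ _ _ = trans (cong φ (+-identityʳ M)) (sym (+-identityʳ (φ M)))
  φ-product-* {p ∷ ps} {M} (pr ∷ prs) (ne ∷ u) (nd ∷ nds) = begin
    φ (p * product ps * M)                  ≡⟨ cong φ (*-assoc p (product ps) M) ⟩
    φ (p * (product ps * M))                ≡⟨ φ-*-∤ pr (prime∤* pr (prime∤product pr prs ne) nd) ⟩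
    (p ∸ 1) * φ (product ps * M)            ≡⟨ cong ((p ∸ 1) *_) (φ-product-* prs u nds) ⟩
    (p ∸ 1) * (product (preds ps) * φ M)    ≡⟨ sym (*-assoc (p ∸ 1) (product (preds ps)) (φ M)) ⟩
    (p ∸ 1) * product (preds ps) * φ M      ∎
    where
    open ≡-Reasoning

  -- The source of every comparison of prime powers: φ loses one factor `q` of `N` but gains `p - 1`
  -- for each further prime `p` of `N`. It is enough to evaluate φ at the divisor
  -- `product ps * q ^ J`; the truncated `J ∸ 1` lets `J = 0` through.
  q^∣φ : ∀ {q N ps} → Prime q → 0 < N → ∀ J → q ^ J ∣ N → All Prime ps → Unique ps → All (_∣ N) ps →
    All (λ p → ¬ p ≡ q) ps → q ^ (J ∸ 1) * product (preds ps) ∣ φ N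
  q^∣φ {q} {N} {ps} q-pr N>0 J q^J∣N prs u ds ne with strip (prime>1 q-pr) N N>0
  ... | c , N′ , refl , q∤N′ = ∣-trans (subst (q ^ (J ∸ 1) * product (preds ps) ∣_) (sym φeq)
          (subst (_∣ product (preds ps) * φ (q ^ J)) (*-comm (product (preds ps)) (q ^ (J ∸ 1)))
            (*-monoʳ-∣ (product (preds ps)) (q^∣ J))))
          (φ-∣ N>0 (subst (_∣ q ^ c * N′) (*-comm (q ^ J) (product ps))
            (*-pres-∣ (^-∣ q J≤c) (product-∣ prs u (rest prs ds ne)))))
    where
    J≤c : J ≤ c
    J≤c = p^∣⇒≤ q-pr q∤N′ J c q^J∣N
    rest : ∀ {qs} → All Prime qs → All (_∣ q ^ c * N′) qs → All (λ p → ¬ p ≡ q) qs → All (_∣ N′) qs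
    rest [] [] [] = []
    rest (pr ∷ prs) (d ∷ ds) (n ∷ ns) = [ (λ d′ → ⊥-elim (n (prime∣prime pr q-pr (prime∣^ pr q c d′)))) , (λ z → z) ]′
      (euclidsLemma (q ^ c) N′ pr d) ∷ rest prs ds ns
    nd : ∀ {qs} → All Prime qs → All (λ p → ¬ p ≡ q) qs → All (λ p → ¬ p ∣ q ^ J) qs
    nd [] [] = []
    nd (pr ∷ prs) (n ∷ ns) = (λ d → n (prime∣prime pr q-pr (prime∣^ pr q J d))) ∷ nd prs ns
    φeq : φ (product ps * q ^ J) ≡ product (preds ps) * φ (q ^ J)
    φeq = φ-product-* prs u (nd prs ne)
    q^∣ : ∀ J → q ^ (J ∸ 1) ∣ φ (q ^ J)
    q^∣ zero = 1∣ _
    q^∣ (suc j) = subst (q ^ j ∣_) (trans (sym (φ-^-* q-pr (prime∤1 q-pr) j)) (cong φ (*-identityʳ (q ^ suc j))))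
        (m∣m*n _)

  ^length∣product : ∀ {q} ps → All (λ p → q ∣ p ∸ 1) ps → q ^ length ps ∣ product (preds ps)
  ^length∣product [] [] = ∣-refl
  ^length∣product (p ∷ ps) (d ∷ ds) = *-pres-∣ d (^length∣product ps ds)

-- Divisibility and size of differences of powers.

module PowerDifferences where

  open import Data.Nat
  open import Data.Nat.Properties
  open import Data.Nat.Divisibility
  open import Data.Integer as ℤ using (ℤ; ∣_∣; 0ℤ; 1ℤ) renaming (+_ to pos)
  open Totient

  binom : ℕ → ℕ → ℕ
  binom n zero = 1
  binom zero (suc k) = 0
  binom (suc n) (suc k) = binom n k + binom n (suc k)

  binom-> : ∀ n k → n < k → binom n k ≡ 0
  binom-> zero (suc k) _ = refl
  binom-> (suc n) (suc k) (s≤s n<k) = cong₂ _+_ (binom-> n k n<k) (binom-> n (suc k) (m<n⇒m<1+n n<k))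

  binom-nn : ∀ n → binom n n ≡ 1
  binom-nn zero = refl
  binom-nn (suc n) = cong₂ _+_ (binom-nn n) (binom-> n (suc n) ≤-refl)

  -- Shows without factorials that a prime divides its inner binomial coefficients, as Fermat's
  -- theorem needs.
  binom-absorb : ∀ n k → suc k * binom (suc n) (suc k) ≡ suc n * binom n k
  binom-absorb zero zero = refl
  binom-absorb zero (suc k) = *-zeroʳ k
  binom-absorb (suc n) zero = trans (+-identityʳ _) (cong suc (trans (sym (+-identityʳ _)) (binom-absorb n zero)))
  binom-absorb (suc n) (suc k) = begin
    suc (suc k) * (x + y)        ≡⟨ lem₁ k x y ⟩
    suc k * x + x + suc (suc k) * y  ≡⟨ cong₂ (λ u v → u + x + v) (binom-absorb n k) (binom-absorb n (suc k)) ⟩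
    suc n * binom n k + x + suc n * binom n (suc k) ≡⟨ lem₂ n (binom n k) (binom n (suc k)) ⟩
    suc (suc n) * x ∎
    where
    open ≡-Reasoning
    x = binom (suc n) (suc k)
    y = binom (suc n) (suc (suc k))
    lem₁ : ∀ k x y → suc (suc k) * (x + y) ≡ suc k * x + x + suc (suc k) * y
    lem₁ = solve-∀
    lem₂ : ∀ n u v → suc n * u + (u + v) + suc n * v ≡ suc (suc n) * (u + v)
    lem₂ = solve-∀

  Σ₁-*ˡ : ∀ c f n → Σ₁ (λ r → c * f r) n ≡ c * Σ₁ f n
  Σ₁-*ˡ c f zero = sym (*-zeroʳ c)
  Σ₁-*ˡ c f (suc n) = trans (cong (_+ c * f (suc n)) (Σ₁-*ˡ c f n)) (sym (*-distribˡ-+ c (Σ₁ f n) (f (suc n))))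

  binomial : ∀ a n → suc a ^ n ≡ 1 + Σ₁ (λ k → binom n k * a ^ k) n
  binomial a zero = refl
  binomial a (suc n) = begin
    suc a * suc a ^ n                  ≡⟨ cong (suc a *_) (binomial a n) ⟩
    suc a * (1 + Σ₁ f n)               ≡⟨ lem a (Σ₁ f n) ⟩
    1 + ((a * (1 + Σ₁ f n)) + (Σ₁ f n))   ≡⟨ cong suc (cong₂ _+_ e₁ e₂) ⟩
    1 + (Σ₁ g (suc n) + Σ₁ f (suc n))  ≡⟨ cong suc (sym (Σ₁-+ g f (suc n))) ⟩
    1 + Σ₁ (λ k → g k + f k) (suc n)   ≡⟨ cong suc (Σ₁-cong′ (suc n)) ⟩
    1 + Σ₁ (λ k → binom (suc n) k * a ^ k) (suc n) ∎
    where
    open ≡-Reasoning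
    f g : ℕ → ℕ
    f k = binom n k * a ^ k
    g k = binom n (k ∸ 1) * a ^ k
    lem : ∀ a s → suc a * (1 + s) ≡ 1 + ((a * (1 + s)) + s)
    lem = solve-∀
    e₂ : Σ₁ f n ≡ Σ₁ f (suc n)
    e₂ = sym (trans (cong (λ z → Σ₁ f n + z * a ^ suc n) (binom-> n (suc n) ≤-refl)) (+-identityʳ _))
    e₁ : a * (1 + Σ₁ f n) ≡ Σ₁ g (suc n)
    e₁ = begin
      a * (1 + Σ₁ f n)          ≡⟨ *-distribˡ-+ a 1 (Σ₁ f n) ⟩
      a * 1 + a * Σ₁ f n        ≡⟨ cong₂ _+_ (sym (+-identityʳ _)) (sym (Σ₁-*ˡ a f n)) ⟩
      g 1 + Σ₁ (λ r → a * f r) n  ≡⟨ cong (g 1 +_) (Σ₁-cong (λ r → sh a (binom n r) (a ^ r)) n) ⟩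
      g 1 + Σ₁ (g ∘ suc) n      ≡⟨ sym (Σ₁-shift g 1 n) ⟩
      Σ₁ g (suc n)              ∎
      where
      sh : ∀ a b c → a * (b * c) ≡ b * (a * c)
      sh = solve-∀
    Σ₁-cong′ : ∀ j → Σ₁ (λ k → g k + f k) j ≡ Σ₁ (λ k → binom (suc n) k * a ^ k) j
    Σ₁-cong′ zero = refl
    Σ₁-cong′ (suc j) = cong₂ _+_ (Σ₁-cong′ j) (sym (*-distribʳ-+ (a ^ suc j) (binom n j) (binom n (suc j))))

  Σ₁-∣ : ∀ {d} f n → (∀ r → 0 < r → r ≤ n → d ∣ f r) → d ∣ Σ₁ f n
  Σ₁-∣ f zero h = _ ∣0
  Σ₁-∣ f (suc n) h = ∣m∣n⇒∣m+n (Σ₁-∣ f n (λ r r>0 r≤n → h r r>0 (m≤n⇒m≤1+n r≤n))) (h (suc n) (s≤s z≤n) ≤-refl)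

  fermat : ∀ {p} → Prime p → ∀ a → ∃ λ c → a ^ p ≡ a + c * p
  fermat {suc p} pr zero = 0 , refl
  fermat {suc p} pr (suc a) with fermat pr a | Σ₁-∣ {suc p} (λ k → binom (suc p) k * a ^ k) p inner
    where
    inner : ∀ r → 0 < r → r ≤ p → suc p ∣ binom (suc p) r * a ^ r
    inner (suc r) _ r≤p with euclidsLemma (suc r) (binom (suc p) (suc r)) pr
         (subst (suc p ∣_) (sym (binom-absorb p r)) (m∣m*n (binom p r)))
    ... | inj₁ d = ⊥-elim (>⇒∤ (s≤s r≤p) d)
    ... | inj₂ d = ∣m⇒∣m*n (a ^ suc r) d
  ... | c , eq | divides k eq′ = k + c , (begin
    suc a ^ suc p  ≡⟨ binomial a (suc p) ⟩
    1 + (Σ₁ (λ k → binom (suc p) k * a ^ k) p + binom (suc p) (suc p) * a ^ suc p)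
       ≡⟨ cong₂ (λ u v → 1 + (u + v)) eq′ (trans (cong (_* a ^ suc p) (binom-nn (suc p))) (trans (+-identityʳ _) eq))
           ⟩
    1 + (k * suc p + (a + c * suc p)) ≡⟨ lem k (suc p) a c ⟩
    suc a + (k + c) * suc p ∎)
    where
    open ≡-Reasoning
    lem : ∀ k p a c → 1 + (k * p + (a + c * p)) ≡ suc a + (k + c) * p
    lem = solve-∀

  abs-^ : ∀ i k → ∣ i ℤ.^ k ∣ ≡ ∣ i ∣ ^ k
  abs-^ i zero = refl
  abs-^ i (suc k) = trans (ℤₚ.abs-* i (i ℤ.^ k)) (cong (∣ i ∣ *_) (abs-^ i k))

  pos-^ : ∀ r k → pos (r ^ k) ≡ pos r ℤ.^ k
  pos-^ r zero = refl
  pos-^ r (suc k) = trans (ℤₚ.pos-* r (r ^ k)) (cong (pos r ℤ.*_) (pos-^ r k))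

  toS : ∀ {p z} → p ∣ ∣ z ∣ → pos p S.∣ z
  toS = S.∣ᵤ⇒∣

  fromS : ∀ {p z} → pos p S.∣ z → p ∣ ∣ z ∣
  fromS = S.∣⇒∣ᵤ

  euclidℤ : ∀ {p} → Prime p → ∀ i j → p ∣ ∣ i ℤ.* j ∣ → (p ∣ ∣ i ∣) ⊎ (p ∣ ∣ j ∣)
  euclidℤ pr i j d = euclidsLemma ∣ i ∣ ∣ j ∣ pr (subst (_ ∣_) (ℤₚ.abs-* i j) d)

  primeℤ∣^ : ∀ {p} → Prime p → ∀ i k → p ∣ ∣ i ℤ.^ k ∣ → p ∣ ∣ i ∣
  primeℤ∣^ pr i k d = prime∣^ pr ∣ i ∣ k (subst (_ ∣_) (abs-^ i k) d)

  -- The homogeneous geometric sum of the `u^i v^(t-1-i)`, a division-free form of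
  -- `(u^t - v^t)/(u - v)`.
  geom : ℕ → ℤ → ℤ → ℤ
  geom zero u v = 0ℤ
  geom (suc t) u v = u ℤ.* geom t u v ℤ.+ v ℤ.^ t

  geom-* : ∀ t u v → (u ℤ.- v) ℤ.* geom t u v ≡ u ℤ.^ t ℤ.- v ℤ.^ t
  geom-* zero u v = ℤₚ.*-zeroʳ (u ℤ.- v)
  geom-* (suc t) u v = begin
    (u ℤ.- v) ℤ.* (u ℤ.* geom t u v ℤ.+ v ℤ.^ t)        ≡⟨ l₁ u v (geom t u v) (v ℤ.^ t) ⟩
    u ℤ.* ((u ℤ.- v) ℤ.* geom t u v) ℤ.+ (u ℤ.- v) ℤ.* v ℤ.^ t
      ≡⟨ cong (λ z → u ℤ.* z ℤ.+ (u ℤ.- v) ℤ.* v ℤ.^ t) (geom-* t u v) ⟩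
    u ℤ.* (u ℤ.^ t ℤ.- v ℤ.^ t) ℤ.+ (u ℤ.- v) ℤ.* v ℤ.^ t ≡⟨ l₂ u v (u ℤ.^ t) (v ℤ.^ t) ⟩
    u ℤ.* u ℤ.^ t ℤ.- v ℤ.* v ℤ.^ t                       ∎
    where
    open ≡-Reasoning
    l₁ : ∀ u v g w → (u ℤ.- v) ℤ.* (u ℤ.* g ℤ.+ w) ≡ u ℤ.* ((u ℤ.- v) ℤ.* g) ℤ.+ (u ℤ.- v) ℤ.* w
    l₁ = ℤSolver.solve-∀
    l₂ : ∀ u v x w → u ℤ.* (x ℤ.- w) ℤ.+ (u ℤ.- v) ℤ.* w ≡ u ℤ.* x ℤ.- v ℤ.* w
    l₂ = ℤSolver.solve-∀

  -- Modulo `u - v` each of the `suc t` summands becomes `v^t`.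
  geom-mod : ∀ t u v → (u ℤ.- v) S.∣ geom (suc t) u v ℤ.- pos (suc t) ℤ.* v ℤ.^ t
  geom-mod zero u v = subst ((u ℤ.- v) S.∣_) (sym (l u)) (S.divides 0ℤ refl)
    where
    l : ∀ u → u ℤ.* 0ℤ ℤ.+ 1ℤ ℤ.- 1ℤ ℤ.* 1ℤ ≡ 0ℤ
    l = ℤSolver.solve-∀
  geom-mod (suc t) u v = subst ((u ℤ.- v) S.∣_)
    (l u v (geom (suc t) u v) (pos (suc t)) (v ℤ.^ t))
    (S.∣m∣n⇒∣m+n (S.∣n⇒∣m*n u (geom-mod t u v)) (S.∣n⇒∣m*n (pos (suc t) ℤ.* v ℤ.^ t) S.∣-refl))
    where
    l : ∀ u v g s w → u ℤ.* (g ℤ.- s ℤ.* w) ℤ.+ s ℤ.* w ℤ.* (u ℤ.- v) ≡ u ℤ.* g ℤ.+ v ℤ.* w ℤ.- (1ℤ ℤ.+ s) ℤ.*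
        (v ℤ.* w)
    l = ℤSolver.solve-∀

  fermatℤ : ∀ {p} → Prime p → ∀ i → pos p S.∣ i ℤ.^ p ℤ.- i
  fermatℤ {p} pr i = subst (pos p S.∣_) (l (i ℤ.^ p) (pos r ℤ.^ p) (pos r) i)
    (S.∣m∣n⇒∣m+n (S.∣m∣n⇒∣m-n r^p-r (S.∣-trans p∣r-i (S.divides (geom p (pos r) i)
        (trans (sym (geom-* p (pos r) i)) (ℤₚ.*-comm (pos r ℤ.- i) (geom p (pos r) i)))))) p∣r-i)
    where
    resid : ∀ i → ∃ λ r → pos p S.∣ pos r ℤ.- i
    resid (pos n) = n , subst (pos p S.∣_) (sym (ℤₚ.+-inverseʳ (pos n))) (S.divides 0ℤ refl)
    -- Adding `suc n` copies of `p` to the negative number gives a natural representative.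
    resid ℤ.-[1+ n ] = suc n * (p ∸ 1) , S.divides (pos (suc n))
      (trans (cong pos (trans (l′ n (p ∸ 1)) (cong (suc n *_) (m+[n∸m]≡n (prime>0 pr))))) (ℤₚ.pos-* (suc n) p))
      where
      l′ : ∀ n k → suc n * k + suc n ≡ suc n * suc k
      l′ = solve-∀
    r = proj₁ (resid i)
    p∣r-i = proj₂ (resid i)
    r^p-r : pos p S.∣ pos r ℤ.^ p ℤ.- pos r
    r^p-r with fermat pr r
    ... | c , eq = S.divides (pos c) (begin
      pos r ℤ.^ p ℤ.- pos r             ≡⟨ cong (ℤ._- pos r) (trans (sym (pos-^ r p)) (cong pos eq)) ⟩
      pos (r + c * p) ℤ.- pos r         ≡⟨ cong (ℤ._- pos r)
          (trans (ℤₚ.pos-+ r (c * p)) (cong (λ z → pos r ℤ.+ z) (ℤₚ.pos-* c p))) ⟩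
      pos r ℤ.+ pos c ℤ.* pos p ℤ.- pos r ≡⟨ l″ (pos r) (pos c ℤ.* pos p) ⟩
      pos c ℤ.* pos p                   ∎)
      where
      open ≡-Reasoning
      l″ : ∀ x y → x ℤ.+ y ℤ.- x ≡ y
      l″ = ℤSolver.solve-∀
    l : ∀ ip rp r i → ((rp ℤ.- r) ℤ.- (rp ℤ.- ip)) ℤ.+ (r ℤ.- i) ≡ ip ℤ.- i
    l = ℤSolver.solve-∀

  -- The second-order Taylor expansion of geom at u = v, multiplied by 2 v so that neither a division by 2 nor the
  -- exponent t - 1 occurs.
  geom-mod² : ∀ t u v → (u ℤ.- v) ℤ.* (u ℤ.- v) S.∣
    v ℤ.* (pos 2 ℤ.* geom (suc t) u v ℤ.- pos 2 ℤ.* pos (suc t) ℤ.* v ℤ.^ t) ℤ.- pos t ℤ.* pos (suc t) ℤ.* v ℤ.^ t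
        ℤ.* (u ℤ.- v)
  geom-mod² zero u v = S.divides 0ℤ (l u v)
    where
    l : ∀ u v → v ℤ.* (pos 2 ℤ.* (u ℤ.* 0ℤ ℤ.+ 1ℤ) ℤ.- pos 2 ℤ.* 1ℤ ℤ.* 1ℤ) ℤ.- 0ℤ ℤ.* 1ℤ ℤ.* 1ℤ ℤ.* (u ℤ.- v) ≡ 0ℤ
        ℤ.* ((u ℤ.- v) ℤ.* (u ℤ.- v))
    l = ℤSolver.solve-∀
  geom-mod² (suc t) u v = subst ((u ℤ.- v) ℤ.* (u ℤ.- v) S.∣_) (l u v (geom (suc t) u v) (pos t) (v ℤ.^ t))
    (S.∣m∣n⇒∣m+n (S.∣n⇒∣m*n u (geom-mod² t u v)) (S.∣n⇒∣m*n (pos t ℤ.* pos (suc t) ℤ.* v ℤ.^ t) S.∣-refl))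
    where
    l : ∀ u v g t w →
      u ℤ.* (v ℤ.* (pos 2 ℤ.* g ℤ.- pos 2 ℤ.* (1ℤ ℤ.+ t) ℤ.* w) ℤ.- t ℤ.* (1ℤ ℤ.+ t) ℤ.* w ℤ.* (u ℤ.- v)) ℤ.+ t ℤ.*
          (1ℤ ℤ.+ t) ℤ.* w ℤ.* ((u ℤ.- v) ℤ.* (u ℤ.- v))
      ≡ v ℤ.* (pos 2 ℤ.* (u ℤ.* g ℤ.+ v ℤ.* w) ℤ.- pos 2 ℤ.* (1ℤ ℤ.+ (1ℤ ℤ.+ t)) ℤ.* (v ℤ.* w)) ℤ.- (1ℤ ℤ.+ t) ℤ.*
          (1ℤ ℤ.+ (1ℤ ℤ.+ t)) ℤ.* (v ℤ.* w) ℤ.* (u ℤ.- v)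
    l = ℤSolver.solve-∀

  -- The case of lifting the exponent needed to see that geom q u v is not a power of q.
  q²∤geom : ∀ {q u v} → Prime q → ¬ q ≡ 2 → q ∣ ∣ u ℤ.- v ∣ → ¬ q ∣ ∣ v ∣ → ¬ q * q ∣ ∣ geom q u v ∣
  q²∤geom {zero} pr = ⊥-elim (<-irrefl refl (prime>0 pr))
  q²∤geom {suc t} {u} {v} pr q≢2 d q∤v dd = [ (λ x → q≢2 (prime∣prime pr prime[2] x)) ,
      (λ x → [ q∤v , (λ y → q∤v (primeℤ∣^ pr v t y)) ]′ (euclidℤ pr v (v ℤ.^ t) x)) ]′
      (euclidℤ pr (pos 2) (v ℤ.* v ℤ.^ t) (fromS (S.*-cancelˡ-∣ Q (subst (Q ℤ.* Q S.∣_) (l₃ Q v (v ℤ.^ t)) Q²∣))))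
    where
    q = suc t
    Q = pos q
    δ = u ℤ.- v
    Q∣δ : Q S.∣ δ
    Q∣δ = toS d
    Q²∣δ² : Q ℤ.* Q S.∣ δ ℤ.* δ
    Q²∣δ² = S.∣-trans (S.*-monoʳ-∣ Q Q∣δ) (S.*-monoˡ-∣ δ Q∣δ)
    Q²∣g : Q ℤ.* Q S.∣ geom q u v
    Q²∣g = subst (S._∣ geom q u v) (ℤₚ.pos-* q q) (toS {z = geom q u v} dd)
    main = S.∣-trans Q²∣δ² (geom-mod² t u v)
    Q²∣third : Q ℤ.* Q S.∣ pos t ℤ.* Q ℤ.* v ℤ.^ t ℤ.* δ
    Q²∣third = subst (Q ℤ.* Q S.∣_) (l₁ (pos t) Q (v ℤ.^ t) δ) (S.∣n⇒∣m*n (pos t ℤ.* v ℤ.^ t) (S.*-monoʳ-∣ Q Q∣δ))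
      where
      l₁ : ∀ t Q w δ → t ℤ.* w ℤ.* (Q ℤ.* δ) ≡ t ℤ.* Q ℤ.* w ℤ.* δ
      l₁ = ℤSolver.solve-∀
    Q²∣ : Q ℤ.* Q S.∣ v ℤ.* (pos 2 ℤ.* Q ℤ.* v ℤ.^ t)
    Q²∣ = subst (Q ℤ.* Q S.∣_) (l₂ v (geom q u v) Q (v ℤ.^ t) (pos t ℤ.* Q ℤ.* v ℤ.^ t ℤ.* δ))
      (S.∣m∣n⇒∣m-n (S.∣n⇒∣m*n (v ℤ.* pos 2) Q²∣g) (S.∣m∣n⇒∣m+n main Q²∣third))
      where
      l₂ : ∀ v g Q w z → v ℤ.* pos 2 ℤ.* g ℤ.- ((v ℤ.* (pos 2 ℤ.* g ℤ.- pos 2 ℤ.* Q ℤ.* w) ℤ.- z) ℤ.+ z) ≡ v ℤ.*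
          (pos 2 ℤ.* Q ℤ.* w)
      l₂ = ℤSolver.solve-∀
    l₃ : ∀ Q v w → v ℤ.* (pos 2 ℤ.* Q ℤ.* w) ≡ Q ℤ.* (pos 2 ℤ.* (v ℤ.* w))
    l₃ = ℤSolver.solve-∀

  -- The numbers V k, their cofactors, and which exponents a prime divides.

  V : ℤ → ℤ → ℕ → ℕ
  V a b k = ∣ a ℤ.^ k ℤ.- b ℤ.^ k ∣

  -- The cofactor of `V a b i` in `V a b (i * j)`.
  T : ℤ → ℤ → ℕ → ℕ → ℕ
  T a b i j = ∣ geom j (a ℤ.^ i) (b ℤ.^ i) ∣

  V-* : ∀ a b i j → V a b (i * j) ≡ V a b i * T a b i j
  V-* a b i j = begin
    V a b (i * j)                                          ≡⟨ cong₂ (λ x y → ∣ x ℤ.- y ∣) (sym (ℤₚ.^-*-assoc a i j))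
        (sym (ℤₚ.^-*-assoc b i j)) ⟩
    ∣ (a ℤ.^ i) ℤ.^ j ℤ.- (b ℤ.^ i) ℤ.^ j ∣                ≡⟨ cong ∣_∣ (sym (geom-* j (a ℤ.^ i) (b ℤ.^ i))) ⟩
    ∣ (a ℤ.^ i ℤ.- b ℤ.^ i) ℤ.* geom j (a ℤ.^ i) (b ℤ.^ i) ∣ ≡⟨ ℤₚ.abs-* (a ℤ.^ i ℤ.- b ℤ.^ i) _ ⟩
    V a b i * T a b i j                                    ∎
    where open ≡-Reasoning

  V-∣ : ∀ a b {i k} → i ∣ k → V a b i ∣ V a b k
  V-∣ a b {i} (divides j refl) = subst (λ z → V a b i ∣ V a b z) (*-comm i j)
      (subst (V a b i ∣_) (sym (V-* a b i j)) (m∣m*n _))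

  Cop : ℤ → ℤ → Set
  Cop a b = ∀ p → Prime p → p ∣ ∣ a ∣ → p ∣ ∣ b ∣ → ⊥

  V-comm : ∀ a b k → V a b k ≡ V b a k
  V-comm a b k = ℤₚ.∣i-j∣≡∣j-i∣ (a ℤ.^ k) (b ℤ.^ k)

  module _ {a b : ℤ} (cop : Cop a b) where

    V-∤b : ∀ {p k} → Prime p → 0 < k → p ∣ V a b k → ¬ p ∣ ∣ b ∣
    V-∤b {p} {suc k} pr _ d p∣b = cop p pr (primeℤ∣^ pr a (suc k) (fromS
        (S.∣m+n∣n⇒∣m {m = a ℤ.^ suc k} (toS d) (S.∣m⇒∣-m (toS
            (subst (p ∣_) (sym (abs-^ b (suc k))) (∣m⇒∣m*n (∣ b ∣ ^ k) p∣b))))))) p∣b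

  module _ {a b : ℤ} (cop : Cop a b) where

    V-∤a : ∀ {p k} → Prime p → 0 < k → p ∣ V a b k → ¬ p ∣ ∣ a ∣
    V-∤a {p} {k} pr k>0 d = V-∤b {b} {a} (λ q q-pr x y → cop q q-pr y x) pr k>0 (subst (p ∣_) (V-comm a b k) d)

    -- A step of Euclid's algorithm on exponents: `a^(d+e) - b^(d+e)` equals
    -- `(a^d - b^d) a^e + b^d (a^e - b^e)`, and `a^e` cancels. Iterated in Bézout form it plays the
    -- role of the order of `a/b` modulo `p`.
    V-sub : ∀ {p} → Prime p → ∀ d e → ¬ p ∣ ∣ a ∣ → p ∣ V a b (d + e) → p ∣ V a b e → p ∣ V a b d
    V-sub {p} pr d e p∤a h₁ h₂ with euclidℤ pr (a ℤ.^ d ℤ.- b ℤ.^ d) (a ℤ.^ e)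
        (fromS (S.∣m+n∣n⇒∣m {m = (a ℤ.^ d ℤ.- b ℤ.^ d) ℤ.* a ℤ.^ e} (subst (pos p S.∣_) eq (toS h₁))
            (S.∣n⇒∣m*n (b ℤ.^ d) (toS h₂))))
      where
      l : ∀ ad ae bd be → ad ℤ.* ae ℤ.- bd ℤ.* be ≡ (ad ℤ.- bd) ℤ.* ae ℤ.+ bd ℤ.* (ae ℤ.- be)
      l = ℤSolver.solve-∀
      eq = trans (cong₂ ℤ._-_ (ℤₚ.^-distribˡ-+-* a d e) (ℤₚ.^-distribˡ-+-* b d e))
          (l (a ℤ.^ d) (a ℤ.^ e) (b ℤ.^ d) (b ℤ.^ e))
    ... | inj₁ x = x
    ... | inj₂ x = ⊥-elim (p∤a (primeℤ∣^ pr a e x))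

    V-gcd : ∀ {p} → Prime p → ∀ i j → 0 < i → p ∣ V a b i → p ∣ V a b j → p ∣ V a b (gcd i j)
    V-gcd {p} pr i j i>0 hi hj with Bézout.identity (gcd-GCD i j)
    ... | Bézout.+- x y eq = V-sub pr (gcd i j) (y * j) (V-∤a pr i>0 hi)
        (subst (λ z → p ∣ V a b z) (sym eq) (∣-trans hi (V-∣ a b (n∣m*n x)))) (∣-trans hj (V-∣ a b (n∣m*n y)))
    ... | Bézout.-+ x y eq = V-sub pr (gcd i j) (x * i) (V-∤a pr i>0 hi)
        (subst (λ z → p ∣ V a b z) (sym eq) (∣-trans hj (V-∣ a b (n∣m*n y)))) (∣-trans hi (V-∣ a b (n∣m*n x)))

    -- If `p ∣ V a b i`, then `T a b i j` is congruent modulo `p` to `j` times a power of `b`, and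
    -- `p ∤ b`. So only primes of `j` can be shared by `V a b i` and its cofactor.
    T-mod : ∀ {p} → Prime p → ∀ i j → 0 < i → p ∣ V a b i → p ∣ T a b i j → p ∣ j
    T-mod pr i zero _ _ _ = _ ∣0
    T-mod {p} pr i (suc j) i>0 hi ht with euclidℤ pr (pos (suc j)) ((b ℤ.^ i) ℤ.^ j) (fromS
        (subst (pos p S.∣_) (l (geom (suc j) (a ℤ.^ i) (b ℤ.^ i)) (pos (suc j) ℤ.* (b ℤ.^ i) ℤ.^ j))
        (S.∣m∣n⇒∣m-n (toS {z = geom (suc j) (a ℤ.^ i) (b ℤ.^ i)} ht)
            (S.∣-trans (toS hi) (geom-mod j (a ℤ.^ i) (b ℤ.^ i))))))
      where
      l : ∀ g w → g ℤ.- (g ℤ.- w) ≡ w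
      l = ℤSolver.solve-∀
    ... | inj₁ x = x
    ... | inj₂ x = ⊥-elim (V-∤b cop pr i>0 hi (primeℤ∣^ pr b i (primeℤ∣^ pr (b ℤ.^ i) j x)))

    V-fermat : ∀ {p} → Prime p → ¬ p ∣ ∣ a ∣ → ¬ p ∣ ∣ b ∣ → p ∣ V a b (p ∸ 1)
    V-fermat {p} pr p∤a p∤b = fromS (subst (pos p S.∣_) (l (a ℤ.^ (p ∸ 1)) (b ℤ.^ (p ∸ 1)))
        (S.∣m∣n⇒∣m-n (one a p∤a) (one b p∤b)))
      where
      l : ∀ x y → (x ℤ.- 1ℤ) ℤ.- (y ℤ.- 1ℤ) ≡ x ℤ.- y
      l = ℤSolver.solve-∀
      l₂ : ∀ i x → i ℤ.* x ℤ.- i ≡ i ℤ.* (x ℤ.- 1ℤ)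
      l₂ = ℤSolver.solve-∀
      one : ∀ i → ¬ p ∣ ∣ i ∣ → pos p S.∣ i ℤ.^ (p ∸ 1) ℤ.- 1ℤ
      one i p∤i = [ (λ x → ⊥-elim (p∤i x)) , toS ]′ (euclidℤ pr i (i ℤ.^ (p ∸ 1) ℤ.- 1ℤ)
        (fromS (subst (pos p S.∣_) (trans (cong (λ k → i ℤ.^ k ℤ.- i) (sym (m+[n∸m]≡n (prime>0 pr))))
            (l₂ i (i ℤ.^ (p ∸ 1)))) (fermatℤ pr i))))

  T-mod⁻ : ∀ a b {p} i j → p ∣ V a b i → p ∣ j → p ∣ T a b i j
  T-mod⁻ a b i zero _ _ = _ ∣0
  T-mod⁻ a b {p} i (suc j) hi hj = fromS (subst (pos p S.∣_)
      (l (geom (suc j) (a ℤ.^ i) (b ℤ.^ i)) (pos (suc j) ℤ.* (b ℤ.^ i) ℤ.^ j))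
        (S.∣m∣n⇒∣m+n (S.∣-trans (toS hi) (geom-mod j (a ℤ.^ i) (b ℤ.^ i)))
            (S.∣m⇒∣m*n ((b ℤ.^ i) ℤ.^ j) (toS {z = pos (suc j)} hj))))
    where
    l : ∀ g w → (g ℤ.- w) ℤ.+ w ≡ g
    l = ℤSolver.solve-∀

  -- Parity, signs and growth of V k.

  evenOrOdd : ∀ n → (∃ λ k → n ≡ 2 * k) ⊎ (∃ λ k → n ≡ suc (2 * k))
  evenOrOdd zero = inj₁ (0 , refl)
  evenOrOdd (suc n) with evenOrOdd n
  ... | inj₁ (k , refl) = inj₂ (k , refl)
  ... | inj₂ (k , refl) = inj₁ (suc k , cong suc (sym (+-suc k (k + 0))))

  odd⇒suc : ∀ {n} → ¬ 2 ∣ n → ∃ λ k → n ≡ suc (2 * k)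
  odd⇒suc {n} 2∤n with evenOrOdd n
  ... | inj₁ (k , refl) = ⊥-elim (2∤n (m∣m*n k))
  ... | inj₂ r = r

  ^-even : ∀ i k → i ℤ.^ (2 * k) ≡ pos (∣ i ∣ ^ (2 * k))
  ^-even i k = begin
    i ℤ.^ (2 * k)              ≡⟨ sym (ℤₚ.^-*-assoc i 2 k) ⟩
    (i ℤ.^ 2) ℤ.^ k            ≡⟨ cong (ℤ._^ k) (sq i) ⟩
    pos (∣ i ∣ ^ 2) ℤ.^ k      ≡⟨ sym (pos-^ (∣ i ∣ ^ 2) k) ⟩
    pos ((∣ i ∣ ^ 2) ^ k)      ≡⟨ cong pos (^-*-assoc ∣ i ∣ 2 k) ⟩
    pos (∣ i ∣ ^ (2 * k))      ∎
    where
    open ≡-Reasoning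
    sq : ∀ i → i ℤ.^ 2 ≡ pos (∣ i ∣ ^ 2)
    sq (pos n) = sym (pos-^ n 2)
    sq ℤ.-[1+ n ] = refl

  -- A negative base needs only its odd powers recorded, since `^-even` treats even powers for all
  -- signs.
  data SignView (i : ℤ) : Set where
    nonneg : (∀ k → i ℤ.^ k ≡ pos (∣ i ∣ ^ k)) → SignView i
    neg    : (∀ k → i ℤ.^ suc (2 * k) ≡ ℤ.- pos (∣ i ∣ ^ suc (2 * k))) → SignView i

  signView : ∀ i → SignView i
  signView (pos n) = nonneg (λ k → sym (pos-^ n k))
  signView i@(ℤ.-[1+ n ]) = neg λ k → begin
    i ℤ.* i ℤ.^ (2 * k)                       ≡⟨ cong (i ℤ.*_) (^-even i k) ⟩
    (ℤ.- pos (suc n)) ℤ.* pos (suc n ^ (2 * k)) ≡⟨ sym (ℤₚ.neg-distribˡ-* (pos (suc n)) _) ⟩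
    ℤ.- (pos (suc n) ℤ.* pos (suc n ^ (2 * k))) ≡⟨ cong ℤ.-_ (sym (ℤₚ.pos-* (suc n) _)) ⟩
    ℤ.- pos (suc n ^ suc (2 * k))             ∎
    where open ≡-Reasoning

  ∣pos-pos∣ : ∀ {A B} → B ≤ A → ∣ pos A ℤ.- pos B ∣ + B ≡ A
  ∣pos-pos∣ {A} {B} B≤A = trans (cong (λ z → ∣ z ∣ + B) (trans (ℤₚ.[+m]-[+n]≡m⊖n A B) (ℤₚ.⊖-≥ B≤A))) (m∸n+n≡m B≤A)

  ∣-pos-pos∣ : ∀ A B → ∣ ℤ.- pos A ℤ.- pos B ∣ ≡ A + B
  ∣-pos-pos∣ A B = trans (cong ∣_∣ (l (pos A) (pos B))) (trans (ℤₚ.∣-i∣≡∣i∣ (pos A ℤ.+ pos B)) refl)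
    where
    l : ∀ x y → ℤ.- x ℤ.- y ≡ ℤ.- (x ℤ.+ y)
    l = ℤSolver.solve-∀

  ∣--∣ : ∀ {A B} → B ≤ A → ∣ ℤ.- pos A ℤ.- ℤ.- pos B ∣ + B ≡ A
  ∣--∣ {A} {B} B≤A = trans (cong (_+ B) (trans (cong ∣_∣ (l (pos A) (pos B))) (ℤₚ.∣-i∣≡∣i∣ (pos A ℤ.- pos B))))
      (∣pos-pos∣ B≤A)
    where
    l : ∀ x y → ℤ.- x ℤ.- ℤ.- y ≡ ℤ.- (x ℤ.- y)
    l = ℤSolver.solve-∀

  ∣+∣ : ∀ A B → ∣ pos A ℤ.- ℤ.- pos B ∣ ≡ A + B
  ∣+∣ A B = cong (λ z → ∣ pos A ℤ.+ z ∣) (ℤₚ.neg-involutive (pos B))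

  V-even : ∀ a b k → ∣ b ∣ ≤ ∣ a ∣ → V a b (2 * k) + ∣ b ∣ ^ (2 * k) ≡ ∣ a ∣ ^ (2 * k)
  V-even a b k B≤A = trans (cong (_+ ∣ b ∣ ^ (2 * k)) (cong₂ (λ x y → ∣ x ℤ.- y ∣) (^-even a k) (^-even b k)))
      (∣pos-pos∣ (^-monoˡ-≤ (2 * k) B≤A))

  -- The alternatives are equal and opposite signs of `a` and `b`. For opposite signs only odd
  -- exponents are listed; even ones obey `V-even` in either case.
  V-cases : ∀ a b → ∣ b ∣ ≤ ∣ a ∣ →
    (∀ k → V a b k + ∣ b ∣ ^ k ≡ ∣ a ∣ ^ k) ⊎ (∀ k → V a b (suc (2 * k)) ≡ ∣ a ∣ ^ suc (2 * k) + ∣ b ∣ ^ suc (2 * k))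
  V-cases a b B≤A with signView a | signView b
  ... | nonneg f | nonneg g = inj₁ λ k → trans (cong (_+ ∣ b ∣ ^ k) (cong₂ (λ x y → ∣ x ℤ.- y ∣) (f k) (g k)))
      (∣pos-pos∣ (^-monoˡ-≤ k B≤A))
  ... | nonneg f | neg g = inj₂ λ k → trans (cong₂ (λ x y → ∣ x ℤ.- y ∣) (f (suc (2 * k))) (g k))
      (∣+∣ (∣ a ∣ ^ suc (2 * k)) (∣ b ∣ ^ suc (2 * k)))
  ... | neg f | nonneg g = inj₂ λ k → trans (cong₂ (λ x y → ∣ x ℤ.- y ∣) (f k) (g (suc (2 * k))))
      (∣-pos-pos∣ (∣ a ∣ ^ suc (2 * k)) (∣ b ∣ ^ suc (2 * k)))
  ... | neg f | neg g = inj₁ go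
    where
    go : ∀ k → V a b k + ∣ b ∣ ^ k ≡ ∣ a ∣ ^ k
    go k with evenOrOdd k
    ... | inj₁ (j , refl) = V-even a b j B≤A
    ... | inj₂ (j , refl) = trans (cong (_+ ∣ b ∣ ^ k) (cong₂ (λ x y → ∣ x ℤ.- y ∣) (f j) (g j)))
        (∣--∣ (^-monoˡ-≤ k B≤A))

  V-lower : ∀ a b k → ∣ a ∣ ^ k ≤ V a b k + ∣ b ∣ ^ k
  V-lower a b k = subst₂ _≤_ (trans (cong ∣_∣ (l (a ℤ.^ k) (b ℤ.^ k))) (abs-^ a k)) (cong (V a b k +_) (abs-^ b k))
      (ℤₚ.∣i+j∣≤∣i∣+∣j∣ (a ℤ.^ k ℤ.- b ℤ.^ k) (b ℤ.^ k))
    where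
    l : ∀ x y → x ℤ.- y ℤ.+ y ≡ x
    l = ℤSolver.solve-∀

  V-upper : ∀ a b k → V a b k ≤ ∣ a ∣ ^ k + ∣ b ∣ ^ k
  V-upper a b k = subst (V a b k ≤_) (cong₂ _+_ (abs-^ a k) (abs-^ b k)) (ℤₚ.∣i-j∣≤∣i∣+∣j∣ (a ℤ.^ k) (b ℤ.^ k))

  even⇒2* : ∀ {k} → 2 ∣ k → ∃ λ j → k ≡ 2 * j
  even⇒2* (divides j refl) = j , *-comm j 2

  -- Only `V a b n` has to be an exact difference of absolute powers. For the exponent `e + n` the
  -- triangle inequality suffices, so the signs of `a` and `b` do not matter there.
  A^V≤V : ∀ a b n e → ∣ b ∣ ≤ ∣ a ∣ → V a b n + ∣ b ∣ ^ n ≡ ∣ a ∣ ^ n → ∣ a ∣ ^ e * V a b n ≤ V a b (e + n)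
  A^V≤V a b n e B≤A eq = +-cancelʳ-≤ (∣ b ∣ ^ (e + n)) _ _ (begin
    A ^ e * V a b n + B ^ (e + n)    ≡⟨ cong (A ^ e * V a b n +_) (^-distribˡ-+-* B e n) ⟩
    A ^ e * V a b n + B ^ e * B ^ n  ≤⟨ +-monoʳ-≤ (A ^ e * V a b n) (*-monoˡ-≤ (B ^ n) (^-monoˡ-≤ e B≤A)) ⟩
    A ^ e * V a b n + A ^ e * B ^ n  ≡⟨ sym (*-distribˡ-+ (A ^ e) (V a b n) (B ^ n)) ⟩
    A ^ e * (V a b n + B ^ n)        ≡⟨ cong (A ^ e *_) eq ⟩
    A ^ e * A ^ n                    ≡⟨ sym (^-distribˡ-+-* A e n) ⟩
    A ^ (e + n)                      ≤⟨ V-lower a b (e + n) ⟩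
    V a b (e + n) + B ^ (e + n)      ∎)
    where
    open ≤-Reasoning
    A = ∣ a ∣
    B = ∣ b ∣

  ^-mono-exp : ∀ {A j k} → 0 < A → j ≤ k → A ^ j ≤ A ^ k
  ^-mono-exp {A} A>0 j≤k = ^-monoʳ-≤ A {{>-nonZero A>0}} j≤k

  suc^-≥ : ∀ B k → B ^ suc k + B ^ k ≤ suc B ^ suc k
  suc^-≥ B k = begin
    B * B ^ k + B ^ k   ≡⟨ +-comm (B * B ^ k) (B ^ k) ⟩
    suc B * B ^ k       ≤⟨ *-monoʳ-≤ (suc B) (^-monoˡ-≤ k (n≤1+n B)) ⟩
    suc B * suc B ^ k   ∎
    where open ≤-Reasoning

  -- The hard case of monotonicity: opposite signs, `m` odd and `n` even, so that a sum of powers is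
  -- compared with a difference. One factor `A ≥ B + 1` of `A ^ n` is spent on `A^(n-1)` and `B`
  -- copies of it, and `A^(n-1)` dominates `B^(n-1) + B^(n-2)`.
  sum≤diff : ∀ {A B m n} → 0 < B → B < A → 0 < m → m < n → (A ^ m + B ^ m) + B ^ n ≤ A ^ n
  sum≤diff {A} {B} {suc m} {suc (suc n)} B>0 B<A _ (s≤s (s≤s m≤n)) = begin
    (A ^ suc m + B ^ suc m) + B * B ^ suc n  ≤⟨ +-monoˡ-≤ (B * B ^ suc n)
        (+-mono-≤ (^-mono-exp (<-trans B>0 B<A) (s≤s m≤n)) (^-mono-exp B>0 (s≤s m≤n))) ⟩
    (A ^ suc n + B ^ suc n) + B * B ^ suc n  ≡⟨ l (A ^ suc n) (B ^ n) B ⟩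
    A ^ suc n + B * (B ^ suc n + B ^ n)      ≤⟨ +-monoʳ-≤ (A ^ suc n)
        (*-monoʳ-≤ B (≤-trans (suc^-≥ B n) (^-monoˡ-≤ (suc n) B<A))) ⟩
    suc B * A ^ suc n                        ≤⟨ *-monoˡ-≤ (A ^ suc n) B<A ⟩
    A * A ^ suc n                            ∎
    where
    open ≤-Reasoning
    l : ∀ x y b → (x + b * y) + b * (b * y) ≡ x + b * (b * y + y)
    l = solve-∀

  V-zero : ∀ a b k → ∣ a ∣ ≡ ∣ b ∣ → V a b k + ∣ b ∣ ^ k ≡ ∣ a ∣ ^ k → V a b k ≡ 0
  V-zero a b k e h = +-cancelʳ-≡ (∣ b ∣ ^ k) (V a b k) 0 (trans h (cong (_^ k) e))

  -- `0 < V a b n` excludes `a = - b` with even `n`, where monotonicity fails.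
  V-mono′ : ∀ a b {m n} → ∣ b ∣ ≤ ∣ a ∣ → 0 < ∣ b ∣ → 0 < m → m ≤ n → 0 < V a b n → V a b m ≤ V a b n
  V-mono′ a b {m} {n} B≤A B>0 m>0 m≤n Vn>0 with m≤n⇒m<n∨m≡n m≤n
  ... | inj₂ refl = ≤-refl
  ... | inj₁ m<n = go (V-cases a b B≤A) (evenOrOdd m) (evenOrOdd n) m>0 m<n Vn>0
    where
    A>0 : 0 < ∣ a ∣
    A>0 = <-≤-trans B>0 B≤A
    diff : ∀ {m n} → V a b m + ∣ b ∣ ^ m ≡ ∣ a ∣ ^ m → m < n → V a b m ≤ V a b n
    diff {m} {n} eq m<n = ≤-trans (m≤n*m (V a b m) (∣ a ∣ ^ (n ∸ m)) {{>-nonZero (^-pos (n ∸ m) A>0)}})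
       (subst (λ k → ∣ a ∣ ^ (n ∸ m) * V a b m ≤ V a b k) (m∸n+n≡m (<⇒≤ m<n)) (A^V≤V a b m (n ∸ m) B≤A eq))
    go : (∀ k → V a b k + ∣ b ∣ ^ k ≡ ∣ a ∣ ^ k) ⊎ (∀ k → V a b (suc (2 * k)) ≡ ∣ a ∣ ^ suc (2 * k) + ∣ b ∣ ^ suc
        (2 * k)) →
      ∀ {m n} → (∃ λ k → m ≡ 2 * k) ⊎ (∃ λ k → m ≡ suc (2 * k)) → (∃ λ k → n ≡ 2 * k) ⊎ (∃ λ k → n ≡ suc (2 * k)) → 0
          < m → m < n → 0 < V a b n → V a b m ≤ V a b n
    go (inj₁ same) {m} _ _ _ m<n _ = diff (same m) m<n
    go (inj₂ opp) (inj₁ (j , refl)) _ _ m<n _ = diff (V-even a b j B≤A) m<n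
    go (inj₂ opp) {m} {n} (inj₂ (j , refl)) (inj₂ (k , refl)) _ m<n _ = begin
      V a b m                  ≡⟨ opp j ⟩
      ∣ a ∣ ^ m + ∣ b ∣ ^ m    ≤⟨ +-mono-≤ (^-mono-exp A>0 (<⇒≤ m<n)) (^-mono-exp B>0 (<⇒≤ m<n)) ⟩
      ∣ a ∣ ^ n + ∣ b ∣ ^ n    ≡⟨ sym (opp k) ⟩
      V a b n                  ∎
      where open ≤-Reasoning
    go (inj₂ opp) {m} {n} (inj₂ (j , refl)) (inj₁ (k , refl)) m>0 m<n Vn>0 with m≤n⇒m<n∨m≡n B≤A
    ... | inj₂ e = ⊥-elim (<-irrefl (sym (V-zero a b n (sym e) (V-even a b k B≤A))) Vn>0)
    ... | inj₁ B<A = +-cancelʳ-≤ (∣ b ∣ ^ n) _ _ (begin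
      V a b m + ∣ b ∣ ^ n                    ≡⟨ cong (_+ ∣ b ∣ ^ n) (opp j) ⟩
      (∣ a ∣ ^ m + ∣ b ∣ ^ m) + ∣ b ∣ ^ n    ≤⟨ sum≤diff B>0 B<A m>0 m<n ⟩
      ∣ a ∣ ^ n                              ≡⟨ sym (V-even a b k B≤A) ⟩
      V a b n + ∣ b ∣ ^ n                    ∎)
      where open ≤-Reasoning

  V-mono : ∀ a b {m n} → 0 < ∣ a ∣ → 0 < ∣ b ∣ → 0 < m → m ≤ n → 0 < V a b n → V a b m ≤ V a b n
  V-mono a b {m} {n} A>0 B>0 m>0 m≤n Vn>0 with ≤-total ∣ b ∣ ∣ a ∣
  ... | inj₁ B≤A = V-mono′ a b B≤A B>0 m>0 m≤n Vn>0
  ... | inj₂ A≤B = subst₂ _≤_ (V-comm b a m) (V-comm b a n)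
      (V-mono′ b a A≤B A>0 m>0 m≤n (subst (0 <_) (V-comm a b n) Vn>0))

  -- `A^k - B^k` is at least `(A - B) A^(k-1)`, and `A^(k-1) ≥ A ≥ 2`. The bound `s` is left free so
  -- that it can be a difference of powers as well as a sum of powers of integers.
  2Δ≤ : ∀ {A B s} k → 0 < B → B < A → 1 < k → A ^ k ≤ s + B ^ k → 2 * (A ∸ B) ≤ s
  2Δ≤ {A} {B} {s} (suc (suc k)) B>0 B<A (s≤s (s≤s _)) h = +-cancelʳ-≤ (B ^ suc (suc k)) _ _ (begin
    2 * Δ + B * B ^ suc k           ≤⟨ +-monoˡ-≤ (B * B ^ suc k) (begin
      2 * Δ                         ≡⟨ *-comm 2 Δ ⟩
      Δ * 2                         ≤⟨ *-monoʳ-≤ Δ (≤-trans (≤-<-trans B>0 B<A)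
          (m≤m*n A (A ^ k) {{>-nonZero (^-pos k A>0)}})) ⟩
      Δ * A ^ suc k                 ∎) ⟩
    Δ * A ^ suc k + B * B ^ suc k   ≤⟨ +-monoʳ-≤ (Δ * A ^ suc k) (*-monoʳ-≤ B (^-monoˡ-≤ (suc k) (<⇒≤ B<A))) ⟩
    Δ * A ^ suc k + B * A ^ suc k   ≡⟨ sym (*-distribʳ-+ (A ^ suc k) Δ B) ⟩
    (Δ + B) * A ^ suc k             ≡⟨ cong (_* A ^ suc k) (m∸n+n≡m (<⇒≤ B<A)) ⟩
    A ^ suc (suc k)                 ≤⟨ h ⟩
    s + B ^ suc (suc k)             ∎)
    where
    open ≤-Reasoning
    Δ = A ∸ B
    A>0 : 0 < A
    A>0 = <-trans B>0 B<A

  V-eq-abs : ∀ a b k → ∣ a ∣ ≡ ∣ b ∣ → 2 ∣ V a b k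
  V-eq-abs a b k e with V-cases a b (≤-reflexive (sym e)) | evenOrOdd k
  ... | inj₁ same | _ = subst (2 ∣_) (sym (V-zero a b k e (same k))) (2 ∣0)
  ... | inj₂ opp | inj₁ (j , refl) = subst (2 ∣_) (sym (V-zero a b k e (V-even a b j (≤-reflexive (sym e))))) (2 ∣0)
  ... | inj₂ opp | inj₂ (j , refl) = subst (2 ∣_) (sym (trans (opp j)
      (trans (cong (λ z → z ^ k + ∣ b ∣ ^ k) e) (cong (∣ b ∣ ^ k +_) (sym (+-identityʳ _)))))) (m∣m*n (∣ b ∣ ^ k))

  -- For equal absolute values the number is even; otherwise `2Δ≤` makes it at least 2.
  V≢1 : ∀ a b k → 0 < ∣ a ∣ → 0 < ∣ b ∣ → 1 < k → V a b k ≢ 1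
  V≢1 a b k A>0 B>0 k>1 e with <-cmp ∣ a ∣ ∣ b ∣
  ... | tri≈ _ eq _ = >⇒∤ (s≤s (s≤s z≤n)) (subst (2 ∣_) e (V-eq-abs a b k eq))
  ... | tri> _ _ B<A = <⇒≱ (*-monoʳ-≤ 2 (m<n⇒0<n∸m B<A)) (subst (2 * (∣ a ∣ ∸ ∣ b ∣) ≤_) e
      (2Δ≤ k B>0 B<A k>1 (V-lower a b k)))
  ... | tri< A<B _ _ = <⇒≱ (*-monoʳ-≤ 2 (m<n⇒0<n∸m A<B)) (subst (2 * (∣ b ∣ ∸ ∣ a ∣) ≤_) (trans (V-comm b a k) e)
      (2Δ≤ k A>0 A<B k>1 (V-lower b a k)))

-- Upper bounds for the ratio of a number to its totient.

module TotientRatio where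

  open import Data.Nat
  open import Data.Nat.Properties
  open import Data.Nat.Divisibility
  open Totient

  ^-cancelˡ-≤ : ∀ k → 0 < k → ∀ u v → u ^ k ≤ v ^ k → u ≤ v
  ^-cancelˡ-≤ k@(suc _) _ u v h with u ≤? v
  ... | yes p = p
  ... | no p = ⊥-elim (<⇒≱ (^-monoˡ-< k (≰⇒> p)) h)

  -- Bernoulli's inequality `(1 - 1/(t+1))^i ≥ 1 - i/(t+1)` with denominators cleared; `r` stands
  -- for `t + 1 - i`.
  bernoulli : ∀ t i r → suc t ≡ i + r → suc t ^ i * r ≤ t ^ i * suc t
  bernoulli t zero r e = ≤-reflexive (trans (+-identityʳ r) (trans (sym e) (sym (+-identityʳ (suc t)))))
  bernoulli t (suc i) r e = begin
    suc t * suc t ^ i * r      ≡⟨ l₁ (suc t) (suc t ^ i) r ⟩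
    suc t ^ i * (r + t * r)    ≤⟨ *-monoʳ-≤ (suc t ^ i) (+-monoˡ-≤ (t * r) r≤t) ⟩
    suc t ^ i * (t + t * r)    ≡⟨ l₂ (suc t ^ i) t r ⟩
    t * (suc t ^ i * suc r)    ≤⟨ *-monoʳ-≤ t (bernoulli t i (suc r) (trans e (sym (+-suc i r)))) ⟩
    t * (t ^ i * suc t)        ≡⟨ sym (*-assoc t (t ^ i) (suc t)) ⟩
    t * t ^ i * suc t          ∎
    where
    open ≤-Reasoning
    r≤t : r ≤ t
    r≤t = subst (r ≤_) (sym (suc-injective e)) (m≤n+m r i)
    l₁ : ∀ s x r → s * x * r ≡ x * (s * r)
    l₁ = solve-∀
    l₂ : ∀ x t r → x * (t + t * r) ≡ t * (x * suc r)
    l₂ = solve-∀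

  -- (1 + 1/t)^Q ≤ (j + 1)/j, a bound that telescopes along t ≥ Q (j + 1), Q (j + 2), ….
  suc^≤ : ∀ Q t j → Q * suc j ≤ t → suc t ^ Q * j ≤ t ^ Q * suc j
  suc^≤ Q t j h = *-cancelʳ-≤ _ _ (suc t) (begin
    suc t ^ Q * j * suc t         ≡⟨ *-assoc (suc t ^ Q) j (suc t) ⟩
    suc t ^ Q * (j * suc t)       ≤⟨ *-monoʳ-≤ (suc t ^ Q) j≤ ⟩
    suc t ^ Q * (suc j * r)       ≡⟨ l (suc t ^ Q) (suc j) r ⟩
    suc j * (suc t ^ Q * r)       ≤⟨ *-monoʳ-≤ (suc j) (bernoulli t Q r (sym Q+r)) ⟩
    suc j * (t ^ Q * suc t)       ≡⟨ l₂ (suc j) (t ^ Q) (suc t) ⟩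
    t ^ Q * suc j * suc t         ∎)
    where
    open ≤-Reasoning
    r = suc t ∸ Q
    Q≤ : Q ≤ suc t
    Q≤ = ≤-trans (m≤m*n Q (suc j)) (m≤n⇒m≤1+n h)
    Q+r : Q + r ≡ suc t
    Q+r = m+[n∸m]≡n Q≤
    j≤ : j * suc t ≤ suc j * r
    j≤ = +-cancelˡ-≤ (Q * suc j) _ _ (begin
      Q * suc j + j * suc t    ≤⟨ +-monoˡ-≤ (j * suc t) (m≤n⇒m≤1+n h) ⟩
      suc t + j * suc t        ≡⟨⟩
      suc j * suc t            ≡⟨ cong (suc j *_) (sym Q+r) ⟩
      suc j * (Q + r)          ≡⟨ l₃ j Q r ⟩
      Q * suc j + suc j * r    ∎)
      where
      l₃ : ∀ j Q r → suc j * (Q + r) ≡ Q * suc j + suc j * r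
      l₃ = solve-∀
    l : ∀ x y z → x * (y * z) ≡ y * (x * z)
    l = solve-∀
    l₂ : ∀ x y z → x * (y * z) ≡ y * x * z
    l₂ = solve-∀

  -- (1 + 1/t)^i ≤ 1 + i/t + (i/t)², which is at most 3.
  suc^≤quad : ∀ t i → i ≤ t → suc t ^ i * (t * t) ≤ t ^ i * (t * t + i * t + i * i)
  suc^≤quad t zero _ = ≤-reflexive (cong (1 *_) (trans (sym (+-identityʳ (t * t))) (sym (+-identityʳ (t * t + 0)))))
  suc^≤quad t (suc i) i<t = begin
    suc t * suc t ^ i * (t * t)                     ≡⟨ *-assoc (suc t) (suc t ^ i) (t * t) ⟩
    suc t * (suc t ^ i * (t * t))                   ≤⟨ *-monoʳ-≤ (suc t) (suc^≤quad t i (<⇒≤ i<t)) ⟩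
    suc t * (t ^ i * (t * t + i * t + i * i))       ≡⟨ l (suc t) (t ^ i) (t * t + i * t + i * i) ⟩
    t ^ i * (suc t * (t * t + i * t + i * i))       ≤⟨ *-monoʳ-≤ (t ^ i) step ⟩
    t ^ i * (t * (t * t + suc i * t + suc i * suc i)) ≡⟨ l₂ (t ^ i) t (t * t + suc i * t + suc i * suc i) ⟩
    t * t ^ i * (t * t + suc i * t + suc i * suc i) ∎
    where
    open ≤-Reasoning
    l : ∀ x y z → x * (y * z) ≡ y * (x * z)
    l = solve-∀
    l₂ : ∀ x y z → x * (y * z) ≡ y * x * z
    l₂ = solve-∀
    e₁ : ∀ t i → suc t * (t * t + i * t + i * i) ≡ t * t * t + i * (t * t) + i * i * t + t * t + i * t + i * i
    e₁ = solve-∀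
    e₂ : ∀ t i → t * t * t + i * (t * t) + i * i * t + t * t + i * t + (i * t + t) ≡ t *
        (t * t + suc i * t + suc i * suc i)
    e₂ = solve-∀
    step : suc t * (t * t + i * t + i * i) ≤ t * (t * t + suc i * t + suc i * suc i)
    step = subst₂ _≤_ (sym (e₁ t i)) (e₂ t i) (+-monoʳ-≤ (t * t * t + i * (t * t) + i * i * t + t * t + i * t)
        (≤-trans (*-monoʳ-≤ i (<⇒≤ i<t)) (m≤m+n (i * t) t)))

  suc^≤3 : ∀ Q t → Q ≤ t → suc t ^ Q ≤ 3 * t ^ Q
  suc^≤3 zero t _ = s≤s z≤n
  suc^≤3 Q@(suc _) t@(suc _) Q≤t = *-cancelʳ-≤ _ _ (t * t) (begin
    suc t ^ Q * (t * t)                        ≤⟨ suc^≤quad t Q Q≤t ⟩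
    t ^ Q * (t * t + Q * t + Q * Q)            ≤⟨ *-monoʳ-≤ (t ^ Q)
        (+-mono-≤ (+-monoʳ-≤ (t * t) (*-monoˡ-≤ t Q≤t)) (*-mono-≤ Q≤t Q≤t)) ⟩
    t ^ Q * (t * t + t * t + t * t)            ≡⟨ l (t ^ Q) (t * t) ⟩
    3 * t ^ Q * (t * t)                        ∎)
    where
    open ≤-Reasoning
    l : ∀ x y → x * (y + y + y) ≡ 3 * x * y
    l = solve-∀

  Sorted : List ℕ → Set
  Sorted = AllPairs _<_

  module ClassBound (Q : ℕ) (Q>0 : 0 < Q) where

    next : ∀ {p p′ j} → Q ∣ p ∸ 1 → Q ∣ p′ ∸ 1 → 0 < p → p < p′ → Q * j ≤ p ∸ 1 → Q * suc j ≤ p′ ∸ 1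
    next {suc t} {suc t′} {j} _ (divides k refl) _ (s≤s t<t′) h = subst (Q * suc j ≤_) (*-comm Q k)
      (*-monoʳ-≤ Q (*-cancelˡ-< Q j k (≤-<-trans h (subst (t <_) (*-comm k Q) t<t′))))

    -- The Q-th powers of the factors `p/(p - 1)` are at most `(j+1)/j`, `(j+2)/(j+1)` and so on,
    -- because successive `p - 1` are distinct multiples of `Q`. The product telescopes.
    tail : ∀ ps j → All (λ p → Q ∣ p ∸ 1) ps → All (0 <_) ps → Sorted ps → All (λ p → Q * suc j ≤ p ∸ 1) ps →
      product ps ^ Q * j ≤ product (preds ps) ^ Q * (j + length ps)
    tail [] j _ _ _ _ = ≤-reflexive (cong (1 ^ Q *_) (sym (+-identityʳ j)))
    tail (p@(suc t) ∷ ps) j (d ∷ ds) (p>0 ∷ pos) (lt ∷ srt) (h ∷ hs) = begin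
      (suc t * P) ^ Q * j                 ≡⟨ cong (_* j) (^-distribʳ-* Q (suc t) P) ⟩
      suc t ^ Q * P ^ Q * j               ≡⟨ l₁ (suc t ^ Q) (P ^ Q) j ⟩
      suc t ^ Q * j * P ^ Q               ≤⟨ *-monoˡ-≤ (P ^ Q) (suc^≤ Q t j h) ⟩
      t ^ Q * suc j * P ^ Q               ≡⟨ l₂ (t ^ Q) (suc j) (P ^ Q) ⟩
      t ^ Q * (P ^ Q * suc j)             ≤⟨ *-monoʳ-≤ (t ^ Q) (tail ps (suc j) ds pos srt (bump ds lt)) ⟩
      t ^ Q * (R ^ Q * (suc j + length ps)) ≡⟨ sym (*-assoc (t ^ Q) (R ^ Q) _) ⟩
      t ^ Q * R ^ Q * (suc j + length ps) ≡⟨ cong₂ _*_ (sym (^-distribʳ-* Q t R)) (sym (+-suc j (length ps))) ⟩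
      (t * R) ^ Q * (j + suc (length ps)) ∎
      where
      open ≤-Reasoning
      P = product ps
      R = product (preds ps)
      bump : ∀ {qs} → All (λ p → Q ∣ p ∸ 1) qs → All (p <_) qs → All (λ p → Q * suc (suc j) ≤ p ∸ 1) qs
      bump [] [] = []
      bump (e ∷ es) (l ∷ ls) = next d e p>0 l h ∷ bump es ls
      l₁ : ∀ x y z → x * y * z ≡ x * z * y
      l₁ = solve-∀
      l₂ : ∀ x y z → x * y * z ≡ x * (z * y)
      l₂ = solve-∀

    -- The least entry is only known to satisfy `p - 1 ≥ Q`, too little for telescoping; it costs
    -- the factor 3 of `suc^≤3`. The remaining entries telescope from `j = 1`.
    class : ∀ ps s → 0 < s → length ps ≤ s → All (λ p → Q ∣ p ∸ 1) ps → All (1 <_) ps → Sorted ps →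
      product ps ^ Q ≤ 3 * s * product (preds ps) ^ Q
    class [] s s>0 _ _ _ _ = m≤n*m (1 ^ Q) (3 * s) {{>-nonZero (*-pos {3} (s≤s z≤n) s>0)}}
    class (p@(suc t) ∷ ps) s s>0 len (d ∷ ds) (p>1 ∷ big) (lt ∷ srt) = begin
      (suc t * P) ^ Q                     ≡⟨ ^-distribʳ-* Q (suc t) P ⟩
      suc t ^ Q * P ^ Q                   ≤⟨ *-monoˡ-≤ (P ^ Q) (suc^≤3 Q t Q≤t) ⟩
      3 * t ^ Q * P ^ Q                   ≡⟨ cong (3 * t ^ Q *_) (sym (*-identityʳ (P ^ Q))) ⟩
      3 * t ^ Q * (P ^ Q * 1)             ≤⟨ *-monoʳ-≤ (3 * t ^ Q)
          (tail ps 1 ds (All.map (<-trans (s≤s z≤n)) big) srt (bump ds lt)) ⟩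
      3 * t ^ Q * (R ^ Q * suc (length ps)) ≤⟨ *-monoʳ-≤ (3 * t ^ Q) (*-monoʳ-≤ (R ^ Q) len) ⟩
      3 * t ^ Q * (R ^ Q * s)             ≡⟨ l (t ^ Q) (R ^ Q) s ⟩
      3 * s * (t ^ Q * R ^ Q)             ≡⟨ cong (3 * s *_) (sym (^-distribʳ-* Q t R)) ⟩
      3 * s * (t * R) ^ Q                 ∎
      where
      open ≤-Reasoning
      P = product ps
      R = product (preds ps)
      Q≤t : Q ≤ t
      Q≤t = ∣⇒≤′ (≤-pred p>1) d
      bump : ∀ {qs} → All (λ p → Q ∣ p ∸ 1) qs → All (p <_) qs → All (λ p → Q * 2 ≤ p ∸ 1) qs
      bump [] [] = []
      bump (e ∷ es) (l ∷ ls) = next d e (s≤s z≤n) l (subst (_≤ t) (sym (*-identityʳ Q)) Q≤t) ∷ bump es ls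
      l : ∀ x y s → 3 * x * (y * s) ≡ 3 * s * (x * y)
      l = solve-∀

  -- The number of divisors q, q r, q r t of m with r ≠ t taken from i further prime factors.
  G : ℕ → ℕ
  G zero = 1
  G (suc i) = G i + suc i

  i<G : ∀ i → i < G i
  i<G zero = s≤s z≤n
  i<G (suc i) = +-monoˡ-≤ (suc i) (≤-trans (s≤s z≤n) (i<G i))

  12G : ∀ i → 12 * G i ≡ 12 + 6 * i * suc i
  12G zero = refl
  12G (suc i) = trans (*-distribˡ-+ 12 (G i) (suc i)) (trans (cong (_+ 12 * suc i) (12G i)) (l i))
    where
    l : ∀ i → 12 + 6 * i * suc i + 12 * suc i ≡ 12 + 6 * suc i * suc (suc i)
    l = solve-∀

  -- The base inequalities are the cases i = 0, …, 3 of atG and i = 4 of large; from i = 4 on the factor 2^A lost by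
  -- doubling G is absorbed by b^6.
  module Growth (A b : ℕ) (b>0 : 0 < b) (base₀ : 3 ^ A ≤ b ^ 12) (base₁ : 6 ^ (A * 2) ≤ b ^ 24)
      (base₂ : 12 ^ (A * 3) ≤ b ^ 48)
    (base₃ : 21 ^ (A * 4) ≤ b ^ 84) (base₄ : 33 ^ A ≤ b ^ 24) (2^A≤ : 2 ^ A ≤ b ^ 6) where

    large : ∀ i → (3 * G (4 + i)) ^ A ≤ b ^ (6 * (4 + i))
    large zero = base₄
    large (suc i) = begin
      (3 * (G (4 + i) + (5 + i))) ^ A     ≤⟨ ^-monoˡ-≤ A (≤-trans (*-monoʳ-≤ 3 (+-monoʳ-≤ (G (4 + i)) (i<G (4 + i))))
          (≤-reflexive (l (G (4 + i))))) ⟩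
      (2 * (3 * G (4 + i))) ^ A           ≡⟨ ^-distribʳ-* A 2 (3 * G (4 + i)) ⟩
      2 ^ A * (3 * G (4 + i)) ^ A         ≤⟨ *-mono-≤ 2^A≤ (large i) ⟩
      b ^ 6 * b ^ (6 * (4 + i))           ≡⟨ sym (^-distribˡ-+-* b 6 (6 * (4 + i))) ⟩
      b ^ (6 + 6 * (4 + i))               ≡⟨ cong (b ^_) (sym (*-suc 6 (4 + i))) ⟩
      b ^ (6 * (5 + i))                   ∎
      where
      open ≤-Reasoning
      l : ∀ x → 3 * (x + x) ≡ 2 * (3 * x)
      l = solve-∀

    atG : ∀ i → (3 * G i) ^ (A * suc i) ≤ b ^ (12 * G i)
    atG 0 = subst (λ z → 3 ^ z ≤ b ^ 12) (sym (*-identityʳ A)) base₀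
    atG 1 = base₁
    atG 2 = base₂
    atG 3 = base₃
    atG (suc (suc (suc (suc i)))) = begin
      (3 * G j) ^ (A * suc j)             ≡⟨ sym (^-*-assoc (3 * G j) A (suc j)) ⟩
      ((3 * G j) ^ A) ^ suc j             ≤⟨ ^-monoˡ-≤ (suc j) (large i) ⟩
      (b ^ (6 * j)) ^ suc j               ≡⟨ ^-*-assoc b (6 * j) (suc j) ⟩
      b ^ (6 * j * suc j)                 ≤⟨ ^-monoʳ-≤ b {{>-nonZero b>0}} (m≤n+m (6 * j * suc j) 12) ⟩
      b ^ (12 + 6 * j * suc j)            ≡⟨ cong (b ^_) (sym (12G j)) ⟩
      b ^ (12 * G j)                      ∎
      where
      open ≤-Reasoning
      j = 4 + i

    -- Passing from `s` to `s + 1` multiplies the k-th power of `3 s` by at most 3, since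
    -- `k ≤ G i ≤ s`. The loss `3 ^ A` is paid for by the twelve new factors `b`.
    aboveG : ∀ i d → (3 * (d + G i)) ^ (A * suc i) ≤ b ^ (12 * (d + G i))
    aboveG i zero = atG i
    aboveG i (suc d) = begin
      (3 * suc s) ^ (A * k)                ≡⟨ trans (cong ((3 * suc s) ^_) (*-comm A k))
          (sym (^-*-assoc (3 * suc s) k A)) ⟩
      ((3 * suc s) ^ k) ^ A                ≤⟨ ^-monoˡ-≤ A inner ⟩
      (3 * (3 * s) ^ k) ^ A                ≡⟨ ^-distribʳ-* A 3 ((3 * s) ^ k) ⟩
      3 ^ A * ((3 * s) ^ k) ^ A            ≡⟨ cong (3 ^ A *_)
          (trans (^-*-assoc (3 * s) k A) (cong ((3 * s) ^_) (*-comm k A))) ⟩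
      3 ^ A * (3 * s) ^ (A * k)            ≤⟨ *-mono-≤ base₀ (aboveG i d) ⟩
      b ^ 12 * b ^ (12 * s)                ≡⟨ sym (^-distribˡ-+-* b 12 (12 * s)) ⟩
      b ^ (12 + 12 * s)                    ≡⟨ cong (b ^_) (sym (*-suc 12 s)) ⟩
      b ^ (12 * suc s)                     ∎
      where
      open ≤-Reasoning
      s = d + G i
      k = suc i
      inner : (3 * suc s) ^ k ≤ 3 * (3 * s) ^ k
      inner = begin
        (3 * suc s) ^ k        ≡⟨ ^-distribʳ-* k 3 (suc s) ⟩
        3 ^ k * suc s ^ k      ≤⟨ *-monoʳ-≤ (3 ^ k) (suc^≤3 k s (≤-trans (i<G i) (m≤n+m (G i) d))) ⟩
        3 ^ k * (3 * s ^ k)    ≡⟨ l (3 ^ k) (s ^ k) ⟩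
        3 * (3 ^ k * s ^ k)    ≡⟨ cong (3 *_) (sym (^-distribʳ-* k 3 s)) ⟩
        3 * (3 * s) ^ k        ∎
        where
        l : ∀ x y → x * (3 * y) ≡ 3 * (x * y)
        l = solve-∀

    bound : ∀ i s → G i ≤ s → (3 * s) ^ (A * suc i) ≤ b ^ (12 * s)
    bound i s h = subst (λ z → (3 * z) ^ (A * suc i) ≤ b ^ (12 * z)) (m∸n+n≡m h) (aboveG i (s ∸ G i))

    -- After a Q-th power with `Q = 2 * q` the class costs `3 * s`. The E-th power of this is at
    -- most `q^(12s)`, hence at most `X^(6q)`, which is the Q-th power of `X ^ 3`; this fixes the
    -- constant 12 in `bound`.
    classBound : ∀ {X q i s} ps → b ≤ q → G i ≤ s → q ^ (2 * s) ≤ X ^ q → length ps ≤ s →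
      All (λ p → 2 * q ∣ p ∸ 1) ps → All (1 <_) ps → Sorted ps →
      product ps ^ (A * suc i) ≤ X ^ 3 * product (preds ps) ^ (A * suc i)
    classBound {X} {q} {i} {s} ps b≤q G≤s hq len ds big srt = ^-cancelˡ-≤ Q Q>0 _ _ (begin
      (P ^ E) ^ Q                   ≡⟨ swap P E Q ⟩
      (P ^ Q) ^ E                   ≤⟨ ^-monoˡ-≤ E (ClassBound.class Q Q>0 ps s s>0 len ds big srt) ⟩
      (3 * s * R ^ Q) ^ E           ≡⟨ ^-distribʳ-* E (3 * s) (R ^ Q) ⟩
      (3 * s) ^ E * (R ^ Q) ^ E     ≤⟨ *-monoˡ-≤ ((R ^ Q) ^ E) (begin
        (3 * s) ^ E                 ≤⟨ bound i s G≤s ⟩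
        b ^ (12 * s)                ≤⟨ ^-monoˡ-≤ (12 * s) b≤q ⟩
        q ^ (12 * s)                ≡⟨ cong (q ^_) (l₁ s) ⟩
        q ^ (2 * s * 6)             ≡⟨ sym (^-*-assoc q (2 * s) 6) ⟩
        (q ^ (2 * s)) ^ 6           ≤⟨ ^-monoˡ-≤ 6 hq ⟩
        (X ^ q) ^ 6                 ≡⟨ ^-*-assoc X q 6 ⟩
        X ^ (q * 6)                 ≡⟨ cong (X ^_) (l₂ q) ⟩
        X ^ (3 * Q)                 ≡⟨ sym (^-*-assoc X 3 Q) ⟩
        (X ^ 3) ^ Q                 ∎) ⟩
      (X ^ 3) ^ Q * (R ^ Q) ^ E     ≡⟨ cong ((X ^ 3) ^ Q *_) (sym (swap R E Q)) ⟩
      (X ^ 3) ^ Q * (R ^ E) ^ Q     ≡⟨ sym (^-distribʳ-* Q (X ^ 3) (R ^ E)) ⟩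
      (X ^ 3 * R ^ E) ^ Q           ∎)
      where
      open ≤-Reasoning
      P = product ps
      R = product (preds ps)
      E = A * suc i
      Q = 2 * q
      Q>0 : 0 < Q
      Q>0 = *-pos {2} (s≤s z≤n) (<-≤-trans b>0 b≤q)
      s>0 : 0 < s
      s>0 = ≤-trans (≤-trans (s≤s z≤n) (i<G i)) G≤s
      swap : ∀ x e f → (x ^ e) ^ f ≡ (x ^ f) ^ e
      swap x e f = trans (^-*-assoc x e f) (trans (cong (x ^_) (*-comm e f)) (sym (^-*-assoc x f e)))
      l₁ : ∀ s → 12 * s ≡ 2 * s * 6
      l₁ = solve-∀
      l₂ : ∀ q → q * 6 ≡ 3 * (2 * q)
      l₂ = solve-∀

  product-filter : ∀ {P : ℕ → Set} (P? : ∀ x → Dec (P x)) (h : ℕ → ℕ) ps →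
    product (map h ps) ≡ product (map h (filter P? ps)) * product (map h (filter (¬? ∘ P?) ps))
  product-filter P? h [] = refl
  product-filter P? h (p ∷ ps) with P? p
  ... | yes _ = trans (cong (h p *_) (product-filter P? h ps)) (sym (*-assoc (h p) _ _))
  ... | no _ = trans (cong (h p *_) (product-filter P? h ps)) (l (h p) (product (map h (filter P? ps))) _)
    where
    l : ∀ x y z → x * (y * z) ≡ y * (x * z)
    l = solve-∀

  module Cover (E Y : ℕ) (Good : ℕ → Set) where

    Bounded : ℕ → Set
    Bounded q = ∀ ps → All Good ps → Sorted ps → All (λ p → q ∣ p ∸ 1) ps → product ps ^ E ≤ Y * product (preds ps) ^
        E

    -- Each prime is charged to the first `q` of the list dividing `p - 1`, so overlaps between
    -- classes cost nothing. This is why `Bounded` quantifies over arbitrary lists of such primes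
    -- and not over the full class.
    cover : ∀ qs → All Bounded qs → ∀ ps → All Good ps → Sorted ps → All (λ p → Any (λ q → q ∣ p ∸ 1) qs) ps →
      product ps ^ E ≤ Y ^ length qs * product (preds ps) ^ E
    cover [] _ [] _ _ _ = m≤n*m (1 ^ E) 1
    cover [] _ (p ∷ ps) _ _ (() ∷ _)
    cover (q ∷ qs) (h ∷ hs) ps good srt cov = begin
      product ps ^ E                      ≡⟨ cong (_^ E) (trans (cong product (sym (map-id ps)))
          (product-filter q? (λ x → x) ps)) ⟩
      (product (map (λ x → x) ps₁) * product (map (λ x → x) ps₂)) ^ E ≡⟨ cong₂ (λ x y → (product x * product y) ^ E)
          (map-id ps₁) (map-id ps₂) ⟩
      (product ps₁ * product ps₂) ^ E     ≡⟨ ^-distribʳ-* E (product ps₁) (product ps₂) ⟩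
      product ps₁ ^ E * product ps₂ ^ E   ≤⟨ *-mono-≤
          (h ps₁ (Allₚ.filter⁺ q? good) (AllPairsₚ.filter⁺ q? srt) (Allₚ.all-filter q? ps))
          (cover qs hs ps₂ (Allₚ.filter⁺ (¬? ∘ q?) good) (AllPairsₚ.filter⁺ (¬? ∘ q?) srt)
              (All.zipWith (λ {p} → rest {p}) (Allₚ.filter⁺ (¬? ∘ q?) cov , Allₚ.all-filter (¬? ∘ q?) ps))) ⟩
      Y * R₁ ^ E * (Y ^ length qs * R₂ ^ E) ≡⟨ l Y (R₁ ^ E) (Y ^ length qs) (R₂ ^ E) ⟩
      Y * Y ^ length qs * (R₁ ^ E * R₂ ^ E) ≡⟨ cong (Y * Y ^ length qs *_)
          (trans (sym (^-distribʳ-* E R₁ R₂)) (cong (_^ E) (sym (product-filter q? (_∸ 1) ps)))) ⟩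
      Y * Y ^ length qs * product (preds ps) ^ E ∎
      where
      open ≤-Reasoning
      q? : ∀ p → Dec (q ∣ p ∸ 1)
      q? p = q ∣? (p ∸ 1)
      ps₁ = filter q? ps
      ps₂ = filter (¬? ∘ q?) ps
      R₁ = product (preds ps₁)
      R₂ = product (preds ps₂)
      rest : ∀ {p} → Any (λ q′ → q′ ∣ p ∸ 1) (q ∷ qs) × ¬ q ∣ p ∸ 1 → Any (λ q′ → q′ ∣ p ∸ 1) qs
      rest (here d , nd) = ⊥-elim (nd d)
      rest (there a , _) = a
      l : ∀ x y z w → x * y * (z * w) ≡ x * z * (y * w)
      l = solve-∀

  -- A form of `(M/φ(M))^4 ≤ (d/c) M`, in which prime factors can be added one at a time.
  Cubic : ℕ → ℕ → ℕ → Set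
  Cubic c d M = c * M ^ 3 ≤ d * φ M ^ 4

  -- From `p = 5` on `p^3 ≤ (p - 1)^4`, so no new prime costs anything; only 2 and 3 violate this.
  cubic-rough : ∀ {M} → 0 < M → ¬ 2 ∣ M → ¬ 3 ∣ M → Cubic 1 1 M
  cubic-rough {M} M>0 2∤M 3∤M with factorise M {{>-nonZero M>0}}
  ... | record { factors = ps ; isFactorisation = refl ; factorsPrime = prs } = go prs 2∤M 3∤M
    where
    scale : ∀ x M f y → x ^ 3 ≤ y ^ 4 → 1 * M ^ 3 ≤ 1 * f ^ 4 → 1 * (x * M) ^ 3 ≤ 1 * (y * f) ^ 4
    scale x M f y h₁ h₂ = subst₂ _≤_ (l 3 x M) (l 4 y f) (*-mono-≤ h₁ h₂)
      where
      l : ∀ k x y → x ^ k * (1 * y ^ k) ≡ 1 * (x * y) ^ k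
      l k x y = trans (cong (x ^ k *_) (*-identityˡ (y ^ k)))
          (trans (sym (^-distribʳ-* k x y)) (sym (*-identityˡ ((x * y) ^ k))))
    pow : ∀ p → 5 ≤ p → p ^ 3 ≤ (p ∸ 1) ^ 4
    pow (suc (suc (suc (suc (suc k))))) (s≤s (s≤s (s≤s (s≤s (s≤s _))))) = subst ((5 + k) ^ 3 ≤_) (l k)
        (m≤m+n _ (k * k * k * k + 15 * (k * k * k) + 81 * (k * k) + 181 * k + 131))
      where
      l : ∀ k → (5 + k) * ((5 + k) * ((5 + k) * 1)) + (k * k * k * k + 15 * (k * k * k) + 81 * (k * k) + 181 * k +
          131) ≡ (4 + k) * ((4 + k) * ((4 + k) * ((4 + k) * 1)))
      l = solve-∀
    go : ∀ {ps} → All Prime ps → ¬ 2 ∣ product ps → ¬ 3 ∣ product ps → Cubic 1 1 (product ps)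
    go [] _ _ = ≤-refl
    go {p ∷ ps} (pr ∷ prs) n2 n3 with p ∣? product ps
    ... | yes d = subst (λ z → 1 * (p * product ps) ^ 3 ≤ 1 * z ^ 4) (sym (φ-*-∣ pr d))
       (scale p (product ps) (φ (product ps)) p (^-monoʳ-≤ p {{>-nonZero (prime>0 pr)}} (n≤1+n 3))
           (go prs (n2 ∘ ∣n⇒∣m*n p) (n3 ∘ ∣n⇒∣m*n p)))
    ... | no d = subst (λ z → 1 * (p * product ps) ^ 3 ≤ 1 * z ^ 4) (sym (φ-*-∤ pr d))
       (scale p (product ps) (φ (product ps)) (p ∸ 1) (pow p
           (odd-prime≥5 pr (λ { refl → n2 (m∣m*n (product ps)) }) (λ { refl → n3 (m∣m*n (product ps)) })))
           (go prs (n2 ∘ ∣n⇒∣m*n p) (n3 ∘ ∣n⇒∣m*n p)))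

  -- The prime costs the factor `p^3/(p - 1)^4` once; its higher powers are free, because
  -- `x^3 ≤ x^4`.
  cubic-^ : ∀ {p M c d} → Prime p → ¬ p ∣ M → Cubic c d M → ∀ j → Cubic (c * (p ∸ 1) ^ 4) (d * p ^ 3) (p ^ suc j * M)
  cubic-^ {p} {M} {c} {d} pr p∤M h j = begin
    c * (p ∸ 1) ^ 4 * (p * p ^ j * M) ^ 3            ≡⟨ e₁ ⟩
    (p ^ 3 * (p ∸ 1) ^ 4 * (p ^ j) ^ 3) * (c * M ^ 3)  ≤⟨ *-mono-≤
        (*-monoʳ-≤ (p ^ 3 * (p ∸ 1) ^ 4) (^-monoʳ-≤ (p ^ j) {{>-nonZero (^-pos j (prime>0 pr))}} (n≤1+n 3))) h ⟩
    (p ^ 3 * (p ∸ 1) ^ 4 * (p ^ j) ^ 4) * (d * φ M ^ 4) ≡⟨ e₂ ⟩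
    d * p ^ 3 * (p ^ j * ((p ∸ 1) * φ M)) ^ 4        ≡⟨ cong (λ z → d * p ^ 3 * z ^ 4) (sym (φ-^-* pr p∤M j)) ⟩
    d * p ^ 3 * φ (p ^ suc j * M) ^ 4                ∎
    where
    open ≤-Reasoning
    e₁ : c * (p ∸ 1) ^ 4 * (p * p ^ j * M) ^ 3 ≡ (p ^ 3 * (p ∸ 1) ^ 4 * (p ^ j) ^ 3) * (c * M ^ 3)
    e₁ = trans (cong (c * (p ∸ 1) ^ 4 *_) (trans (^-distribʳ-* 3 (p * p ^ j) M)
        (cong (_* M ^ 3) (^-distribʳ-* 3 p (p ^ j)))))
      (l c ((p ∸ 1) ^ 4) (p ^ 3) ((p ^ j) ^ 3) (M ^ 3))
      where
      l : ∀ c q p x M → c * q * (p * x * M) ≡ (p * q * x) * (c * M)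
      l = solve-∀
    e₂ : (p ^ 3 * (p ∸ 1) ^ 4 * (p ^ j) ^ 4) * (d * φ M ^ 4) ≡ d * p ^ 3 * (p ^ j * ((p ∸ 1) * φ M)) ^ 4
    e₂ = trans (l (p ^ 3) ((p ∸ 1) ^ 4) ((p ^ j) ^ 4) d (φ M ^ 4))
      (cong (d * p ^ 3 *_) (trans (cong ((p ^ j) ^ 4 *_) (sym (^-distribʳ-* 4 (p ∸ 1) (φ M))))
          (sym (^-distribʳ-* 4 (p ^ j) ((p ∸ 1) * φ M)))))
      where
      l : ∀ p q x d f → (p * q * x) * (d * f) ≡ d * p * (x * (q * f))
      l = solve-∀

  -- The primes 2 and 3 cost the factors 8 and 27/16, whose product is 27/2.
  2U³≤27φ⁴ : ∀ {U} → 0 < U → 2 * U ^ 3 ≤ 27 * φ U ^ 4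
  2U³≤27φ⁴ {U} U>0 with strip (prime>1 prime[2]) U U>0
  ... | i , U₁ , refl , 2∤U₁ with strip (prime>1 prime[3]) U₁ (*-posʳ (2 ^ i) U>0)
  ... | j , M , refl , 3∤M = two i
    where
    three : ∀ j → Cubic 1 1 M → Cubic 16 27 (3 ^ j * M)
    three zero h = subst (Cubic 16 27) (sym (+-identityʳ M))
        (≤-trans (*-monoʳ-≤ 16 (subst₂ _≤_ (*-identityˡ (M ^ 3)) (*-identityˡ (φ M ^ 4)) h))
        (*-monoˡ-≤ (φ M ^ 4) (m≤m+n 16 11)))
    three (suc j) h = cubic-^ {c = 1} {1} prime[3] 3∤M h j
    M-odd : ¬ 2 ∣ M
    M-odd d = 2∤U₁ (∣n⇒∣m*n (3 ^ j) d)
    M>0 : 0 < M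
    M>0 = *-posʳ (3 ^ j) (*-posʳ (2 ^ i) U>0)
    c₃ : Cubic 16 27 (3 ^ j * M)
    c₃ = three j (cubic-rough M>0 M-odd 3∤M)
    two : ∀ i → 2 * (2 ^ i * (3 ^ j * M)) ^ 3 ≤ 27 * φ (2 ^ i * (3 ^ j * M)) ^ 4
    two zero = subst (Cubic 2 27) (sym (+-identityʳ (3 ^ j * M)))
        (≤-trans (*-monoˡ-≤ ((3 ^ j * M) ^ 3) {2} {16} (m≤m+n 2 14)) c₃)
    two (suc i) = *-cancelˡ-≤ 8 (subst₂ _≤_ (l₁ ((2 ^ suc i * (3 ^ j * M)) ^ 3))
        (l₂ (φ (2 ^ suc i * (3 ^ j * M)) ^ 4)) (cubic-^ {c = 16} {27} prime[2] 2∤U₁ c₃ i))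
      where
      l₁ : ∀ x → 16 * 1 * x ≡ 8 * (2 * x)
      l₁ = solve-∀
      l₂ : ∀ x → 27 * 8 * x ≡ 8 * (27 * x)
      l₂ = solve-∀

-- Lists of distinct prime divisors, and size estimates for products of two or three primes.

module DistinctPrimes where

  open import Data.Nat
  open import Data.Nat.Properties
  open import Data.Nat.Divisibility
  open Totient
  open TotientRatio using (Sorted)

  primesOf : ℕ → List ℕ
  primesOf M = filter (λ p → prime? p ×-dec (p ∣? M)) (upTo (suc M))

  primesOf-sorted : ∀ M → Sorted (primesOf M)
  primesOf-sorted M = AllPairsₚ.filter⁺ (λ p → prime? p ×-dec (p ∣? M))
      (AllPairsₚ.applyUpTo⁺₁ (λ x → x) (suc M) (λ i<j _ → i<j))

  primesOf-all : ∀ M → All (λ p → Prime p × p ∣ M) (primesOf M)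
  primesOf-all M = Allₚ.all-filter (λ p → prime? p ×-dec (p ∣? M)) (upTo (suc M))

  primesOf-complete : ∀ {M p} → 0 < M → Prime p → p ∣ M → p ∈ primesOf M
  primesOf-complete {M} M>0 pr d = ∈-filter⁺ (λ p → prime? p ×-dec (p ∣? M)) (∈-upTo⁺ (s≤s (∣⇒≤′ M>0 d))) (pr , d)

  Sorted⇒Unique : ∀ {ps} → Sorted ps → Unique ps
  Sorted⇒Unique = AllPairs.map <⇒≢

  ∈⇒∣product : ∀ {p} {ps : List ℕ} → p ∈ ps → p ∣ product ps
  ∈⇒∣product {p} {_ ∷ ps} (here refl) = m∣m*n (product ps)
  ∈⇒∣product {ps = q ∷ ps} (there i) = ∣n⇒∣m*n q (∈⇒∣product i)

  squarefree⇒product : ∀ {M} → 0 < M → (∀ p → Prime p → ¬ p * p ∣ M) → product (primesOf M) ≡ M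
  squarefree⇒product {M} M>0 sqf with product-∣ (All.map proj₁ (primesOf-all M)) (Sorted⇒Unique (primesOf-sorted M))
      (All.map proj₂ (primesOf-all M))
  ... | divides k eq = sym (trans eq (trans (cong (_* product (primesOf M)) k≡1) (*-identityˡ _)))
    where
    k≡1 : k ≡ 1
    k≡1 = noPrimeDivisor⇒≡1 (*-posˡ (product (primesOf M)) (subst (0 <_) eq M>0)) λ p pr d →
      sqf p pr (subst (p * p ∣_) (sym eq) (*-pres-∣ d (∈⇒∣product
          (primesOf-complete M>0 pr (subst (p ∣_) (sym eq) (∣m⇒∣m*n (product (primesOf M)) d))))))

  others : ℕ → List ℕ → List ℕ
  others q = filter (λ x → ¬? (x ≟ q))

  length-others : ∀ {q qs} → Unique qs → q ∈ qs → suc (length (others q qs)) ≡ length qs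
  length-others {q} {x ∷ qs} (ne ∷ u) i with x ≟ q
  ... | yes refl = cong (suc ∘ length) (trans (filter-reject (λ y → ¬? (y ≟ x)) {x} {qs} (λ n → n refl))
    (filter-all (λ y → ¬? (y ≟ x)) (All.map (λ n e → n (sym e)) ne)))
  ... | no x≢q = trans (cong (suc ∘ length) (filter-accept (λ y → ¬? (y ≟ q)) {x} {qs} x≢q))
      (cong suc (length-others u (later i)))
    where
    later : q ∈ x ∷ qs → q ∈ qs
    later (here e) = ⊥-elim (x≢q (sym e))
    later (there i) = i

  gcd-∣-left : ∀ {e b F} → Prime b → ¬ b ∣ F → gcd (e * b) F ∣ e
  gcd-∣-left {e} {b} {F} pr b∤F = coprime-divisor {gcd (e * b) F} {b} {e} cp
      (subst (gcd (e * b) F ∣_) (*-comm e b) (gcd[m,n]∣m (e * b) F))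
    where
    cp : Coprime (gcd (e * b) F) b
    cp {d} (d∣g , d∣b) = [ (λ z → z) , (λ { refl → ⊥-elim (b∤F (∣-trans d∣g (gcd[m,n]∣n (e * d) F))) }) ]′
        (prime⇒irreducible pr d∣b)

  pair-size : ∀ {q b} → 3 ≤ q → 3 ≤ b → sum (q ∷ b ∷ []) + 2 ≤ q * b
  pair-size {q} {b} hq hb = subst₂ (λ x y → sum (x ∷ y ∷ []) + 2 ≤ x * y) (m∸n+n≡m hq) (m∸n+n≡m hb)
      (go (q ∸ 3) (b ∸ 3))
    where
    l : ∀ i j → ((i + 3) + ((j + 3) + 0)) + 2 + (i * j + 2 * i + 2 * j + 1) ≡ (i + 3) * (j + 3)
    l = solve-∀
    go : ∀ i j → sum (i + 3 ∷ j + 3 ∷ []) + 2 ≤ (i + 3) * (j + 3)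
    go i j = subst (sum (i + 3 ∷ j + 3 ∷ []) + 2 ≤_) (l i j) (m≤m+n _ _)

  -- This and `pair-size` are what `freshPrime` needs; the summand 2 is the exponent lost in
  -- `T-lower`. Three factors 3 would fail, since 9 + 9 + 9 + 2 exceeds 27, so one of the two
  -- distinct primes has to be at least 5.
  triple-size : ∀ {q b c} → 3 ≤ q → 3 ≤ b → 3 ≤ c → 5 ≤ b ⊎ 5 ≤ c → sum (q * b ∷ q * c ∷ b * c ∷ []) + 2 ≤ q * b * c
  triple-size {q} {b} {c} hq hb hc (inj₂ hc′) = subst₂ (λ x y → sum (x * b ∷ x * y ∷ b * y ∷ []) + 2 ≤ x * b * y)
      (m∸n+n≡m hq) (m∸n+n≡m hc′)
     (subst (λ z → sum ((q ∸ 3 + 3) * z ∷ (q ∸ 3 + 3) * (c ∸ 5 + 5) ∷ z * (c ∸ 5 + 5) ∷ []) + 2 ≤ (q ∸ 3 + 3) * z *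
         (c ∸ 5 + 5)) (m∸n+n≡m hb) (go (q ∸ 3) (b ∸ 3) (c ∸ 5)))
    where
    l : ∀ i j k → ((i + 3) * (j + 3) + ((i + 3) * (k + 5) + ((j + 3) * (k + 5) + 0))) + 2 +
        (i * j * k + 4 * (i * j) + 2 * (i * k) + 2 * (j * k) + 7 * i + 7 * j + 3 * k + 4) ≡ (i + 3) * (j + 3) *
        (k + 5)
    l = solve-∀
    go : ∀ i j k → sum ((i + 3) * (j + 3) ∷ (i + 3) * (k + 5) ∷ (j + 3) * (k + 5) ∷ []) + 2 ≤ (i + 3) * (j + 3) *
        (k + 5)
    go i j k = subst (sum ((i + 3) * (j + 3) ∷ (i + 3) * (k + 5) ∷ (j + 3) * (k + 5) ∷ []) + 2 ≤_) (l i j k)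
        (m≤m+n _ _)
  triple-size {q} {b} {c} hq hb hc (inj₁ hb′) = subst₂ _≤_ (l₁ q b c) (l₂ q b c)
      (triple-size {q} {c} {b} hq hc hb (inj₂ hb′))
    where
    l₁ : ∀ q b c → (q * c + (q * b + (c * b + 0))) + 2 ≡ (q * b + (q * c + (b * c + 0))) + 2
    l₁ = solve-∀
    l₂ : ∀ q b c → q * c * b ≡ q * b * c
    l₂ = solve-∀

-- The equation with coprime bases and coprime exponents.

module CoprimeExponents where

  open import Data.Nat
  open import Data.Nat.Properties
  open import Data.Nat.Divisibility
  open import Data.Integer as ℤ using (ℤ; ∣_∣; 0ℤ; 1ℤ) renaming (+_ to pos)
  open Totient
  open PowerDifferences

  2∣prime∸1 : ∀ {p} → Prime p → ¬ p ≡ 2 → 2 ∣ p ∸ 1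
  2∣prime∸1 {p} pr p≢2 with odd⇒suc {p} (λ d → p≢2 (sym (prime∣prime prime[2] pr d)))
  ... | k , refl = m∣m*n k

  V≡V1*T : ∀ a b k → V a b k ≡ V a b 1 * T a b 1 k
  V≡V1*T a b k = trans (cong (V a b) (sym (*-identityˡ k))) (V-* a b 1 k)

  2∣V : ∀ a b k → ¬ 2 ∣ ∣ a ∣ → ¬ 2 ∣ ∣ b ∣ → 2 ∣ V a b k
  2∣V a b k a-odd b-odd = ∣-trans (fromS (subst (pos 2 S.∣_) (l a b) (S.∣m∣n⇒∣m-n (odd-1 a a-odd) (odd-1 b b-odd))))
      (V-∣ a b (1∣ k))
    where
    l : ∀ x y → (x ℤ.- 1ℤ) ℤ.- (y ℤ.- 1ℤ) ≡ x ℤ.* 1ℤ ℤ.- y ℤ.* 1ℤ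
    l = ℤSolver.solve-∀
    l₂ : ∀ i → i ℤ.* (i ℤ.* 1ℤ) ℤ.- i ≡ i ℤ.* (i ℤ.- 1ℤ)
    l₂ = ℤSolver.solve-∀
    odd-1 : ∀ i → ¬ 2 ∣ ∣ i ∣ → pos 2 S.∣ i ℤ.- 1ℤ
    odd-1 i i-odd = [ (λ x → ⊥-elim (i-odd x)) , toS ]′ (euclidℤ prime[2] i (i ℤ.- 1ℤ)
        (fromS (subst (pos 2 S.∣_) (l₂ i) (fermatℤ prime[2] i))))

  pow-split : ∀ p c v k → (p ^ c * v) ^ k ≡ p ^ (k * c) * v ^ k
  pow-split p c v k = trans (^-distribʳ-* k (p ^ c) v) (cong (_* v ^ k)
      (trans (^-*-assoc p c k) (cong (p ^_) (*-comm c k))))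

  module Equation (a b : ℤ) (g m n : ℕ) (A>0 : 0 < ∣ a ∣) (B>0 : 0 < ∣ b ∣) (cop : Cop a b) (g>0 : 0 < g)
    (gcd≡1 : gcd m n ≡ 1) (n>0 : 0 < n) (n<m : n < m) (Vm>0 : 0 < V a b m)
    (eq : φ (g ^ m * V a b m) ≡ g ^ n * V a b n) where

    N : ℕ
    N = g ^ m * V a b m

    m>0 : 0 < m
    m>0 = <-trans n>0 n<m

    m>1 : 1 < m
    m>1 = ≤-<-trans n>0 n<m

    N>0 : 0 < N
    N>0 = *-pos (^-pos m g>0) Vm>0

    V1>0 : 0 < V a b 1
    V1>0 = ∣-pos Vm>0 (V-∣ a b (1∣ m))

    not-both-even : 2 ∣ m → 2 ∣ n → ⊥
    not-both-even dm dn = prime∤1 prime[2] (subst (2 ∣_) gcd≡1 (gcd-greatest dm dn))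

    V-coprime : ∀ {p} → Prime p → p ∣ V a b m → p ∣ V a b n → p ∣ V a b 1
    V-coprime {p} pr dm dn = subst (λ k → p ∣ V a b k) gcd≡1 (V-gcd cop pr m n m>0 dm dn)

    -- The exponent of `p` in `g`, with cofactor `g′`.
    c : ∀ {p} → Prime p → ℕ
    c pr = proj₁ (strip (prime>1 pr) g g>0)

    g′ : ∀ {p} → Prime p → ℕ
    g′ pr = proj₁ (proj₂ (strip (prime>1 pr) g g>0))

    g≡ : ∀ {p} (pr : Prime p) → g ≡ p ^ c pr * g′ pr
    g≡ pr = proj₁ (proj₂ (proj₂ (strip (prime>1 pr) g g>0)))

    p∤g′ : ∀ {p} (pr : Prime p) → ¬ p ∣ g′ pr
    p∤g′ pr = proj₂ (proj₂ (proj₂ (strip (prime>1 pr) g g>0)))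

    ^∣N : ∀ {p} (pr : Prime p) f → p ^ f ∣ V a b m → p ^ (m * c pr + f) ∣ N
    ^∣N {p} pr f d = subst₂ _∣_ (sym (^-distribˡ-+-* p (m * c pr) f)) refl
      (*-pres-∣ (subst (λ z → p ^ (m * c pr) ∣ z ^ m) (sym (g≡ pr))
          (subst (p ^ (m * c pr) ∣_) (sym (pow-split p (c pr) (g′ pr) m)) (m∣m*n (g′ pr ^ m)))) d)

    ^∣φN : ∀ {p} (pr : Prime p) J → p ^ J ∣ φ N → p ^ J ∣ p ^ (n * c pr) * V a b n
    ^∣φN {p} pr J d = p^∣*-cancelʳ pr (λ x → p∤g′ pr (prime∣^ pr (g′ pr) n x)) J _
      (subst (p ^ J ∣_) (trans eq (trans (cong (λ z → z ^ n * V a b n) (g≡ pr))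
          (trans (cong (_* V a b n) (pow-split p (c pr) (g′ pr) n)) (l (p ^ (n * c pr)) (g′ pr ^ n) (V a b n))))) d)
      where
      l : ∀ a b c → a * b * c ≡ a * c * b
      l = solve-∀

    -- The prime `p` of `g` counts `m` times in `N` but only `n < m` times on the other side of the
    -- equation. Against `^∣N` and `q^∣φ` this leaves almost no freedom.
    ^∣φN⇒≤ : ∀ {p} (pr : Prime p) J f v → V a b n ≡ p ^ f * v → ¬ p ∣ v → p ^ J ∣ φ N → J ≤ n * c pr + f
    ^∣φN⇒≤ {p} pr J f v Veq p∤v d = p^∣⇒≤ pr p∤v J (n * c pr + f)
      (subst (p ^ J ∣_) (trans (cong (p ^ (n * c pr) *_) Veq)
          (trans (sym (*-assoc (p ^ (n * c pr)) (p ^ f) v)) (cong (_* v) (sym (^-distribˡ-+-* p (n * c pr) f)))))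
          (^∣φN pr J d))

    -- One of a, b is even, so V is odd: any odd prime factor of V m would make φ N more divisible by 2 than g^n V n.
    evenBase-impossible : (2 ∣ ∣ a ∣) ⊎ (2 ∣ ∣ b ∣) → ⊥
    evenBase-impossible even = V≢1 a b m A>0 B>0 m>1 (noPrimeDivisor⇒≡1 Vm>0 none)
      where
      c₂ = c prime[2]
      V-odd : ∀ k → 0 < k → ¬ 2 ∣ V a b k
      V-odd k k>0 d = [ V-∤a cop prime[2] k>0 d , V-∤b cop prime[2] k>0 d ]′ even
      none : ∀ p → Prime p → ¬ p ∣ V a b m
      none p pr d with p ≟ 2
      ... | yes refl = V-odd m m>0 d
      ... | no p≢2 = <⇒≱ bad (^∣φN⇒≤ prime[2] (suc (J ∸ 1)) 0 (V a b n) (sym (+-identityʳ _)) (V-odd n n>0)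
              (∣-trans (subst (_∣ 2 ^ (J ∸ 1) * ((p ∸ 1) * 1)) (*-comm (2 ^ (J ∸ 1)) 2)
                  (*-monoʳ-∣ (2 ^ (J ∸ 1)) (∣m⇒∣m*n 1 (2∣prime∸1 pr p≢2))))
              (q^∣φ prime[2] N>0 J (^∣N prime[2] 0 (1∣ _)) (pr ∷ []) ([] ∷ []) (∣n⇒∣m*n (g ^ m) d ∷ []) (p≢2 ∷ []))))
        where
        J = m * c₂ + 0
        bad : n * c₂ + 0 < suc (J ∸ 1)
        bad with c₂
        ... | zero rewrite *-zeroʳ n = s≤s z≤n
        ... | suc c = ≤-trans (+-monoˡ-< 0 (*-monoˡ-< (suc c) n<m)) (≤-trans (m≤n+m∸n _ 1) ≤-refl)

    -- Both bases odd: even `m`, and odd `m` with odd `n`.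

    module BothOdd (a-odd : ¬ 2 ∣ ∣ a ∣) (b-odd : ¬ 2 ∣ ∣ b ∣) where

      c₂ = c prime[2]

      2∣V1 : 2 ∣ V a b 1
      2∣V1 = 2∣V a b 1 a-odd b-odd

      f v : ℕ
      f = proj₁ (strip (prime>1 prime[2]) (V a b 1) V1>0)
      v = proj₁ (proj₂ (strip (prime>1 prime[2]) (V a b 1) V1>0))

      V1≡ : V a b 1 ≡ 2 ^ f * v
      V1≡ = proj₁ (proj₂ (proj₂ (strip (prime>1 prime[2]) (V a b 1) V1>0)))

      v-odd : ¬ 2 ∣ v
      v-odd = proj₂ (proj₂ (proj₂ (strip (prime>1 prime[2]) (V a b 1) V1>0)))

      f>0 : 0 < f
      f>0 = p^∣⇒≤ prime[2] v-odd 1 f (subst (2 ∣_) V1≡ 2∣V1)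

      -- The cofactor is congruent to `k` times a power of `b` modulo 2, so for odd `k` all factors
      -- 2 of `V a b k` lie in `V a b 1`.
      T-odd : ∀ k → ¬ 2 ∣ k → ¬ 2 ∣ T a b 1 k
      T-odd k ok d = ok (T-mod {a} {b} cop prime[2] 1 k (s≤s z≤n) 2∣V1 d)

      2^∣φN⇒≤ : ¬ 2 ∣ n → ∀ J → 2 ^ J ∣ φ N → J ≤ n * c₂ + f
      2^∣φN⇒≤ n-odd J = ^∣φN⇒≤ prime[2] J f (v * T a b 1 n)
        (trans (V≡V1*T a b n) (trans (cong (_* T a b 1 n) V1≡) (*-assoc (2 ^ f) v (T a b 1 n))))
            (prime∤* prime[2] v-odd (T-odd n n-odd))

      2^f∣Vm : 2 ^ f ∣ V a b m
      2^f∣Vm = ∣-trans (subst (2 ^ f ∣_) (sym V1≡) (m∣m*n v)) (V-∣ a b (1∣ m))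

      -- An even `m` gives `V a b m` at least one factor 2 more than `V a b n`, and φ loses only
      -- one. No room is left for an odd prime or for an even `g`, so `g = 1` and `V a b m` is a
      -- power of 2. The odd cofactor `T a b 1 n` must be 1; then `V a b m` is twice `V a b 1`,
      -- which leaves `∣a + b∣ = 2` and `V a b m = V a b 2`. Growth in the exponent yields `n = 1`
      -- and `m = 2`.
      evenExponent : 2 ∣ m → ∃ λ K → g ≡ 1 × m ≡ 2 × n ≡ 1 × ∣ a ℤ.+ b ∣ ≡ 2 × V a b 1 ≡ 2 ^ K
      evenExponent 2∣m = K ∸ 1 , g≡1 , m≡2 , n≡1 , ∣a+b∣≡2 , V1≡2^
        where
        n-odd : ¬ 2 ∣ n
        n-odd = not-both-even 2∣m
        2∣T2 : 2 ∣ T a b 1 2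
        2∣T2 = T-mod⁻ a b 1 2 2∣V1 ∣-refl
        2^∣Vm : 2 ^ suc f ∣ V a b m
        2^∣Vm = ∣-trans (subst₂ _∣_ (*-comm (2 ^ f) 2) (sym (V≡V1*T a b 2))
            (*-pres-∣ (subst (2 ^ f ∣_) (sym V1≡) (m∣m*n v)) 2∣T2)) (V-∣ a b 2∣m)
        J = m * c₂ + suc f
        2^J∣N : 2 ^ J ∣ N
        2^J∣N = ^∣N prime[2] (suc f) 2^∣Vm
        J≡ : J ∸ 1 ≡ m * c₂ + f
        J≡ = cong (_∸ 1) (+-suc (m * c₂) f)
        no-odd : ∀ p → Prime p → p ∣ N → p ≡ 2
        no-odd p pr d with p ≟ 2
        ... | yes e = e
        ... | no p≢2 = ⊥-elim (<⇒≱ (s≤s (+-monoˡ-≤ f (*-monoˡ-≤ c₂ (<⇒≤ n<m)))) (2^∣φN⇒≤ n-odd (suc (m * c₂ + f))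
              (subst (λ j → 2 ^ suc j ∣ φ N) J≡ (∣-trans (subst (_∣ 2 ^ (J ∸ 1) * ((p ∸ 1) * 1))
                  (*-comm (2 ^ (J ∸ 1)) 2) (*-monoʳ-∣ (2 ^ (J ∸ 1)) (∣m⇒∣m*n 1 (2∣prime∸1 pr p≢2))))
              (q^∣φ prime[2] N>0 J 2^J∣N (pr ∷ []) ([] ∷ []) (d ∷ []) (p≢2 ∷ []))))))
        c₂≡0 : c₂ ≡ 0
        c₂≡0 = zero-of c₂ (+-cancelʳ-≤ f _ _ (2^∣φN⇒≤ n-odd (m * c₂ + f)
            (subst (λ j → 2 ^ j ∣ φ N) J≡ (∣-trans (m∣m*n 1) (q^∣φ prime[2] N>0 J 2^J∣N [] [] [] [])))))
          where
          zero-of : ∀ c → m * c ≤ n * c → c ≡ 0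
          zero-of zero _ = refl
          zero-of (suc c) h = ⊥-elim (<⇒≱ (*-monoˡ-< (suc c) n<m) h)
        g≡1 : g ≡ 1
        g≡1 = noPrimeDivisor⇒≡1 g>0 λ p pr d → p∤g′ prime[2]
          (subst₂ _∣_ (no-odd p pr (∣m⇒∣m*n (V a b m) (∣-trans d
              (subst (λ k → g ∣ g ^ k) (m+[n∸m]≡n m>0) (m∣m*n (g ^ (m ∸ 1)))))))
              (trans (g≡ prime[2]) (trans (cong (λ z → 2 ^ z * g′ prime[2]) c₂≡0) (+-identityʳ _))) d)
        g^≡1 : ∀ k → g ^ k ≡ 1
        g^≡1 k = trans (cong (_^ k) g≡1) (^-zeroˡ k)
        st = strip (prime>1 prime[2]) N N>0
        K = proj₁ st
        N≡ : N ≡ 2 ^ K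
        N≡ = trans (proj₁ (proj₂ (proj₂ st))) (trans (cong (2 ^ K *_) (noPrimeDivisor⇒≡1
          (*-posʳ (2 ^ K) (subst (0 <_) (proj₁ (proj₂ (proj₂ st))) N>0))
          (λ p pr d → proj₂ (proj₂ (proj₂ st)) (subst (_∣ proj₁ (proj₂ st))
              (no-odd p pr (subst (p ∣_) (sym (proj₁ (proj₂ (proj₂ st)))) (∣n⇒∣m*n (2 ^ K) d))) d)))) (*-identityʳ _))
        K>0 : 0 < K
        K>0 = p^∣p^⇒≤ (prime>1 prime[2]) 1 K (subst (2 ∣_) N≡ (∣n⇒∣m*n (g ^ m) (2∣V a b m a-odd b-odd)))
        K≡ : K ≡ suc (K ∸ 1)
        K≡ = sym (m+[n∸m]≡n K>0)
        Vm≡ : V a b m ≡ 2 ^ K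
        Vm≡ = trans (sym (*-identityˡ _)) (trans (cong (_* V a b m) (sym (g^≡1 m))) N≡)
        Vn≡ : V a b n ≡ 2 ^ (K ∸ 1)
        Vn≡ = begin
          V a b n                  ≡⟨ trans (sym (*-identityˡ _)) (cong (_* V a b n) (sym (g^≡1 n))) ⟩
          g ^ n * V a b n          ≡⟨ sym eq ⟩
          φ N                      ≡⟨ cong φ (trans N≡ (trans (cong (2 ^_) K≡) (sym (*-identityʳ _)))) ⟩
          φ (2 ^ suc (K ∸ 1) * 1)  ≡⟨ φ-^-* prime[2] (prime∤1 prime[2]) (K ∸ 1) ⟩
          2 ^ (K ∸ 1) * (1 * 1)    ≡⟨ *-identityʳ _ ⟩
          2 ^ (K ∸ 1)              ∎
          where open ≡-Reasoning
        Vn>0 : 0 < V a b n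
        Vn>0 = subst (0 <_) (sym Vn≡) (^-pos (K ∸ 1) (s≤s z≤n))
        T1n≡1 : T a b 1 n ≡ 1
        T1n≡1 = noPrimeDivisor⇒≡1 (*-posʳ (V a b 1) (subst (0 <_) (V≡V1*T a b n) Vn>0)) λ p pr d → T-odd n n-odd
          (subst (_∣ T a b 1 n) (prime∣prime pr prime[2] (prime∣^ pr 2 (K ∸ 1)
              (subst (p ∣_) (trans (sym (V≡V1*T a b n)) Vn≡) (∣n⇒∣m*n (V a b 1) d)))) d)
        Vn≡V1 : V a b n ≡ V a b 1
        Vn≡V1 = trans (V≡V1*T a b n) (trans (cong (V a b 1 *_) T1n≡1) (*-identityʳ _))
        V1≡2^ : V a b 1 ≡ 2 ^ (K ∸ 1)
        V1≡2^ = trans (sym Vn≡V1) Vn≡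
        t : ℕ
        t = T a b 2 (quotient 2∣m)
        Vm≡V2 : V a b m ≡ V a b 2 * t
        Vm≡V2 = trans (cong (V a b) (m∣n⇒n≡m*quotient 2∣m)) (V-* a b 2 (quotient 2∣m))
        Tt≡2 : T a b 1 2 * t ≡ 2
        Tt≡2 = *-cancelˡ-≡ _ _ (V a b 1) {{>-nonZero V1>0}} (begin
          V a b 1 * (T a b 1 2 * t)   ≡⟨ sym (*-assoc (V a b 1) (T a b 1 2) t) ⟩
          V a b 1 * T a b 1 2 * t     ≡⟨ cong (_* t) (sym (V≡V1*T a b 2)) ⟩
          V a b 2 * t                 ≡⟨ sym Vm≡V2 ⟩
          V a b m                     ≡⟨ Vm≡ ⟩
          2 ^ K                       ≡⟨ cong (2 ^_) K≡ ⟩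
          2 * 2 ^ (K ∸ 1)             ≡⟨ cong (2 *_) (sym V1≡2^) ⟩
          2 * V a b 1                 ≡⟨ *-comm 2 (V a b 1) ⟩
          V a b 1 * 2                 ∎)
          where open ≡-Reasoning
        T2≡2 : T a b 1 2 ≡ 2
        T2≡2 = ∣-antisym (divides t (trans (sym Tt≡2) (*-comm (T a b 1 2) t))) 2∣T2
        t≡1 : t ≡ 1
        t≡1 = *-cancelˡ-≡ t 1 2 (trans (cong (_* t) (sym T2≡2)) Tt≡2)
        ∣a+b∣≡2 : ∣ a ℤ.+ b ∣ ≡ 2
        ∣a+b∣≡2 = trans (cong ∣_∣ (l a b)) T2≡2
          where
          l : ∀ a b → a ℤ.+ b ≡ (a ℤ.* 1ℤ) ℤ.* ((a ℤ.* 1ℤ) ℤ.* 0ℤ ℤ.+ 1ℤ) ℤ.+ (b ℤ.* 1ℤ) ℤ.* 1ℤ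
          l = ℤSolver.solve-∀
        V2≡ : V a b m ≡ V a b 2
        V2≡ = trans Vm≡V2 (trans (cong (V a b 2 *_) t≡1) (*-identityʳ _))
        V2>0 : 0 < V a b 2
        V2>0 = subst (0 <_) V2≡ Vm>0
        A≢B : ∣ a ∣ ≢ ∣ b ∣
        A≢B e = <-irrefl (sym (V-zero a b 2 e (V-even a b 1 (≤-reflexive (sym e))))) V2>0
        main : ∀ x y → 0 < ∣ y ∣ → ∣ y ∣ < ∣ x ∣ → 0 < V x y 2 → 0 < V x y 1 → V x y n ≡ V x y 1 → V x y m ≡ V x y 2
            → n ≡ 1 × m ≡ 2
        main x y Y>0 Y<X V2>0 V1>0 Vn Vm = n≡ (V-cases x y (<⇒≤ Y<X)) , ≤-antisym m≤2 m>1
          where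
          X>1 : 1 < ∣ x ∣
          X>1 = ≤-<-trans Y>0 Y<X
          exp0 : ∀ e u → 0 < u → ∣ x ∣ ^ e * u ≤ u → e ≡ 0
          exp0 zero u _ _ = refl
          exp0 (suc e) u u>0 h = ⊥-elim (<⇒≱ (subst (_< ∣ x ∣ ^ suc e * u) (*-identityˡ u)
             (*-monoˡ-< u {{>-nonZero u>0}} (≤-trans X>1 (m≤m*n ∣ x ∣ (∣ x ∣ ^ e)
                 {{>-nonZero (^-pos e (<-trans (s≤s z≤n) X>1))}})))) h)
          m≤2 : m ≤ 2
          m≤2 = m∸n≡0⇒m≤n (exp0 (m ∸ 2) (V x y 2) V2>0 (subst₂ _≤_ refl (trans (cong (V x y) (m∸n+n≡m m>1)) Vm)
              (A^V≤V x y 2 (m ∸ 2) (<⇒≤ Y<X) (V-even x y 1 (<⇒≤ Y<X)))))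
          n≡ : (∀ k → V x y k + ∣ y ∣ ^ k ≡ ∣ x ∣ ^ k) ⊎ (∀ k → V x y (suc (2 * k)) ≡ ∣ x ∣ ^ suc (2 * k) + ∣ y ∣ ^
              suc (2 * k)) → n ≡ 1
          n≡ (inj₁ same) = ≤-antisym (m∸n≡0⇒m≤n (exp0 (n ∸ 1) (V x y 1) V1>0
              (subst₂ _≤_ refl (trans (cong (V x y) (m∸n+n≡m n>0)) Vn) (A^V≤V x y 1 (n ∸ 1) (<⇒≤ Y<X) (same 1))))) n>0
          n≡ (inj₂ opp) with odd⇒suc n-odd
          ... | zero , e = e
          ... | suc k , e = ⊥-elim (<-irrefl refl (begin-strict
              ∣ x ∣ ^ 1 + ∣ y ∣ ^ 1    <⟨ +-mono-<-≤ (^-monoʳ-< ∣ x ∣ X>1 {1} {suc (2 * suc k)} (s≤s (s≤s z≤n)))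
                  (^-mono-exp {j = 1} {suc (2 * suc k)} Y>0 (s≤s z≤n)) ⟩
              ∣ x ∣ ^ suc (2 * suc k) + ∣ y ∣ ^ suc (2 * suc k)  ≡⟨ sym (opp (suc k)) ⟩
              V x y (suc (2 * suc k))  ≡⟨ cong (V x y) (sym e) ⟩
              V x y n                  ≡⟨ Vn ⟩
              V x y 1                  ≡⟨ opp 0 ⟩
              ∣ x ∣ ^ 1 + ∣ y ∣ ^ 1    ∎))
            where open ≤-Reasoning
        n≡1,m≡2 : n ≡ 1 × m ≡ 2
        n≡1,m≡2 with <-cmp ∣ b ∣ ∣ a ∣
        ... | tri< B<A _ _ = main a b B>0 B<A V2>0 V1>0 Vn≡V1 V2≡
        ... | tri≈ _ e _ = ⊥-elim (A≢B (sym e))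
        ... | tri> _ _ A<B = main b a A>0 A<B (subst (0 <_) (V-comm a b 2) V2>0) (subst (0 <_) (V-comm a b 1) V1>0)
              (trans (V-comm b a n) (trans Vn≡V1 (V-comm a b 1))) (trans (V-comm b a m) (trans V2≡ (V-comm a b 2)))
        n≡1 = proj₁ n≡1,m≡2
        m≡2 = proj₂ n≡1,m≡2

      oddExponents-impossible : ¬ 2 ∣ m → ¬ 2 ∣ n → ⊥
      oddExponents-impossible m-odd n-odd = <⇒≱ 3φN<N N≤3φN
        where
        -- The gap of two, due to parity, outweighs the single factor 2 lost by φ and so excludes an
        -- even `g`.
        2+n≤m : 2 + n ≤ m
        2+n≤m with odd⇒suc m-odd | odd⇒suc n-odd
        ... | i , refl | j , refl = s≤s (subst (_≤ 2 * i) (cong suc (+-suc j (j + 0)))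
            (*-monoʳ-≤ 2 (*-cancelˡ-< 2 j i (≤-pred n<m))))
        2^∣N : 2 ^ (m * c₂ + f) ∣ N
        2^∣N = ^∣N prime[2] f 2^f∣Vm
        c₂≡0 : c₂ ≡ 0
        c₂≡0 = zero-of c₂ (+-cancelʳ-≤ f _ _ (subst (_≤ suc (n * c₂ + f)) (m+[n∸m]≡n (≤-trans f>0 (m≤n+m f (m * c₂))))
                    (s≤s (2^∣φN⇒≤ n-odd (m * c₂ + f ∸ 1) (∣-trans (m∣m*n 1)
                        (q^∣φ prime[2] N>0 (m * c₂ + f) 2^∣N [] [] [] []))))))
          where
          zero-of : ∀ c → m * c ≤ suc (n * c) → c ≡ 0
          zero-of zero _ = refl
          zero-of (suc c) h = ⊥-elim (<⇒≱ (≤-trans (s≤s (≤-trans (s≤s (m≤n+m (n * suc c) c))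
              (m≤n+m (suc c + n * suc c) c))) (*-monoˡ-≤ (suc c) 2+n≤m)) h)
        2^f∣N : 2 ^ f ∣ N
        2^f∣N = subst (λ z → 2 ^ z ∣ N) (trans (cong (λ z → m * z + f) c₂≡0) (cong (_+ f) (*-zeroʳ m))) 2^∣N
        unique : ∀ p q → Prime p → Prime q → ¬ p ≡ 2 → ¬ q ≡ 2 → p ∣ N → q ∣ N → p ≡ q
        unique p q p-pr q-pr p≢2 q≢2 dp dq with p ≟ q
        ... | yes e = e
        ... | no p≢q = ⊥-elim (<⇒≱ {f} ≤-refl (subst (suc f ≤_)
            (trans (cong (λ z → n * z + f) c₂≡0) (cong (_+ f) (*-zeroʳ n)))
              (2^∣φN⇒≤ n-odd (suc f) (∣-trans (subst (λ z → 2 ^ suc z ∣ 2 ^ (f ∸ 1) * ((p ∸ 1) * ((q ∸ 1) * 1)))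
                  (m+[n∸m]≡n f>0)
                (subst (_∣ 2 ^ (f ∸ 1) * ((p ∸ 1) * ((q ∸ 1) * 1))) (l (2 ^ (f ∸ 1)))
                  (*-monoʳ-∣ (2 ^ (f ∸ 1)) (*-pres-∣ (2∣prime∸1 p-pr p≢2) (∣m⇒∣m*n 1 (2∣prime∸1 q-pr q≢2))))))
                (q^∣φ prime[2] N>0 f 2^f∣N (p-pr ∷ q-pr ∷ []) ((p≢q ∷ []) ∷ [] ∷ []) (dp ∷ dq ∷ [])
                    (p≢2 ∷ q≢2 ∷ []))))))
          where
          l : ∀ x → x * 4 ≡ 2 * (2 * x)
          l = solve-∀
        2∣N : 2 ∣ N
        2∣N = ∣n⇒∣m*n (g ^ m) (2∣V a b m a-odd b-odd)
        -- The ratio of `N` to its totient is 2, or `2p/(p - 1)` with a single odd prime `p ≥ 3`.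
        N≤3φN : N ≤ 3 * φ N
        N≤3φN with strip (prime>1 prime[2]) N N>0
        ... | zero , N′ , e , odd = ⊥-elim (odd (subst (2 ∣_) (trans e (+-identityʳ N′)) 2∣N))
        ... | suc K , N′ , e , odd with N′ ≟ 1
        ...   | yes refl = begin
          N                            ≡⟨ e ⟩
          2 * 2 ^ K * 1                ≡⟨ l (2 ^ K) ⟩
          2 * (2 ^ K * (1 * 1))        ≤⟨ *-monoˡ-≤ (2 ^ K * (1 * 1)) {2} {3} (s≤s (s≤s z≤n)) ⟩
          3 * (2 ^ K * (1 * 1))        ≡⟨ cong (3 *_) (sym (φ-^-* prime[2] (prime∤1 prime[2]) K)) ⟩
          3 * φ (2 ^ suc K * 1)        ≡⟨ cong (λ z → 3 * φ z) (sym e) ⟩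
          3 * φ N                      ∎
          where
          open ≤-Reasoning
          l : ∀ x → 2 * x * 1 ≡ 2 * (x * (1 * 1))
          l = solve-∀
        ...   | no N′≢1 with primeDivisor {N′} (≤∧≢⇒< (*-posʳ (2 ^ suc K) (subst (0 <_) e N>0)) (N′≢1 ∘ sym))
        ...     | p , pr , p∣N′ with strip (prime>1 pr) N′ (*-posʳ (2 ^ suc K) (subst (0 <_) e N>0))
        ...       | zero , N″ , e′ , p∤ = ⊥-elim (p∤ (subst (p ∣_) (trans e′ (+-identityʳ N″)) p∣N′))
        ...       | suc j , N″ , e′ , p∤ = begin
          N                                              ≡⟨ e ⟩
          2 * 2 ^ K * N′                                 ≡⟨ cong (2 * 2 ^ K *_) (trans e′ (cong (p ^ suc j *_) N″≡1))
              ⟩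
          2 * 2 ^ K * (p * p ^ j * 1)                    ≡⟨ l₁ (2 ^ K) p (p ^ j) ⟩
          2 * p * (2 ^ K * p ^ j)                        ≤⟨ *-monoˡ-≤ (2 ^ K * p ^ j) 2p≤ ⟩
          3 * (p ∸ 1) * (2 ^ K * p ^ j)                  ≡⟨ l₂ (p ∸ 1) (2 ^ K) (p ^ j) ⟩
          3 * (2 ^ K * (1 * (p ^ j * ((p ∸ 1) * 1))))    ≡⟨ cong (λ z → 3 * (2 ^ K * (1 * z)))
              (sym (φ-^-* pr (prime∤1 pr) j)) ⟩
          3 * (2 ^ K * (1 * φ (p ^ suc j * 1)))          ≡⟨ cong (λ z → 3 * (2 ^ K * (1 * φ z)))
              (sym (trans e′ (cong (p ^ suc j *_) N″≡1))) ⟩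
          3 * (2 ^ K * (1 * φ N′))                       ≡⟨ cong (3 *_) (sym (φ-^-* prime[2] odd K)) ⟩
          3 * φ (2 ^ suc K * N′)                         ≡⟨ cong (λ z → 3 * φ z) (sym e) ⟩
          3 * φ N                                        ∎
          where
          open ≤-Reasoning
          p≢2 : ¬ p ≡ 2
          p≢2 refl = odd p∣N′
          N′∣N : N′ ∣ N
          N′∣N = subst (N′ ∣_) (sym e) (n∣m*n (2 ^ suc K))
          N″∣N′ : N″ ∣ N′
          N″∣N′ = subst (N″ ∣_) (sym e′) (n∣m*n (p ^ suc j))
          N″≡1 : N″ ≡ 1
          N″≡1 = noPrimeDivisor⇒≡1 (∣-pos N>0 (∣-trans N″∣N′ N′∣N)) λ q q-pr d → p∤ (subst (_∣ N″)
            (unique q p q-pr pr (λ { refl → odd (∣-trans d N″∣N′) }) p≢2 (∣-trans d (∣-trans N″∣N′ N′∣N))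
                (∣-trans p∣N′ N′∣N)) d)
          2p≤ : 2 * p ≤ 3 * (p ∸ 1)
          2p≤ with odd⇒suc {p} (λ d → p≢2 (sym (prime∣prime prime[2] pr d)))
          ... | zero , refl = ⊥-elim (<-irrefl refl (prime>1 pr))
          ... | suc i , refl = subst₂ _≤_ (l₃ i) (l₄ i) (+-monoʳ-≤ (4 * i + 6) (m≤n+m 0 (2 * i)))
            where
            l₃ : ∀ i → 4 * i + 6 + 0 ≡ 2 * suc (2 * suc i)
            l₃ = solve-∀
            l₄ : ∀ i → 4 * i + 6 + (2 * i + 0) ≡ 3 * (2 * suc i)
            l₄ = solve-∀
          l₁ : ∀ x p y → 2 * x * (p * y * 1) ≡ 2 * p * (x * y)
          l₁ = solve-∀
          l₂ : ∀ q x y → 3 * q * (x * y) ≡ 3 * (x * (1 * (y * (q * 1))))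
          l₂ = solve-∀
        Vn>0 : 0 < V a b n
        Vn>0 = *-posʳ (g ^ n) (subst (0 <_) eq (φ-pos N>0))
        main : ∀ x y → ¬ 2 ∣ ∣ x ∣ → 0 < ∣ y ∣ → ∣ y ∣ < ∣ x ∣ → 0 < V x y n → 3 * V x y n < V x y m
        main x y x-odd Y>0 Y<X Vn>0 = go (V-cases x y (<⇒≤ Y<X))
          where
          open ≤-Reasoning
          3≤X : 3 ≤ ∣ x ∣
          3≤X = ≤∧≢⇒< (≤-<-trans Y>0 Y<X) λ e → x-odd (subst (2 ∣_) e ∣-refl)
          9≤ : 9 ≤ ∣ x ∣ ^ (m ∸ n)
          9≤ = ≤-trans (^-monoˡ-≤ 2 3≤X) (^-mono-exp (<-trans Y>0 Y<X)
              (subst (_≤ m ∸ n) (m+n∸n≡m 2 n) (∸-monoˡ-≤ n 2+n≤m)))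
          go : (∀ k → V x y k + ∣ y ∣ ^ k ≡ ∣ x ∣ ^ k) ⊎ (∀ k → V x y (suc (2 * k)) ≡ ∣ x ∣ ^ suc (2 * k) + ∣ y ∣ ^
              suc (2 * k)) → 3 * V x y n < V x y m
          go (inj₁ same) = begin-strict
            3 * V x y n                       <⟨ *-monoˡ-< (V x y n) {{>-nonZero Vn>0}} {3} {9}
                (s≤s (s≤s (s≤s (s≤s z≤n)))) ⟩
            9 * V x y n                       ≤⟨ *-monoˡ-≤ (V x y n) 9≤ ⟩
            ∣ x ∣ ^ (m ∸ n) * V x y n         ≤⟨ A^V≤V x y n (m ∸ n) (<⇒≤ Y<X) (same n) ⟩
            V x y (m ∸ n + n)                 ≡⟨ cong (V x y) (m∸n+n≡m (<⇒≤ n<m)) ⟩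
            V x y m                           ∎
          go (inj₂ opp) with odd⇒suc m-odd | odd⇒suc n-odd
          ... | i , em | j , en = begin-strict
            3 * V x y n                       ≡⟨ cong (3 *_)
                (trans (cong (V x y) en) (trans (opp j) (cong (λ z → ∣ x ∣ ^ z + ∣ y ∣ ^ z) (sym en)))) ⟩
            3 * (∣ x ∣ ^ n + ∣ y ∣ ^ n)       ≤⟨ *-monoʳ-≤ 3 (+-monoʳ-≤ (∣ x ∣ ^ n) (^-monoˡ-≤ n (<⇒≤ Y<X))) ⟩
            3 * (∣ x ∣ ^ n + ∣ x ∣ ^ n)       ≡⟨ l (∣ x ∣ ^ n) ⟩
            6 * ∣ x ∣ ^ n                     ≤⟨ *-monoˡ-≤ (∣ x ∣ ^ n) (≤-trans (m≤m+n 6 3) 9≤) ⟩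
            ∣ x ∣ ^ (m ∸ n) * ∣ x ∣ ^ n       ≡⟨ trans (sym (^-distribˡ-+-* ∣ x ∣ (m ∸ n) n))
                (cong (∣ x ∣ ^_) (m∸n+n≡m (<⇒≤ n<m))) ⟩
            ∣ x ∣ ^ m                         <⟨ m<m+n (∣ x ∣ ^ m) (^-pos m Y>0) ⟩
            ∣ x ∣ ^ m + ∣ y ∣ ^ m             ≡⟨ sym (trans (cong (V x y) em)
                (trans (opp i) (cong (λ z → ∣ x ∣ ^ z + ∣ y ∣ ^ z) (sym em)))) ⟩
            V x y m                           ∎
            where
            l : ∀ z → 3 * (z + z) ≡ 6 * z
            l = solve-∀
        -- Here coprimality makes both absolute values 1 and both differences 2, so powers of `a`
        -- give no growth. If `g = 1`, then `φ 2` would be 2; if `g ≥ 2`, already `g ^ 2 ≥ 4` beats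
        -- the factor 3.
        A≢B : ¬ ∣ a ∣ ≡ ∣ b ∣
        A≢B e = go (V-cases a b (≤-reflexive (sym e))) (odd⇒suc m-odd) (odd⇒suc n-odd)
          where
          B≡1 : ∣ b ∣ ≡ 1
          B≡1 = noPrimeDivisor⇒≡1 B>0 λ p pr d → cop p pr (subst (p ∣_) (sym e) d) d
          go : (∀ k → V a b k + ∣ b ∣ ^ k ≡ ∣ a ∣ ^ k) ⊎ (∀ k → V a b (suc (2 * k)) ≡ ∣ a ∣ ^ suc (2 * k) + ∣ b ∣ ^
              suc (2 * k)) →
            (∃ λ k → m ≡ suc (2 * k)) → (∃ λ k → n ≡ suc (2 * k)) → ⊥
          go (inj₁ same) _ _ = <-irrefl (sym (V-zero a b m e (same m))) Vm>0
          go (inj₂ opp) (i , em) (j , en) = two-g g refl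
            where
            two : ∀ j → V a b (suc (2 * j)) ≡ 2
            two j = trans (opp j) (cong₂ _+_ (trans (cong (_^ suc (2 * j)) (trans e B≡1)) (^-zeroˡ (suc (2 * j))))
                (trans (cong (_^ suc (2 * j)) B≡1) (^-zeroˡ (suc (2 * j)))))
            Vm≡2 = trans (cong (V a b) em) (two i)
            Vn≡2 = trans (cong (V a b) en) (two j)
            two-g : ∀ k → k ≡ g → ⊥
            two-g zero e₀ = <-irrefl e₀ g>0
            two-g (suc zero) e₁ = <-irrefl (trans eq (trans (cong₂ (λ x y → x ^ n * y) (sym e₁) Vn≡2)
                (trans (cong (_* 2) (^-zeroˡ n)) (sym (trans (cong₂ (λ x y → x ^ m * y) (sym e₁) Vm≡2)
                (cong (_* 2) (^-zeroˡ m)))))))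
              (φ-< (≤-trans (subst (2 ≤_) (sym Vm≡2) ≤-refl) (m≤n*m (V a b m) (g ^ m) {{>-nonZero (^-pos m g>0)}})))
            two-g (suc (suc k)) e₂ = <⇒≱ (begin-strict
              3 * φ N                       ≡⟨ cong (3 *_) (trans eq (cong (g ^ n *_) (trans Vn≡2 (sym Vm≡2)))) ⟩
              3 * (g ^ n * V a b m)         <⟨ *-monoˡ-< (g ^ n * V a b m) {{>-nonZero (*-pos (^-pos n g>0) Vm>0)}}
                  {3} {4} ≤-refl ⟩
              4 * (g ^ n * V a b m)         ≤⟨ *-monoˡ-≤ (g ^ n * V a b m)
                  (^-monoˡ-≤ 2 (subst (2 ≤_) e₂ (s≤s (s≤s z≤n)))) ⟩
              g ^ 2 * (g ^ n * V a b m)     ≡⟨ sym (*-assoc (g ^ 2) (g ^ n) (V a b m)) ⟩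
              g ^ 2 * g ^ n * V a b m       ≡⟨ cong (_* V a b m) (sym (^-distribˡ-+-* g 2 n)) ⟩
              g ^ (2 + n) * V a b m         ≤⟨ *-monoˡ-≤ (V a b m) (^-mono-exp g>0 2+n≤m) ⟩
              N                             ∎) N≤3φN
              where open ≤-Reasoning
        3V<V : 3 * V a b n < V a b m
        3V<V with <-cmp ∣ b ∣ ∣ a ∣
        ... | tri< B<A _ _ = main a b a-odd B>0 B<A Vn>0
        ... | tri> _ _ A<B = subst₂ (λ x y → 3 * x < y) (V-comm b a n) (V-comm b a m)
            (main b a b-odd A>0 A<B (subst (0 <_) (V-comm a b n) Vn>0))
        ... | tri≈ _ B≡A _ = ⊥-elim (A≢B (sym B≡A))
        3φN<N : 3 * φ N < N
        3φN<N = begin-strict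
          3 * φ N                  ≡⟨ cong (3 *_) eq ⟩
          3 * (g ^ n * V a b n)    ≡⟨ l (g ^ n) (V a b n) ⟩
          g ^ n * (3 * V a b n)    <⟨ *-monoʳ-< (g ^ n) {{>-nonZero (^-pos n g>0)}} 3V<V ⟩
          g ^ n * V a b m          ≤⟨ *-monoˡ-≤ (V a b m) (^-mono-exp g>0 (<⇒≤ n<m)) ⟩
          g ^ m * V a b m          ∎
          where
          open ≤-Reasoning
          l : ∀ x y → 3 * (x * y) ≡ x * (3 * y)
          l = solve-∀

-- Odd `m` and even `n`: the prime factors of `W`.

module OddEvenExponents where

  open import Data.Nat
  open import Data.Nat.Properties
  open import Data.Nat.Divisibility
  open import Data.Integer as ℤ using (ℤ; ∣_∣; 0ℤ; 1ℤ) renaming (+_ to pos)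
  open Totient
  open PowerDifferences
  open TotientRatio
  open DistinctPrimes
  open CoprimeExponents

  2+e≤3^e : ∀ e → 0 < e → 2 + e ≤ 3 ^ e
  2+e≤3^e (suc zero) _ = ≤-refl
  2+e≤3^e (suc (suc e)) _ = ≤-trans (≤-trans (s≤s (2+e≤3^e (suc e) (s≤s z≤n)))
      (+-monoˡ-≤ (3 ^ suc e) (^-pos {3} (suc e) (s≤s z≤n)))) (+-monoʳ-≤ (3 ^ suc e) (m≤m+n (3 ^ suc e) _))

  -- These finite checks serve the values `U < 2 * X` with `X ≤ 12`, `X ≤ 6` and `X ≤ 3`. The
  -- extremal ratios 5/2, 3 and 2 are attained at `u = 10`, `6` and `2`.
  φ-small₃ : ∀ {u} → u < 24 → ¬ 3 ∣ u → 2 * u ≤ 5 * φ u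
  φ-small₃ u< 3∤u = [ (λ d → ⊥-elim (3∤u d)) , (λ h → h) ]′
      (toWitness {a? = allUpTo? (λ u → (3 ∣? u) ⊎-dec (2 * u ≤? 5 * φ u)) 24} _ u<)

  φ-small : ∀ {u} → u < 12 → u ≤ 3 * φ u
  φ-small = toWitness {a? = allUpTo? (λ u → u ≤? 3 * φ u) 12} _

  φ-tiny : ∀ {u} → u < 6 → u ≤ 2 * φ u
  φ-tiny = toWitness {a? = allUpTo? (λ u → u ≤? 2 * φ u) 6} _

  module OddEven (a b : ℤ) (g m n : ℕ) (A>0 : 0 < ∣ a ∣) (B>0 : 0 < ∣ b ∣) (cop : Cop a b) (g>0 : 0 < g)
    (gcd≡1 : gcd m n ≡ 1) (n>0 : 0 < n) (n<m : n < m) (Vm>0 : 0 < V a b m)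
    (eq : φ (g ^ m * V a b m) ≡ g ^ n * V a b n)
    (a-odd : ¬ 2 ∣ ∣ a ∣) (b-odd : ¬ 2 ∣ ∣ b ∣) (m-odd : ¬ 2 ∣ m) (n-even : 2 ∣ n) (B<A : ∣ b ∣ < ∣ a ∣) where

    open Equation a b g m n A>0 B>0 cop g>0 gcd≡1 n>0 n<m Vm>0 eq
    open BothOdd a-odd b-odd using (2∣V1)

    A B : ℕ
    A = ∣ a ∣
    B = ∣ b ∣

    Tₘ : ℕ → ℕ
    Tₘ = T a b 1

    3≤A : 3 ≤ A
    3≤A = ≤∧≢⇒< (≤-<-trans B>0 B<A) λ e → a-odd (subst (2 ∣_) e ∣-refl)

    2≤V1 : 2 ≤ V a b 1
    2≤V1 = ∣⇒≤′ V1>0 2∣V1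

    V1<2A : V a b 1 < 2 * A
    V1<2A = begin-strict
      V a b 1        ≤⟨ V-upper a b 1 ⟩
      A * 1 + B * 1  ≡⟨ cong₂ _+_ (*-identityʳ A) (*-identityʳ B) ⟩
      A + B          <⟨ +-monoʳ-< A B<A ⟩
      A + A          ≡⟨ cong (A +_) (sym (+-identityʳ A)) ⟩
      2 * A          ∎
      where open ≤-Reasoning

    V>0 : ∀ d → 0 < d → 0 < V a b d
    V>0 d@(suc _) _ = +-cancelʳ-< (B ^ d) 0 (V a b d) (<-≤-trans (^-monoˡ-< d B<A) (V-lower a b d))

    T>0 : ∀ d → 0 < d → 0 < Tₘ d
    T>0 d d>0 = *-posʳ (V a b 1) (subst (0 <_) (V≡V1*T a b d) (V>0 d d>0))

    T-upper : ∀ d → 0 < d → Tₘ d < A ^ d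
    T-upper d@(suc _) d>0 = *-cancelˡ-< 2 (Tₘ d) (A ^ d) (begin-strict
      2 * Tₘ d          ≤⟨ *-monoˡ-≤ (Tₘ d) 2≤V1 ⟩
      V a b 1 * Tₘ d    ≡⟨ sym (V≡V1*T a b d) ⟩
      V a b d           ≤⟨ V-upper a b d ⟩
      A ^ d + B ^ d     <⟨ +-monoʳ-< (A ^ d) (^-monoˡ-< d B<A) ⟩
      A ^ d + A ^ d     ≡⟨ cong (A ^ d +_) (sym (+-identityʳ (A ^ d))) ⟩
      2 * A ^ d         ∎)
      where open ≤-Reasoning

    -- For equal signs the exponent would be `1 + e`. For opposite signs `V a b 1` can be almost
    -- `2 * A`, and the factor 2 is absorbed by giving up one more factor `A`.
    T-lower : ∀ e → ¬ 2 ∣ 2 + e → A ^ e < Tₘ (2 + e)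
    T-lower e odd = go (V-cases a b (<⇒≤ B<A)) (odd⇒suc odd)
      where
      open ≤-Reasoning
      go : (∀ k → V a b k + B ^ k ≡ A ^ k) ⊎ (∀ k → V a b (suc (2 * k)) ≡ A ^ suc (2 * k) + B ^ suc (2 * k)) →
        (∃ λ k → 2 + e ≡ suc (2 * k)) → A ^ e < Tₘ (2 + e)
      go (inj₁ same) _ = <-≤-trans (^-monoʳ-< A (≤-trans (s≤s (s≤s z≤n)) 3≤A) {e} {suc e} ≤-refl)
        (*-cancelʳ-≤ (A ^ suc e) (Tₘ (2 + e)) (V a b 1) {{>-nonZero V1>0}} (begin
          A ^ suc e * V a b 1      ≤⟨ A^V≤V a b 1 (suc e) (<⇒≤ B<A) (same 1) ⟩
          V a b (suc e + 1)        ≡⟨ cong (V a b ∘ suc) (+-comm e 1) ⟩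
          V a b (2 + e)            ≡⟨ trans (V≡V1*T a b (2 + e)) (*-comm (V a b 1) _) ⟩
          Tₘ (2 + e) * V a b 1     ∎))
      go (inj₂ opp) (k , d≡) = *-cancelˡ-< 2 (A ^ e) (Tₘ (2 + e)) (begin-strict
        2 * A ^ e        ≤⟨ *-monoˡ-≤ (A ^ e) (≤-trans (n≤1+n 2) 3≤A) ⟩
        A * A ^ e        <⟨ *-cancelˡ-< A _ _ (begin-strict
          A ^ (2 + e)                   ≤⟨ m≤m+n (A ^ (2 + e)) (B ^ (2 + e)) ⟩
          A ^ (2 + e) + B ^ (2 + e)     ≡⟨ trans (cong (λ z → A ^ z + B ^ z) d≡)
              (trans (sym (opp k)) (cong (V a b) (sym d≡))) ⟩
          V a b (2 + e)                 ≡⟨ V≡V1*T a b (2 + e) ⟩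
          V a b 1 * Tₘ (2 + e)          <⟨ *-monoˡ-< (Tₘ (2 + e)) {{>-nonZero (T>0 (2 + e) (s≤s z≤n))}} V1<2A ⟩
          2 * A * Tₘ (2 + e)            ≡⟨ l A (Tₘ (2 + e)) ⟩
          A * (2 * Tₘ (2 + e))          ∎) ⟩
        2 * Tₘ (2 + e)   ∎)
        where
        l : ∀ x y → 2 * x * y ≡ x * (2 * y)
        l = solve-∀

    odd-divisor : ∀ {d} → d ∣ m → ¬ 2 ∣ d
    odd-divisor d∣m 2∣d = m-odd (∣-trans 2∣d d∣m)

    q≢2 : ∀ {q} → q ∣ m → ¬ q ≡ 2
    q≢2 d refl = m-odd d

    q∤n : ∀ {q} → Prime q → q ∣ m → ¬ q ∣ n
    q∤n pr dm dn = prime∤1 pr (subst (_ ∣_) gcd≡1 (gcd-greatest dm dn))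

    newPrime : ∀ {q} → Prime q → q ∣ m → ∃ λ p → Prime p × (p ∣ V a b q) × (¬ p ∣ V a b 1)
    newPrime {q} pr q∣m = go q refl
      where
      T∣V : ∀ {p} → p ∣ Tₘ q → p ∣ V a b q
      T∣V d = subst (_ ∣_) (sym (V≡V1*T a b q)) (∣n⇒∣m*n (V a b 1) d)
      go : ∀ k → k ≡ q → ∃ λ p → Prime p × (p ∣ V a b q) × (¬ p ∣ V a b 1)
      go zero e = ⊥-elim (<-irrefl e (prime>0 pr))
      go (suc zero) e = ⊥-elim (<-irrefl e (prime>1 pr))
      go (suc (suc e)) 2+e≡q with q ∣? V a b 1
      ... | no q∤V1 with primeDivisor {Tₘ q} (≤-<-trans (^-pos e A>0)
          (subst (λ z → A ^ e < Tₘ z) 2+e≡q (T-lower e (subst (λ z → ¬ 2 ∣ z) (sym 2+e≡q) (odd-divisor q∣m)))))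
      ...   | p , p-pr , p∣T = p , p-pr , T∣V p∣T , λ p∣V1 → q∤V1
          (subst (_∣ V a b 1) (prime∣prime p-pr pr (T-mod {a} {b} cop p-pr 1 q (s≤s z≤n) p∣V1 p∣T)) p∣V1)
      go (suc (suc e)) 2+e≡q | yes q∣V1 with strip (prime>1 pr) (Tₘ q) (T>0 q (prime>0 pr))
      ... | j , M , T≡ , q∤M with M ≟ 1
      ...   | no M≢1 with primeDivisor {M} (≤∧≢⇒< (*-posʳ (q ^ j) (subst (0 <_) T≡ (T>0 q (prime>0 pr)))) (M≢1 ∘ sym))
      ...     | p , p-pr , p∣M = p , p-pr , T∣V p∣T , λ p∣V1 → q∤M
          (subst (_∣ M) (prime∣prime p-pr pr (T-mod {a} {b} cop p-pr 1 q (s≤s z≤n) p∣V1 p∣T)) p∣M)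
        where
        p∣T : p ∣ Tₘ q
        p∣T = subst (p ∣_) (sym T≡) (∣n⇒∣m*n (q ^ j) p∣M)
      go (suc (suc e)) 2+e≡q | yes q∣V1 | j , M , T≡ , q∤M | yes refl = ⊥-elim
          (small j (trans T≡ (*-identityʳ (q ^ j))))
        where
        big : A ^ e < Tₘ q
        big = subst (λ z → A ^ e < Tₘ z) 2+e≡q (T-lower e (subst (λ z → ¬ 2 ∣ z) (sym 2+e≡q) (odd-divisor q∣m)))
        e>0 : 0 < e
        e>0 = +-cancelˡ-< 2 0 e (subst (3 ≤_) (sym 2+e≡q) (odd-prime≥3 pr (q≢2 q∣m)))
        small : ∀ j → Tₘ q ≡ q ^ j → ⊥
        small zero e₀ = <⇒≱ big (subst (_≤ A ^ e) (sym e₀) (^-pos e A>0))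
        small (suc zero) e₁ = <⇒≱ big (begin
          Tₘ q       ≡⟨ trans e₁ (*-identityʳ q) ⟩
          q          ≡⟨ sym 2+e≡q ⟩
          2 + e      ≤⟨ 2+e≤3^e e e>0 ⟩
          3 ^ e      ≤⟨ ^-monoˡ-≤ e 3≤A ⟩
          A ^ e      ∎)
          where open ≤-Reasoning
        small (suc (suc j)) e₂ = q²∤geom {q} {a ℤ.^ 1} {b ℤ.^ 1} pr (q≢2 q∣m) q∣V1
            (λ d → V-∤b {a} {b} cop {q} {1} pr (s≤s z≤n) q∣V1 (primeℤ∣^ pr b 1 d))
          (subst (q * q ∣_) (sym e₂) (subst (q * q ∣_) (*-assoc q q (q ^ j)) (m∣m*n (q ^ j))))

    -- By Fermat, `p` divides `V` at `gcd (e * q) (p - 1)`, and this gcd would divide `e` if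
    -- `q ∤ p - 1`.
    q∣p-1 : ∀ {p q} e → Prime p → Prime q → 0 < e → p ∣ V a b (e * q) → ¬ p ∣ V a b e → q ∣ p ∸ 1
    q∣p-1 {p} {q} e pr q-pr e>0 d nd with q ∣? (p ∸ 1)
    ... | yes h = h
    ... | no h = ⊥-elim (nd (∣-trans (V-gcd {a} {b} cop pr (e * q) (p ∸ 1) pos-eq d
        (V-fermat {a} {b} cop pr (V-∤a {a} {b} cop pr pos-eq d) (V-∤b {a} {b} cop pr pos-eq d)))
        (V-∣ a b (gcd-∣-left {e} q-pr h))))
      where
      pos-eq : 0 < e * q
      pos-eq = *-pos e>0 (prime>0 q-pr)

    -- If `q ∣ V a b 1`, then `q ∣ m` gives `V a b m` an extra factor `q`, while `q ∤ n` gives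
    -- `V a b n` none. The prime of `newPrime`, congruent to 1 modulo `q`, restores the factor `q`
    -- lost by φ, so `φ N` has too many.
    q∤V1 : ∀ {q} → Prime q → q ∣ m → ¬ q ∣ V a b 1
    q∤V1 {q} pr q∣m q∣V1 with newPrime pr q∣m | strip (prime>1 pr) (V a b 1) V1>0
    ... | p , p-pr , p∣Vq , p∤V1 | f , v , V1≡ , q∤v = <⇒≱ bad (^∣φN⇒≤ pr J f (v * Tₘ n)
          (trans (V≡V1*T a b n) (trans (cong (_* Tₘ n) V1≡) (*-assoc (q ^ f) v (Tₘ n))))
          (prime∤* pr q∤v (λ d → q∤n pr q∣m (T-mod {a} {b} cop pr 1 n (s≤s z≤n) q∣V1 d)))
          (∣-trans (subst (_∣ q ^ (J ∸ 1) * ((p ∸ 1) * 1)) q^J (*-monoʳ-∣ (q ^ (J ∸ 1)) (∣m⇒∣m*n 1 q∣p)))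
            (q^∣φ pr N>0 J (^∣N pr (suc f) q^f∣Vm) (p-pr ∷ []) ([] ∷ [])
                (∣n⇒∣m*n (g ^ m) (∣-trans p∣Vq (V-∣ a b q∣m)) ∷ []) ((λ { refl → p∤V1 q∣V1 }) ∷ []))))
      where
      J = m * c pr + suc f
      q∣p : q ∣ p ∸ 1
      q∣p = q∣p-1 1 p-pr pr (s≤s z≤n) (subst (λ z → p ∣ V a b z) (sym (*-identityˡ q)) p∣Vq) p∤V1
      q^f∣Vm : q ^ suc f ∣ V a b m
      q^f∣Vm = subst₂ _∣_ (*-comm (q ^ f) q) (sym (V≡V1*T a b m))
          (*-pres-∣ (subst (q ^ f ∣_) (sym V1≡) (m∣m*n v)) (T-mod⁻ a b 1 m q∣V1 q∣m))
      J≡ : J ≡ suc (m * c pr + f)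
      J≡ = +-suc (m * c pr) f
      q^J : q ^ (J ∸ 1) * q ≡ q ^ J
      q^J = trans (*-comm (q ^ (J ∸ 1)) q) (cong (q ^_) (trans (cong (λ z → suc (z ∸ 1)) J≡) (sym J≡)))
      bad : n * c pr + f < J
      bad = subst (n * c pr + f <_) (sym J≡) (s≤s (+-monoˡ-≤ f (*-monoˡ-≤ (c pr) (<⇒≤ n<m))))

    W : ℕ
    W = Tₘ m

    W>0 : 0 < W
    W>0 = T>0 m m>0

    W∤V1 : ∀ {p} → Prime p → p ∣ W → ¬ p ∣ V a b 1
    W∤V1 pr d h = q∤V1 pr (T-mod {a} {b} cop pr 1 m (s≤s z≤n) h d) h

    W∣Vm : W ∣ V a b m
    W∣Vm = subst (W ∣_) (sym (V≡V1*T a b m)) (n∣m*n (V a b 1))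

    Vm∤V1⇒W : ∀ {p} → Prime p → p ∣ V a b m → ¬ p ∣ V a b 1 → p ∣ W
    Vm∤V1⇒W pr d nd = [ (λ h → ⊥-elim (nd h)) , (λ h → h) ]′
        (euclidsLemma (V a b 1) W pr (subst (_ ∣_) (V≡V1*T a b m) d))

    T∣W : ∀ {d} → d ∣ m → Tₘ d ∣ W
    T∣W {d} d∣m = *-cancelˡ-∣ (V a b 1) {{>-nonZero V1>0}} (subst₂ _∣_ (V≡V1*T a b d) (V≡V1*T a b m) (V-∣ a b d∣m))

    -- A prime of `W` does not divide `V a b n`, since `gcd m n = 1` would put it into `V a b 1`.
    -- Only `g ^ n` can supply its powers. With `e = 2` this makes `W` squarefree, with `e = 1`
    -- prime to `g`.
    W-val : ∀ {p} (pr : Prime p) → p ∣ W → ∀ e → p ^ e ∣ V a b m → m * c pr + e ≤ 1 + n * c pr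
    W-val {p} pr d e p^e = ≤-trans (m≤n+m∸n (m * c pr + e) 1) (s≤s (subst (m * c pr + e ∸ 1 ≤_) (+-identityʳ _)
      (^∣φN⇒≤ pr (m * c pr + e ∸ 1) 0 (V a b n) (sym (+-identityʳ _))
          (λ h → W∤V1 pr d (V-coprime pr (∣-trans d W∣Vm) h))
        (∣-trans (m∣m*n 1) (q^∣φ pr N>0 (m * c pr + e) (^∣N pr e p^e) [] [] [] [])))))

    W-squarefree : ∀ p → Prime p → ¬ p * p ∣ W
    W-squarefree p pr d = <⇒≱ (subst (1 + n * c pr <_) (+-comm 2 (m * c pr)) (s≤s (s≤s (*-monoˡ-≤ (c pr) (<⇒≤ n<m)))))
      (W-val pr (∣-trans (m∣m*n p) d) 2 (subst (_∣ V a b m) (cong (p *_) (sym (*-identityʳ p))) (∣-trans d W∣Vm)))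

    W∤g : ∀ {p} → Prime p → p ∣ W → ¬ p ∣ g
    W∤g {p} pr d p∣g = p∤g′ pr (subst (p ∣_) (trans (g≡ pr) (trans (cong (λ z → p ^ z * g′ pr) c≡0) (+-identityʳ _)))
        p∣g)
      where
      zero-of : ∀ c → m * c + 1 ≤ 1 + n * c → c ≡ 0
      zero-of zero _ = refl
      zero-of (suc c) h = ⊥-elim (<⇒≱ (*-monoˡ-< (suc c) n<m)
          (≤-pred (subst (_≤ 1 + n * suc c) (+-comm (m * suc c) 1) h)))
      c≡0 : c pr ≡ 0
      c≡0 = zero-of (c pr) (W-val pr d 1 (subst (_∣ V a b m) (sym (*-identityʳ p)) (∣-trans d W∣Vm)))

    -- Besides the `J - 1` factors `q` that come from `g ^ m`, each entry of `L` puts one into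
    -- `φ N`. Since `n c ≤ J ∸ 1`, also when `q ∤ g` and both are 0, the share of `g ^ n` can be
    -- removed and `length L` factors remain for `V a b n`.
    q^∣Vn : ∀ {q} → Prime q → q ∣ m → ∀ L → All Prime L → Unique L → All (_∣ W) L → All (λ p → q ∣ p ∸ 1) L → q ^
        length L ∣ V a b n
    q^∣Vn {q} pr q∣m L prs u ds ones = *-cancelˡ-∣ (q ^ nc) {{>-nonZero (^-pos nc (prime>0 pr))}}
      (subst (_∣ q ^ nc * V a b n) (^-distribˡ-+-* q nc s) (∣-trans (^-∣ q (+-monoˡ-≤ s nc≤)) (^∣φN pr (J ∸ 1 + s)
        (subst (_∣ φ N) (sym (^-distribˡ-+-* q (J ∸ 1) s)) (∣-trans (*-monoʳ-∣ (q ^ (J ∸ 1)) (^length∣product L ones))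
          (q^∣φ pr N>0 J (subst (λ z → q ^ z ∣ N) (+-identityʳ J) (^∣N pr 0 (1∣ _))) prs u
              (All.map (λ d → ∣n⇒∣m*n (g ^ m) (∣-trans d W∣Vm)) ds)
              (All.zipWith (λ {p} (p-pr , d) → ne {p} p-pr d) (prs , ones))))))))
      where
      s = length L
      nc = n * c pr
      J = m * c pr
      ne : ∀ {p} → Prime p → q ∣ p ∸ 1 → ¬ p ≡ q
      ne p-pr d refl = prime∤1 p-pr (∣m+n∣m⇒∣n (subst (q ∣_) (sym (m∸n+n≡m (prime>0 p-pr))) ∣-refl) d)
      nc≤ : nc ≤ J ∸ 1
      nc≤ with c pr
      ... | zero rewrite *-zeroʳ n = z≤n
      ... | suc k = ≤-pred (≤-trans (*-monoˡ-< (suc k) n<m) (m≤n+m∸n (m * suc k) 1))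

    -- With h = gcd n (q - 1) = 2 k, q^s divides V h = ∣a^k - b^k∣ ∣a^k + b^k∣, hence one of the two even factors.
    q^2s≤A^q : ∀ {q} → Prime q → q ∣ m → ∀ s → q ^ s ∣ V a b n → q ^ (2 * s) ≤ A ^ q
    q^2s≤A^q {q} pr q∣m zero _ = ^-pos q A>0
    q^2s≤A^q {q} pr q∣m s@(suc _) q^s = begin
      q ^ (2 * s)        ≡⟨ trans (cong (q ^_) (*-comm 2 s)) (sym (^-*-assoc q s 2)) ⟩
      (q ^ s) ^ 2        ≤⟨ ^-monoˡ-≤ 2 q^s≤ ⟩
      (A ^ k) ^ 2        ≡⟨ trans (^-*-assoc A k 2) (cong (A ^_) (trans (*-comm k 2) (sym h≡))) ⟩
      A ^ h              ≤⟨ ^-mono-exp A>0 (≤-trans (∣⇒≤′ (m<n⇒0<n∸m (prime>1 pr)) (gcd[m,n]∣n n (q ∸ 1)))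
          (m∸n≤m q 1)) ⟩
      A ^ q              ∎
      where
      open ≤-Reasoning
      q∣Vn : q ∣ V a b n
      q∣Vn = ∣-trans (m∣m*n _) q^s
      q∤a = V-∤a {a} {b} cop pr n>0 q∣Vn
      q∤b = V-∤b {a} {b} cop pr n>0 q∣Vn
      h = gcd n (q ∸ 1)
      h∣n = gcd[m,n]∣m n (q ∸ 1)
      2∣h : 2 ∣ h
      2∣h = gcd-greatest n-even (2∣prime∸1 pr (q≢2 q∣m))
      h>0 : 0 < h
      h>0 = ∣-pos n>0 h∣n
      k = proj₁ (even⇒2* 2∣h)
      h≡ : h ≡ 2 * k
      h≡ = proj₂ (even⇒2* 2∣h)
      q∣Vh : q ∣ V a b h
      q∣Vh = V-gcd {a} {b} cop pr n (q ∸ 1) n>0 q∣Vn (V-fermat {a} {b} cop pr q∤a q∤b)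
      q^s∣Vh : q ^ s ∣ V a b h
      q^s∣Vh = p^∣*-cancelʳ {v = T a b h (quotient h∣n)} pr
          (λ d → q∤n pr q∣m (∣-trans (T-mod {a} {b} cop pr h (quotient h∣n) h>0 q∣Vh d) (quotient-∣ h∣n)))
        s (V a b h) (subst (q ^ s ∣_) (trans (cong (V a b) (m∣n⇒n≡m*quotient h∣n)) (V-* a b h (quotient h∣n))) q^s)
      u = a ℤ.^ k
      w = b ℤ.^ k
      Vh≡ : V a b h ≡ ∣ u ℤ.- w ∣ * ∣ u ℤ.+ w ∣
      Vh≡ = trans (cong (V a b) h≡) (trans (cong ∣_∣ (trans (cong₂ ℤ._-_ (sq a) (sq b)) (l u w)))
          (ℤₚ.abs-* (u ℤ.- w) (u ℤ.+ w)))
        where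
        sq : ∀ i → i ℤ.^ (2 * k) ≡ i ℤ.^ k ℤ.* i ℤ.^ k
        sq i = trans (ℤₚ.^-distribˡ-+-* i k (k + 0)) (cong (λ z → i ℤ.^ k ℤ.* i ℤ.^ z) (+-identityʳ k))
        l : ∀ u w → u ℤ.* u ℤ.- w ℤ.* w ≡ (u ℤ.- w) ℤ.* (u ℤ.+ w)
        l = ℤSolver.solve-∀
      both>0 : 0 < ∣ u ℤ.- w ∣ * ∣ u ℤ.+ w ∣
      both>0 = subst (0 <_) Vh≡ (V>0 h h>0)
      notboth : q ∣ ∣ u ℤ.- w ∣ → ¬ q ∣ ∣ u ℤ.+ w ∣
      notboth d₁ d₂ = [ (λ x → q≢2 q∣m (prime∣prime pr prime[2] x)) , (λ x → q∤a (primeℤ∣^ pr a k x)) ]′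
        (euclidℤ pr (pos 2) u (fromS (subst (pos q S.∣_) (l u w)
            (S.∣m∣n⇒∣m+n (toS {z = u ℤ.- w} d₁) (toS {z = u ℤ.+ w} d₂)))))
        where
        l : ∀ u w → (u ℤ.- w) ℤ.+ (u ℤ.+ w) ≡ pos 2 ℤ.* u
        l = ℤSolver.solve-∀
      one : ∀ z → 0 < z → 2 ∣ z → z ≤ A ^ k + B ^ k → q ^ s ∣ z → q ^ s ≤ A ^ k
      one z z>0 2∣z z≤ (divides j refl) = *-cancelˡ-≤ 2 (begin
        2 * q ^ s          ≤⟨ *-monoˡ-≤ (q ^ s) (∣⇒≤′ (*-posˡ (q ^ s) z>0) 2∣j) ⟩
        j * q ^ s          ≤⟨ z≤ ⟩
        A ^ k + B ^ k      ≤⟨ +-monoʳ-≤ (A ^ k) (^-monoˡ-≤ k (<⇒≤ B<A)) ⟩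
        A ^ k + A ^ k      ≡⟨ cong (A ^ k +_) (sym (+-identityʳ (A ^ k))) ⟩
        2 * A ^ k          ∎)
        where
        2∣j : 2 ∣ j
        2∣j = [ (λ x → x) , (λ x → ⊥-elim (q≢2 q∣m (sym (prime∣prime prime[2] pr (prime∣^ prime[2] q s x))))) ]′
            (euclidsLemma j (q ^ s) prime[2] 2∣z)
      2∣- : 2 ∣ ∣ u ℤ.- w ∣
      2∣- = 2∣V a b k a-odd b-odd
      2∣+ : 2 ∣ ∣ u ℤ.+ w ∣
      2∣+ = fromS (subst (pos 2 S.∣_) (l u w) (S.∣m∣n⇒∣m+n (toS {z = u ℤ.- w} 2∣-) (S.∣m⇒∣m*n w (S.∣-refl {pos 2}))))
        where
        l : ∀ u w → (u ℤ.- w) ℤ.+ pos 2 ℤ.* w ≡ u ℤ.+ w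
        l = ℤSolver.solve-∀
      +≤ : ∣ u ℤ.+ w ∣ ≤ A ^ k + B ^ k
      +≤ = subst (∣ u ℤ.+ w ∣ ≤_) (cong₂ _+_ (abs-^ a k) (abs-^ b k)) (ℤₚ.∣i+j∣≤∣i∣+∣j∣ u w)
      q^s≤ : q ^ s ≤ A ^ k
      q^s≤ with q ∣? ∣ u ℤ.+ w ∣
      ... | no nd = one ∣ u ℤ.- w ∣ (*-posˡ ∣ u ℤ.+ w ∣ both>0) 2∣- (V-upper a b k)
          (p^∣*-cancelʳ pr nd s ∣ u ℤ.- w ∣ (subst (q ^ s ∣_) Vh≡ q^s∣Vh))
      ... | yes d = one ∣ u ℤ.+ w ∣ (*-posʳ ∣ u ℤ.- w ∣ both>0) 2∣+ +≤
          (p^∣*-cancelʳ pr (λ d′ → notboth d′ d) s ∣ u ℤ.+ w ∣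
          (subst (q ^ s ∣_) (trans Vh≡ (*-comm ∣ u ℤ.- w ∣ ∣ u ℤ.+ w ∣)) q^s∣Vh))

    -- Were every prime of the squarefree number T d to divide some T e, then T d would divide their product, which is
    -- smaller.
    freshPrime : ∀ d ds → d ∣ m → All (0 <_) ds → sum ds + 2 ≤ d → ∃ λ p → Prime p × (p ∣ Tₘ d) × All
        (λ e → ¬ p ∣ V a b e) ds
    freshPrime d ds d∣m ds>0 size = decide (all? covered? (primesOf (Tₘ d)))
      where
      Covered : ℕ → Set
      Covered p = Any (λ e → p ∣ Tₘ e) ds
      covered? : ∀ p → Dec (Covered p)
      covered? p = any? (λ e → p ∣? Tₘ e) ds
      open ≤-Reasoning
      d≡ : 2 + (d ∸ 2) ≡ d
      d≡ = m+[n∸m]≡n (≤-trans (m≤n+m 2 (sum ds)) size)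
      d>0 : 0 < d
      d>0 = ≤-trans (≤-trans (s≤s z≤n) (m≤n+m 2 (sum ds))) size
      big : A ^ (d ∸ 2) < Tₘ d
      big = subst (λ z → A ^ (d ∸ 2) < Tₘ z) d≡ (T-lower (d ∸ 2) (subst (λ z → ¬ 2 ∣ z) (sym d≡) (odd-divisor d∣m)))
      prod>0 : ∀ es → All (0 <_) es → 0 < product (map Tₘ es)
      prod>0 [] [] = s≤s z≤n
      prod>0 (e ∷ es) (h ∷ hs) = *-pos (T>0 e h) (prod>0 es hs)
      prod≤ : ∀ es → All (0 <_) es → product (map Tₘ es) ≤ A ^ sum es
      prod≤ [] [] = ≤-refl
      prod≤ (e ∷ es) (h ∷ hs) = subst (product (map Tₘ (e ∷ es)) ≤_) (sym (^-distribˡ-+-* A e (sum es)))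
          (*-mono-≤ (<⇒≤ (T-upper e h)) (prod≤ es hs))
      any⇒∣ : ∀ {p} es → Any (λ e → p ∣ Tₘ e) es → p ∣ product (map Tₘ es)
      any⇒∣ (e ∷ es) (here h) = ∣m⇒∣m*n (product (map Tₘ es)) h
      any⇒∣ (e ∷ es) (there h) = ∣n⇒∣m*n (Tₘ e) (any⇒∣ es h)
      T∣prod : All Covered (primesOf (Tₘ d)) → Tₘ d ∣ product (map Tₘ ds)
      T∣prod allp = subst (_∣ product (map Tₘ ds)) (squarefree⇒product (T>0 d d>0)
          (λ p pr h → W-squarefree p pr (∣-trans h (T∣W d∣m))))
        (product-∣ (All.map proj₁ (primesOf-all (Tₘ d))) (Sorted⇒Unique (primesOf-sorted (Tₘ d)))
            (All.map (any⇒∣ ds) allp))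
      all-covered : ¬ All Covered (primesOf (Tₘ d))
      all-covered allp = <⇒≱ big (begin
        Tₘ d                     ≤⟨ ∣⇒≤′ (prod>0 ds ds>0) (T∣prod allp) ⟩
        product (map Tₘ ds)      ≤⟨ prod≤ ds ds>0 ⟩
        A ^ sum ds               ≤⟨ ^-mono-exp A>0 (m+n≤o⇒m≤o∸n (sum ds) size) ⟩
        A ^ (d ∸ 2)              ∎)
      fresh : (∃ λ p → p ∈ primesOf (Tₘ d) × ¬ Covered p) → ∃ λ p → Prime p × (p ∣ Tₘ d) × All (λ e → ¬ p ∣ V a b e)
          ds
      fresh (p , p∈ , ¬cov) = p , pr , p∣T , All.map (λ {e} → ∤V e) (Allₚ.¬Any⇒All¬ ds ¬cov)
        where
        pr = proj₁ (All.lookup (primesOf-all (Tₘ d)) p∈)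
        p∣T = proj₂ (All.lookup (primesOf-all (Tₘ d)) p∈)
        ∤V : ∀ e → ¬ p ∣ Tₘ e → ¬ p ∣ V a b e
        ∤V e nd h = [ W∤V1 pr (∣-trans p∣T (T∣W d∣m)) , nd ]′
            (euclidsLemma (V a b 1) (Tₘ e) pr (subst (p ∣_) (V≡V1*T a b e) h))
      decide : Dec (All Covered (primesOf (Tₘ d))) → ∃ λ p → Prime p × (p ∣ Tₘ d) × All (λ e → ¬ p ∣ V a b e) ds
      decide (yes allp) = ⊥-elim (all-covered allp)
      decide (no ¬all) = fresh (find (Allₚ.¬All⇒Any¬ covered? (primesOf (Tₘ d)) ¬all))

    T∣V : ∀ {p} d → p ∣ Tₘ d → p ∣ V a b d
    T∣V d h = subst (_ ∣_) (sym (V≡V1*T a b d)) (∣n⇒∣m*n (V a b 1) h)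

    -- Counting primes congruent to 1 modulo `q` by the order of `a/b`.

    New : ℕ → ℕ → ℕ → Set
    New q M p = Prime p × (p ∣ V a b M) × (q ∣ p ∸ 1) × (¬ p ∣ V a b 1)

    ∤V1 : ∀ {p} e → ¬ p ∣ V a b e → ¬ p ∣ V a b 1
    ∤V1 e nd h = nd (∣-trans h (V-∣ a b (1∣ e)))

    -- The order of `a/b` modulo `p` divides `e * r` but not `e`, whereas a common divisor of
    -- `e * r` and `F` divides `e`.
    ∤V-gcd : ∀ {p e r F} → Prime p → Prime r → 0 < e → ¬ r ∣ F → p ∣ V a b (e * r) → ¬ p ∣ V a b e → ¬ p ∣ V a b F
    ∤V-gcd {p} {e} {r} {F} pr r-pr e>0 r∤F d nd h =
      nd (∣-trans (V-gcd {a} {b} cop pr (e * r) F (*-pos e>0 (prime>0 r-pr)) d h) (V-∣ a b (gcd-∣-left {e} r-pr r∤F)))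

    Fresh : ℕ → List ℕ → Set
    Fresh d ds = ∃ λ p → Prime p × (p ∣ Tₘ d) × All (λ e → ¬ p ∣ V a b e) ds

    3≤ : ∀ {q} → Prime q → q ∣ m → 3 ≤ q
    3≤ pr q∣m = odd-prime≥3 pr (q≢2 q∣m)

    new-q : ∀ {q} → Prime q → q ∣ m → ∃ λ p → New q q p
    new-q {q} pr q∣m = go (freshPrime q [] q∣m [] (prime>1 pr))
      where
      go : Fresh q [] → ∃ λ p → New q q p
      go (p , p-pr , p∣T , _) = p , p-pr , T∣V q p∣T , q∣p-1 1 p-pr pr (s≤s z≤n)
          (subst (λ z → p ∣ V a b z) (sym (*-identityˡ q)) (T∣V q p∣T)) p∤V1 , p∤V1
        where
        p∤V1 : ¬ p ∣ V a b 1
        p∤V1 = W∤V1 p-pr (∣-trans p∣T (T∣W q∣m))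

    new-qr : ∀ {q r} F → Prime q → Prime r → q * r ∣ m → ¬ r ∣ F → ∃ λ p → New q (q * r) p × (¬ p ∣ V a b F)
    new-qr {q} {r} F q-pr r-pr qr∣m r∤F = go (freshPrime (q * r) (q ∷ r ∷ []) qr∣m (prime>0 q-pr ∷ prime>0 r-pr ∷ [])
        (pair-size (3≤ q-pr (∣-trans (m∣m*n r) qr∣m)) (3≤ r-pr (∣-trans (n∣m*n q) qr∣m))))
      where
      go : Fresh (q * r) (q ∷ r ∷ []) → ∃ λ p → New q (q * r) p × (¬ p ∣ V a b F)
      go (p , pr , p∣T , p∤Vq ∷ p∤Vr ∷ []) = p ,
        (pr , p∣V , q∣p-1 r pr q-pr (prime>0 r-pr) (subst (λ z → p ∣ V a b z) (*-comm q r) p∣V) p∤Vr , ∤V1 q p∤Vq) ,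
        ∤V-gcd pr r-pr (prime>0 q-pr) r∤F p∣V p∤Vq
        where
        p∣V : p ∣ V a b (q * r)
        p∣V = T∣V (q * r) p∣T

    -- Excluding `q * r`, `q * t` and `r * t` makes `q * r * t` the exact order. Each exclusion has
    -- its use: `r * t` gives `q ∣ p - 1`, `q * t` keeps `p` out of `V a b F`, and `q * r` separates
    -- `p` from primes found without `t`.
    new-qrt : ∀ {q r t} F → Prime q → Prime r → Prime t → ¬ r ≡ t → q * r * t ∣ m → ¬ r ∣ F →
      ∃ λ p → New q (q * r * t) p × (¬ p ∣ V a b F) × (¬ p ∣ V a b (q * r))
    new-qrt {q} {r} {t} F q-pr r-pr t-pr r≢t d∣m r∤F = go (freshPrime (q * r * t) (q * r ∷ q * t ∷ r * t ∷ []) d∣m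
         (*-pos (prime>0 q-pr) (prime>0 r-pr) ∷ *-pos (prime>0 q-pr) (prime>0 t-pr) ∷ *-pos (prime>0 r-pr)
             (prime>0 t-pr) ∷ [])
         (triple-size (3≤ q-pr q∣m) (3≤ r-pr r∣m) (3≤ t-pr t∣m) (five (r ≟ 3))))
      where
      q∣m : q ∣ m
      q∣m = ∣-trans (∣-trans (m∣m*n r) (m∣m*n t)) d∣m
      r∣m : r ∣ m
      r∣m = ∣-trans (∣-trans (n∣m*n q) (m∣m*n t)) d∣m
      t∣m : t ∣ m
      t∣m = ∣-trans (n∣m*n (q * r)) d∣m
      five : Dec (r ≡ 3) → 5 ≤ r ⊎ 5 ≤ t
      five (no r≢3) = inj₁ (odd-prime≥5 r-pr (q≢2 r∣m) r≢3)
      five (yes r≡3) = inj₂ (odd-prime≥5 t-pr (q≢2 t∣m) (λ t≡3 → r≢t (trans r≡3 (sym t≡3))))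
      l₁ : ∀ q r t → q * r * t ≡ r * t * q
      l₁ = solve-∀
      l₂ : ∀ q r t → q * r * t ≡ q * t * r
      l₂ = solve-∀
      go : Fresh (q * r * t) (q * r ∷ q * t ∷ r * t ∷ []) → ∃ λ p → New q (q * r * t) p × (¬ p ∣ V a b F) ×
          (¬ p ∣ V a b (q * r))
      go (p , pr , p∣T , p∤qr ∷ p∤qt ∷ p∤rt ∷ []) = p ,
        (pr , p∣V , q∣p-1 (r * t) pr q-pr (*-pos (prime>0 r-pr) (prime>0 t-pr))
            (subst (λ z → p ∣ V a b z) (l₁ q r t) p∣V) p∤rt , ∤V1 (q * r) p∤qr) ,
        ∤V-gcd pr r-pr (*-pos (prime>0 q-pr) (prime>0 t-pr)) r∤F (subst (λ z → p ∣ V a b z) (l₂ q r t) p∣V) p∤qt ,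
            p∤qr
        where
        p∣V : p ∣ V a b (q * r * t)
        p∣V = T∣V (q * r * t) p∣T

    -- All entries divide `V a b M`, so a prime not dividing it is known to be new; `P` carries the
    -- property that separates two such lists.
    NewList : ℕ → ℕ → (ℕ → Set) → ℕ → Set
    NewList q M P len = ∃ λ L → length L ≡ len × All (λ p → New q M p × P p) L × Unique L

    New-∣ : ∀ {q M M′ p} → M ∣ M′ → New q M p → New q M′ p
    New-∣ M∣M′ (pr , d , rest) = pr , ∣-trans d (V-∣ a b M∣M′) , rest

    -- One prime of order `q r` and one of order `q r t` for each `t`. The latter does not divide
    -- `V` at the earlier level, which `t` does not divide, so the entries are distinct.
    newList₁ : ∀ {q r} F → Prime q → Prime r → ¬ r ∣ F → ∀ ts → All Prime ts → Unique ts → All (λ t → ¬ t ≡ q) ts →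
        All (λ t → ¬ r ≡ t) ts →
      q * r * product ts ∣ m → NewList q (q * r * product ts) (λ p → ¬ p ∣ V a b F) (suc (length ts))
    newList₁ {q} {r} F q-pr r-pr r∤F [] _ _ _ _ d∣m = go (new-qr F q-pr r-pr (∣-trans (m∣m*n 1) d∣m) r∤F)
      where
      go : (∃ λ p → New q (q * r) p × (¬ p ∣ V a b F)) → NewList q (q * r * 1) (λ p → ¬ p ∣ V a b F) 1
      go (p , new , p∤F) = p ∷ [] , refl , (New-∣ {q} {q * r} (m∣m*n 1) new , p∤F) ∷ [] , [] ∷ []
    newList₁ {q} {r} F q-pr r-pr r∤F (t ∷ ts) (t-pr ∷ prs) (t≢ ∷ u) (t≢q ∷ neq) (r≢t ∷ ner) d∣m =
        go (newList₁ F q-pr r-pr r∤F ts prs u neq ner (∣-trans (*-monoʳ-∣ (q * r) (n∣m*n t)) d∣m))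
           (new-qrt F q-pr r-pr t-pr r≢t (∣-trans qrt∣ d∣m) r∤F)
      where
      M M′ : ℕ
      M = q * r * product ts
      M′ = q * r * (t * product ts)
      qrt∣ : q * r * t ∣ M′
      qrt∣ = *-monoʳ-∣ (q * r) (m∣m*n (product ts))
      M∣M′ : M ∣ M′
      M∣M′ = *-monoʳ-∣ (q * r) (n∣m*n t)
      t∤M : ¬ t ∣ M
      t∤M = prime∤* t-pr (prime∤* t-pr (λ d → t≢q (prime∣prime t-pr q-pr d))
          (λ d → r≢t (sym (prime∣prime t-pr r-pr d)))) (prime∤product t-pr prs t≢)
      go : NewList q M (λ p → ¬ p ∣ V a b F) (suc (length ts)) →
          (∃ λ p → New q (q * r * t) p × (¬ p ∣ V a b F) × (¬ p ∣ V a b (q * r))) →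
        NewList q M′ (λ p → ¬ p ∣ V a b F) (suc (suc (length ts)))
      go (L , len , all , uL) (p , new , p∤F , p∤qr) = p ∷ L , cong suc len ,
        (New-∣ {q} qrt∣ new , p∤F) ∷ All.map (λ {p′} (nw , nF) → New-∣ {q} M∣M′ nw , nF) all ,
        All.map (λ {p′} (nw , _) e → p∤ (subst (_∣ V a b M) (sym e) (proj₁ (proj₂ nw)))) all ∷ uL
        where
        p∤ : ¬ p ∣ V a b M
        p∤ = ∤V-gcd (proj₁ new) t-pr (*-pos (prime>0 q-pr) (prime>0 r-pr)) t∤M (proj₁ (proj₂ new)) p∤qr

    -- A further prime `r` brings the orders that involve `r`. Their primes avoid `V a b F`, whereas
    -- all earlier ones divide it; this is the recursion of `G`.
    newList₂ : ∀ {q} → Prime q → ∀ rs → All Prime rs → Unique rs → All (λ r → ¬ r ≡ q) rs →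
      q * product rs ∣ m → NewList q (q * product rs) (λ _ → ⊤) (G (length rs))
    newList₂ {q} q-pr [] _ _ _ d∣m = go (new-q q-pr (∣-trans (m∣m*n 1) d∣m))
      where
      go : (∃ λ p → New q q p) → NewList q (q * 1) (λ _ → ⊤) 1
      go (p , new) = p ∷ [] , refl , (New-∣ {q} {q} (m∣m*n 1) new , tt) ∷ [] , [] ∷ []
    newList₂ {q} q-pr (r ∷ rs) (r-pr ∷ prs) (r≢ ∷ u) (r≢q ∷ neq) d∣m =
        go (newList₁ F q-pr r-pr r∤F rs prs u neq r≢ (subst (_∣ m) (sym (*-assoc q r (product rs))) d∣m))
           (newList₂ q-pr rs prs u neq (∣-trans F∣ d∣m))
      where
      F : ℕ
      F = q * product rs
      F∣ : F ∣ q * (r * product rs)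
      F∣ = *-monoʳ-∣ q (n∣m*n r)
      r∤F : ¬ r ∣ F
      r∤F = prime∤* r-pr (λ d → r≢q (prime∣prime r-pr q-pr d)) (prime∤product r-pr prs r≢)
      go : NewList q (q * r * product rs) (λ p → ¬ p ∣ V a b F) (suc (length rs)) → NewList q F (λ _ → ⊤)
          (G (length rs)) →
        NewList q (q * (r * product rs)) (λ _ → ⊤) (G (length rs) + suc (length rs))
      go (L₁ , len₁ , all₁ , u₁) (L₂ , len₂ , all₂ , u₂) = L₁ ++ L₂ ,
        trans (length-++ L₁) (trans (cong₂ _+_ len₁ len₂) (+-comm (suc (length rs)) (G (length rs)))) ,
        Allₚ.++⁺ (All.map (λ {p} (nw , _) → New-∣ {q} (∣-reflexive (*-assoc q r (product rs))) nw , tt) all₁)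
            (All.map (λ {p} (nw , _) → New-∣ {q} F∣ nw , tt) all₂) ,
        Unique-++⁺ u₁ u₂ (λ (i₁ , i₂) → proj₂ (All.lookup all₁ i₁) (proj₁ (proj₂ (proj₁ (All.lookup all₂ i₂)))))

    -- The ratio of `W` to its totient.

    ps : List ℕ
    ps = primesOf W

    R : ℕ
    R = product (preds ps)

    product-ps : product ps ≡ W
    product-ps = squarefree⇒product W>0 W-squarefree

    qs : List ℕ
    qs = primesOf m

    qs-unique : Unique qs
    qs-unique = Sorted⇒Unique (primesOf-sorted m)

    PrimeW : ℕ → Set
    PrimeW p = Prime p × p ∣ W

    q^2G≤A^q : ∀ {q} → q ∈ qs → q ^ (2 * G (length (others q qs))) ≤ A ^ q
    q^2G≤A^q {q} q∈ = go (newList₂ q-pr rs prs (AllPairsₚ.filter⁺ (λ x → ¬? (x ≟ q)) qs-unique) ne qrs∣m)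
      where
      q-pr = proj₁ (All.lookup (primesOf-all m) q∈)
      q∣m = proj₂ (All.lookup (primesOf-all m) q∈)
      rs : List ℕ
      rs = others q qs
      prs : All Prime rs
      prs = Allₚ.filter⁺ (λ x → ¬? (x ≟ q)) (All.map proj₁ (primesOf-all m))
      ds : All (_∣ m) rs
      ds = Allₚ.filter⁺ (λ x → ¬? (x ≟ q)) (All.map proj₂ (primesOf-all m))
      ne : All (λ r → ¬ r ≡ q) rs
      ne = Allₚ.all-filter (λ x → ¬? (x ≟ q)) qs
      qrs∣m : q * product rs ∣ m
      qrs∣m = product-∣ {q ∷ rs} (q-pr ∷ prs) (All.map (λ n e → n (sym e)) ne ∷ AllPairsₚ.filter⁺ (λ x → ¬? (x ≟ q))
          qs-unique) (q∣m ∷ ds)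
      go : NewList q (q * product rs) (λ _ → ⊤) (G (length rs)) → q ^ (2 * G (length rs)) ≤ A ^ q
      go (L , len , new , u) = subst (λ s → q ^ (2 * s) ≤ A ^ q) len (q^2s≤A^q q-pr q∣m (length L) (q^∣Vn q-pr q∣m L
        (All.map (λ {p} (nw , _) → proj₁ nw) new) u
        (All.map (λ {p} (nw , _) → Vm∤V1⇒W (proj₁ nw) (∣-trans (proj₁ (proj₂ nw)) (V-∣ a b qrs∣m))
            (proj₂ (proj₂ (proj₂ nw)))) new)
        (All.map (λ {p} (nw , _) → proj₁ (proj₂ (proj₂ nw))) new)))

    2q∣ : ∀ {q p} → Prime q → q ∣ m → PrimeW p → q ∣ p ∸ 1 → 2 * q ∣ p ∸ 1
    2q∣ {q} {p} q-pr q∣m (pr , p∣W) (divides j e) = subst (2 * q ∣_) (sym e) (*-monoˡ-∣ q 2∣j)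
      where
      2∣p-1 : 2 ∣ p ∸ 1
      2∣p-1 = 2∣prime∸1 pr (λ { refl → W∤V1 pr p∣W 2∣V1 })
      2∣j : 2 ∣ j
      2∣j = [ (λ x → x) , (λ x → ⊥-elim (q≢2 q∣m (sym (prime∣prime prime[2] q-pr x)))) ]′
          (euclidsLemma j q prime[2] (subst (2 ∣_) e 2∣p-1))

    -- The prime divides `V` at `gcd m (p - 1)`, which cannot be 1 because `p ∤ V a b 1`.
    covered : ∀ {p} → PrimeW p → Any (λ q → q ∣ p ∸ 1) qs
    covered {p} (pr , p∣W) = go (gcd m (p ∸ 1) ≟ 1)
      where
      p∣Vm : p ∣ V a b m
      p∣Vm = ∣-trans p∣W W∣Vm
      p∣Vg : p ∣ V a b (gcd m (p ∸ 1))
      p∣Vg = V-gcd {a} {b} cop pr m (p ∸ 1) m>0 p∣Vm (V-fermat {a} {b} cop pr (V-∤a {a} {b} cop pr m>0 p∣Vm)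
          (V-∤b {a} {b} cop pr m>0 p∣Vm))
      go : Dec (gcd m (p ∸ 1) ≡ 1) → Any (λ q → q ∣ p ∸ 1) qs
      go (yes e) = ⊥-elim (W∤V1 pr p∣W (subst (λ z → p ∣ V a b z) e p∣Vg))
      go (no ne) = pick (primeDivisor (≤∧≢⇒< (∣-pos m>0 (gcd[m,n]∣m m (p ∸ 1))) (ne ∘ sym)))
        where
        pick : (∃ λ q → Prime q × q ∣ gcd m (p ∸ 1)) → Any (λ q → q ∣ p ∸ 1) qs
        pick (q , q-pr , d) = Any.map (λ { refl → ∣-trans d (gcd[m,n]∣n m (p ∸ 1)) })
            (primesOf-complete m>0 q-pr (∣-trans d (gcd[m,n]∣m m (p ∸ 1))))

    length-qs>0 : 0 < length qs
    length-qs>0 = go (primeDivisor m>1)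
      where
      go : (∃ λ q → Prime q × q ∣ m) → 0 < length qs
      go (q , pr , d) = ne (primesOf-complete m>0 pr d)
        where
        ne : ∀ {xs} → q ∈ xs → 0 < length xs
        ne (here _) = s≤s z≤n
        ne (there _) = s≤s z≤n

    module Ratio (E b₀ : ℕ) (b₀>0 : 0 < b₀) (base₀ : 3 ^ E ≤ b₀ ^ 12) (base₁ : 6 ^ (E * 2) ≤ b₀ ^ 24)
        (base₂ : 12 ^ (E * 3) ≤ b₀ ^ 48)
      (base₃ : 21 ^ (E * 4) ≤ b₀ ^ 84) (base₄ : 33 ^ E ≤ b₀ ^ 24) (2^E≤ : 2 ^ E ≤ b₀ ^ 6)
      (b₀≤ : ∀ {q} → Prime q → q ∣ m → b₀ ≤ q) where

      open Growth E b₀ b₀>0 base₀ base₁ base₂ base₃ base₄ 2^E≤ using (classBound)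

      k : ℕ
      k = length qs

      bounded : ∀ {q} → q ∈ qs → Cover.Bounded (E * k) (A ^ 3) PrimeW q
      bounded {q} q∈ ps′ good srt ones = subst (λ z → product ps′ ^ (E * z) ≤ A ^ 3 * product (preds ps′) ^ (E * z))
          (length-others qs-unique q∈)
        (classBound {A} {q} {i} {s} ps′ (b₀≤ q-pr q∣m) (m≤n⊔m (length ps′) (G i)) hq (m≤m⊔n (length ps′) (G i))
          (All.zipWith (λ {p} (gd , d) → 2q∣ q-pr q∣m gd d) (good , ones))
              (All.map (λ {p} (pr , _) → prime>1 pr) good) srt)
        where
        q-pr = proj₁ (All.lookup (primesOf-all m) q∈)
        q∣m = proj₂ (All.lookup (primesOf-all m) q∈)
        i s : ℕ
        i = length (others q qs)
        -- Both the given primes and the `G i` constructed ones satisfy the bound on `q^(2s)`, so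
        -- the larger number does; `classBound` needs `s` above both.
        s = length ps′ ⊔ G i
        hq : q ^ (2 * s) ≤ A ^ q
        hq = [ (λ e → subst (λ z → q ^ (2 * z) ≤ A ^ q) (sym e) (q^2s≤A^q q-pr q∣m (length ps′)
                 (q^∣Vn q-pr q∣m ps′ (All.map proj₁ good) (Sorted⇒Unique srt) (All.map proj₂ good) ones)))
             , (λ e → subst (λ z → q ^ (2 * z) ≤ A ^ q) (sym e) (q^2G≤A^q q∈)) ]′ (⊔-sel (length ps′) (G i))

      -- Each of the `k` classes costs `A ^ 3` at the exponent `E * k`; the k-th root leaves it
      -- once.
      W^E≤ : W ^ E ≤ A ^ 3 * R ^ E
      W^E≤ = ^-cancelˡ-≤ k length-qs>0 _ _ (begin
        (W ^ E) ^ k                    ≡⟨ ^-*-assoc W E k ⟩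
        W ^ (E * k)                    ≡⟨ cong (_^ (E * k)) (sym product-ps) ⟩
        product ps ^ (E * k)           ≤⟨ Cover.cover (E * k) (A ^ 3) PrimeW qs (All.tabulate bounded) ps
            (primesOf-all W) (primesOf-sorted W) (All.map covered (primesOf-all W)) ⟩
        (A ^ 3) ^ k * R ^ (E * k)      ≡⟨ cong ((A ^ 3) ^ k *_) (sym (^-*-assoc R E k)) ⟩
        (A ^ 3) ^ k * (R ^ E) ^ k      ≡⟨ sym (^-distribʳ-* k (A ^ 3) (R ^ E)) ⟩
        (A ^ 3 * R ^ E) ^ k            ∎)
        where open ≤-Reasoning

    -- The final inequality between `X = g ∣a∣` and the totient ratios of `W` and `U = g * V 1`.

    U X : ℕ
    U = g * V a b 1
    X = g * A

    U>0 : 0 < U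
    U>0 = *-pos g>0 V1>0

    U<2X : U < 2 * X
    U<2X = subst (U <_) (l g A) (*-monoʳ-< g {{>-nonZero g>0}} V1<2A)
      where
      l : ∀ x y → x * (2 * y) ≡ 2 * (x * y)
      l = solve-∀

    A≤X : A ≤ X
    A≤X = m≤n*m A g {{>-nonZero g>0}}

    R>0 : 0 < R
    R>0 = go (primesOf-all W)
      where
      go : ∀ {xs} → All PrimeW xs → 0 < product (preds xs)
      go [] = s≤s z≤n
      go ((pr , _) ∷ gs) = *-pos (m<n⇒0<n∸m (prime>1 pr)) (go gs)

    Z : ℕ
    Z = g ^ (m ∸ 1)

    N≡ : N ≡ W * (Z * U)
    N≡ = begin
      g ^ m * V a b m                       ≡⟨ cong₂ _*_ (cong (g ^_) (sym (m+[n∸m]≡n m>0))) (V≡V1*T a b m) ⟩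
      g * Z * (V a b 1 * W)                 ≡⟨ l g Z (V a b 1) W ⟩
      W * (Z * (g * V a b 1))               ∎
      where
      open ≡-Reasoning
      l : ∀ g z v w → g * z * (v * w) ≡ w * (z * (g * v))
      l = solve-∀

    -- The primes of `Z` are primes of `g` and hence of `U`, so `Z` passes through φ unchanged; `W`
    -- is squarefree and prime to `g` and to `V a b 1`.
    φN≡ : φ N ≡ R * (Z * φ U)
    φN≡ = begin
      φ N                                ≡⟨ cong φ (trans N≡ (cong (_* (Z * U)) (sym product-ps))) ⟩
      φ (product ps * (Z * U))           ≡⟨ φ-product-* (All.map proj₁ (primesOf-all W))
          (Sorted⇒Unique (primesOf-sorted W)) (All.map (λ {p} → nd p) (primesOf-all W)) ⟩
      R * φ (Z * U)                      ≡⟨ cong (R *_) (φ-*-supported (^-pos (m ∸ 1) g>0)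
          (λ p pr d → ∣m⇒∣m*n (V a b 1) (prime∣^ pr g (m ∸ 1) d))) ⟩
      R * (Z * φ U)                      ∎
      where
      open ≡-Reasoning
      nd : ∀ p → PrimeW p → ¬ p ∣ Z * U
      nd p (pr , d) = prime∤* pr (λ h → W∤g pr d (prime∣^ pr g (m ∸ 1) h)) (prime∤* pr (W∤g pr d) (W∤V1 pr d))

    -- As `n` is even, `V a b n` is the difference of the absolute powers whatever the signs, so
    -- `V a b m` is at least `A` times as large; another factor `g` comes from `n < m`.
    X*φN≤N : X * φ N ≤ N
    X*φN≤N = begin
      g * A * φ N                   ≡⟨ cong (g * A *_) eq ⟩
      g * A * (g ^ n * V a b n)     ≡⟨ l g A (g ^ n) (V a b n) ⟩
      g ^ suc n * (A * V a b n)     ≤⟨ *-mono-≤ (^-mono-exp g>0 n<m) A*Vn≤ ⟩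
      g ^ m * V a b m               ∎
      where
      open ≤-Reasoning
      l : ∀ g A x y → g * A * (x * y) ≡ g * x * (A * y)
      l = solve-∀
      Vn-eq : V a b n + B ^ n ≡ A ^ n
      Vn-eq = subst (λ z → V a b z + B ^ z ≡ A ^ z) (sym (proj₂ (even⇒2* n-even)))
          (V-even a b (proj₁ (even⇒2* n-even)) (<⇒≤ B<A))
      A*Vn≤ : A * V a b n ≤ V a b m
      A*Vn≤ = begin
        A * V a b n                  ≤⟨ *-monoˡ-≤ (V a b n)
            (subst (_≤ A ^ (m ∸ n)) (*-identityʳ A) (^-mono-exp {j = 1} A>0 (m<n⇒0<n∸m n<m))) ⟩
        A ^ (m ∸ n) * V a b n        ≤⟨ A^V≤V a b n (m ∸ n) (<⇒≤ B<A) Vn-eq ⟩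
        V a b (m ∸ n + n)            ≡⟨ cong (V a b) (m∸n+n≡m (<⇒≤ n<m)) ⟩
        V a b m                      ∎

    XφUR≤WU : X * φ U * R ≤ W * U
    XφUR≤WU = *-cancelʳ-≤ _ _ Z {{>-nonZero (^-pos (m ∸ 1) g>0)}}
        (subst₂ _≤_ (trans (cong (X *_) φN≡) (l X R Z (φ U))) (trans N≡ (l₂ W Z U)) X*φN≤N)
      where
      l : ∀ x r z f → x * (r * (z * f)) ≡ x * f * r * z
      l = solve-∀
      l₂ : ∀ w z u → w * (z * u) ≡ w * u * z
      l₂ = solve-∀

    -- The E-th power of `X ≤ (W/φ(W)) (U/φ(U))` with `E = 3 + e`; since `A ≤ X`, the ratio of `W`
    -- uses up three of the `E` factors `X`.
    X^e≤ : ∀ e → W ^ (3 + e) ≤ A ^ 3 * R ^ (3 + e) → X ^ e * φ U ^ (3 + e) ≤ U ^ (3 + e)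
    X^e≤ e h = *-cancelˡ-≤ (X ^ 3 * R ^ E) {{>-nonZero (*-pos (^-pos 3 (<-≤-trans A>0 A≤X)) (^-pos E R>0))}} (begin
      X ^ 3 * R ^ E * (X ^ e * φ U ^ E)      ≡⟨ l (X ^ 3) (R ^ E) (X ^ e) (φ U ^ E) ⟩
      X ^ 3 * X ^ e * φ U ^ E * R ^ E        ≡⟨ cong (λ z → z * φ U ^ E * R ^ E) (sym (^-distribˡ-+-* X 3 e)) ⟩
      X ^ E * φ U ^ E * R ^ E                ≡⟨ trans (cong (_* R ^ E) (sym (^-distribʳ-* E X (φ U))))
          (sym (^-distribʳ-* E (X * φ U) R)) ⟩
      (X * φ U * R) ^ E                      ≤⟨ ^-monoˡ-≤ E XφUR≤WU ⟩
      (W * U) ^ E                            ≡⟨ ^-distribʳ-* E W U ⟩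
      W ^ E * U ^ E                          ≤⟨ *-monoˡ-≤ (U ^ E) h ⟩
      A ^ 3 * R ^ E * U ^ E                  ≤⟨ *-monoˡ-≤ (U ^ E) (*-monoˡ-≤ (R ^ E) (^-monoˡ-≤ 3 A≤X)) ⟩
      X ^ 3 * R ^ E * U ^ E                  ∎)
      where
      open ≤-Reasoning
      E = 3 + e
      l : ∀ x r y f → x * r * (y * f) ≡ x * y * f * r
      l = solve-∀

    U⁴< : U ^ 4 < 27 * X * φ U ^ 4
    U⁴< = *-cancelˡ-< 2 (U ^ 4) (27 * X * φ U ^ 4) (begin-strict
      2 * (U * U ^ 3)            ≡⟨ l₁ U (U ^ 3) ⟩
      U * (2 * U ^ 3)            ≤⟨ *-monoʳ-≤ U (2U³≤27φ⁴ U>0) ⟩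
      U * (27 * φ U ^ 4)         <⟨ *-monoˡ-< (27 * φ U ^ 4)
          {{>-nonZero (*-pos {27} (s≤s z≤n) (^-pos 4 (φ-pos U>0)))}} U<2X ⟩
      2 * X * (27 * φ U ^ 4)     ≡⟨ l₂ X (φ U ^ 4) ⟩
      2 * (27 * X * φ U ^ 4)     ∎)
      where
      open ≤-Reasoning
      l₁ : ∀ u c → 2 * (u * c) ≡ u * (2 * c)
      l₁ = solve-∀
      l₂ : ∀ x f → 2 * x * (27 * f) ≡ 2 * (27 * x * f)
      l₂ = solve-∀

    -- Raising to the power `c` makes the exponent of `φ U` equal to `4 * d`, so that the d-th power
    -- of `U⁴<` applies. What is left of `X` has exponent `e c - d`, which is 9 for both choices of
    -- `E`.
    X⁹< : ∀ e E c d → E * c ≡ 4 * d → e * c ≡ 9 + d → 0 < d → X ^ e * φ U ^ E ≤ U ^ E → X ^ 9 < 27 ^ d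
    X⁹< e E c d@(suc _) Ec ec _ h = *-cancelʳ-< (X ^ d * F) (X ^ 9) (27 ^ d) (begin-strict
      X ^ 9 * (X ^ d * F)                ≡⟨ trans (sym (*-assoc (X ^ 9) (X ^ d) F))
          (cong (_* F) (trans (sym (^-distribˡ-+-* X 9 d)) (trans (cong (X ^_) (sym ec)) (sym (^-*-assoc X e c))))) ⟩
      (X ^ e) ^ c * F                    ≡⟨ cong ((X ^ e) ^ c *_)
          (trans (cong (φ U ^_) (sym Ec)) (sym (^-*-assoc (φ U) E c))) ⟩
      (X ^ e) ^ c * (φ U ^ E) ^ c        ≡⟨ sym (^-distribʳ-* c (X ^ e) (φ U ^ E)) ⟩
      (X ^ e * φ U ^ E) ^ c              ≤⟨ ^-monoˡ-≤ c h ⟩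
      (U ^ E) ^ c                        ≡⟨ trans (^-*-assoc U E c) (trans (cong (U ^_) Ec) (sym (^-*-assoc U 4 d))) ⟩
      (U ^ 4) ^ d                        <⟨ ^-monoˡ-< d U⁴< ⟩
      (27 * X * φ U ^ 4) ^ d             ≡⟨ trans (^-distribʳ-* d (27 * X) (φ U ^ 4))
          (cong₂ _*_ (^-distribʳ-* d 27 X) (^-*-assoc (φ U) 4 d)) ⟩
      27 ^ d * X ^ d * F                 ≡⟨ *-assoc (27 ^ d) (X ^ d) F ⟩
      27 ^ d * (X ^ d * F)               ∎)
      where
      open ≤-Reasoning
      F = φ U ^ (4 * d)

    small-ratio : ∀ {e E c d} → c * U ≤ d * φ U → X ^ e * φ U ^ E ≤ U ^ E → c ^ E * X ^ e ≤ d ^ E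
    small-ratio {e} {E} {c} {d} r h = *-cancelʳ-≤ _ _ (φ U ^ E) {{>-nonZero (^-pos E (φ-pos U>0))}} (begin
      c ^ E * X ^ e * φ U ^ E       ≡⟨ *-assoc (c ^ E) (X ^ e) (φ U ^ E) ⟩
      c ^ E * (X ^ e * φ U ^ E)     ≤⟨ *-monoʳ-≤ (c ^ E) h ⟩
      c ^ E * U ^ E                 ≡⟨ sym (^-distribʳ-* E c U) ⟩
      (c * U) ^ E                   ≤⟨ ^-monoˡ-≤ E r ⟩
      (d * φ U) ^ E                 ≡⟨ ^-distribʳ-* E d (φ U) ⟩
      d ^ E * φ U ^ E               ∎)
      where open ≤-Reasoning

    -- Here q ≥ 3 yields W^7 ≤ A³ φ(W)^7, which is just enough because U is prime to 3 when X is small; if 3 ∤ m,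
    -- q ≥ 5 yields the better exponent 3/10.
    contradiction₃ : 3 ∣ m → ⊥
    contradiction₃ 3∣m = go (X ≤? 12)
      where
      open Ratio 7 3 (s≤s z≤n) (≤ᵇ⇒≤ (3 ^ 7) (3 ^ 12) _) (≤ᵇ⇒≤ (6 ^ 14) (3 ^ 24) _) (≤ᵇ⇒≤ (12 ^ 21) (3 ^ 48) _)
          (≤ᵇ⇒≤ (21 ^ 28) (3 ^ 84) _)
        (≤ᵇ⇒≤ (33 ^ 7) (3 ^ 24) _) (≤ᵇ⇒≤ (2 ^ 7) (3 ^ 6) _) 3≤
      h : X ^ 4 * φ U ^ 7 ≤ U ^ 7
      h = X^e≤ 4 W^E≤
      3∣Vn : 3 ∣ V a b n
      3∣Vn = use (new-q prime[3] 3∣m)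
        where
        use : (∃ λ p → New 3 3 p) → 3 ∣ V a b n
        use (p , pr , d , one , nd) = q^∣Vn prime[3] 3∣m (p ∷ []) (pr ∷ []) ([] ∷ [])
            (Vm∤V1⇒W pr (∣-trans d (V-∣ a b 3∣m)) nd ∷ []) (one ∷ [])
      -- `3 ∣ V a b n` keeps 3 out of `a`, and `a` is odd.
      5≤A : 5 ≤ A
      5≤A = ≤∧≢⇒< (≤∧≢⇒< 3≤A (λ e → V-∤a {a} {b} cop prime[3] n>0 3∣Vn (∣-reflexive e)))
          (λ e → a-odd (subst (2 ∣_) e (divides 2 refl)))
      5≤X : 5 ≤ X
      5≤X = ≤-trans 5≤A A≤X
      go : Dec (X ≤ 12) → ⊥
      go (no X≰12) = <⇒≱ (X⁹< 4 7 4 7 refl refl (s≤s z≤n) h)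
          (≤-trans (≤ᵇ⇒≤ (27 ^ 7) (13 ^ 9) _) (^-monoˡ-≤ 9 (≰⇒> X≰12)))
      -- With the ratio of `U` at most 5/2 the margin is `2^7 * 5^4 = 80000` against `5^7 = 78125`.
      go (yes X≤12) = <⇒≱ (≤-trans (≤ᵇ⇒≤ (suc (5 ^ 7)) (2 ^ 7 * 5 ^ 4) _) (*-monoʳ-≤ (2 ^ 7) (^-monoˡ-≤ 4 5≤X)))
          (small-ratio {4} {7} {2} {5} (φ-small₃ (<-≤-trans U<2X (*-monoʳ-≤ 2 X≤12)) 3∤U) h)
        where
        3∤U : ¬ 3 ∣ U
        3∤U = prime∤* prime[3] (λ 3∣g → <⇒≱ (*-mono-≤ (∣⇒≤′ g>0 3∣g) 5≤A) (≤-trans X≤12 (m≤m+n 12 2)))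
            (q∤V1 prime[3] 3∣m)

    -- Once `X ≤ 6`, a ratio of `U` up to 3 is refuted for `X ≥ 5` by `3^10 < 5^7`. For `X ≤ 4`,
    -- `g = 1` and `A = 3` are forced; then `U < 6` has ratio at most 2, and `2^10 < 3^7`.
    contradiction₅ : ¬ 3 ∣ m → ⊥
    contradiction₅ 3∤m = go (X ≤? 6) (X ≤? 4)
      where
      open Ratio 10 5 (s≤s z≤n) (≤ᵇ⇒≤ (3 ^ 10) (5 ^ 12) _) (≤ᵇ⇒≤ (6 ^ 20) (5 ^ 24) _) (≤ᵇ⇒≤ (12 ^ 30) (5 ^ 48) _)
          (≤ᵇ⇒≤ (21 ^ 40) (5 ^ 84) _)
        (≤ᵇ⇒≤ (33 ^ 10) (5 ^ 24) _) (≤ᵇ⇒≤ (2 ^ 10) (5 ^ 6) _)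
            (λ pr d → odd-prime≥5 pr (q≢2 d) (λ e → 3∤m (subst (_∣ m) e d)))
      h : X ^ 7 * φ U ^ 10 ≤ U ^ 10
      h = X^e≤ 7 W^E≤
      go : Dec (X ≤ 6) → Dec (X ≤ 4) → ⊥
      go (no X≰6) _ = <⇒≱ (X⁹< 7 10 2 5 refl refl (s≤s z≤n) h)
          (≤-trans (≤ᵇ⇒≤ (27 ^ 5) (7 ^ 9) _) (^-monoˡ-≤ 9 (≰⇒> X≰6)))
      go (yes X≤6) (no X≰4) = <⇒≱ (≤-trans (≤ᵇ⇒≤ (suc (3 ^ 10)) (1 ^ 10 * 5 ^ 7) _)
          (*-monoʳ-≤ (1 ^ 10) (^-monoˡ-≤ 7 (≰⇒> X≰4))))
          (small-ratio {7} {10} {1} {3} (subst (_≤ 3 * φ U) (sym (*-identityˡ U))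
              (φ-small (<-≤-trans U<2X (*-monoʳ-≤ 2 X≤6)))) h)
      go (yes _) (yes X≤4) = <⇒≱ (≤-trans (≤ᵇ⇒≤ (suc (2 ^ 10)) (1 ^ 10 * 3 ^ 7) _)
          (*-monoʳ-≤ (1 ^ 10) (^-monoˡ-≤ 7 (≤-trans 3≤A A≤X))))
          (small-ratio {7} {10} {1} {2} (subst (_≤ 2 * φ U) (sym (*-identityˡ U))
              (φ-tiny (<-≤-trans U<2X (*-monoʳ-≤ 2 X≤3)))) h)
        where
        g≤1 : g ≤ 1
        g≤1 = ≤-pred (≰⇒> λ 2≤g → <⇒≱ (*-mono-≤ 2≤g 3≤A) (≤-trans X≤4 (n≤1+n 4)))
        X≤3 : X ≤ 3
        X≤3 = ≤-trans (*-monoˡ-≤ A g≤1) (subst (_≤ 3) (sym (*-identityˡ A))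
            (≤-pred (≤∧≢⇒< (≤-trans A≤X X≤4) (λ e → a-odd (subst (2 ∣_) (sym e) (divides 2 refl))))))

    absurd : ⊥
    absurd = go (3 ∣? m)
      where
      go : Dec (3 ∣ m) → ⊥
      go (yes d) = contradiction₃ d
      go (no nd) = contradiction₅ nd

-- Reduction to coprime data and recovery of the solutions.

module Solutions where

  open import Data.Nat
  open import Data.Nat.Properties
  open import Data.Nat.Divisibility
  open import Data.Integer as ℤ using (ℤ; ∣_∣; 0ℤ; 1ℤ) renaming (+_ to pos)
  open Totient
  open PowerDifferences
  open CoprimeExponents
  open OddEvenExponents

  ∣∣-cases : ∀ z {k} → ∣ z ∣ ≡ k → z ≡ pos k ⊎ z ≡ ℤ.- pos k
  ∣∣-cases (pos n) refl = inj₁ refl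
  ∣∣-cases ℤ.-[1+ n ] refl = inj₂ refl

  ≢0⇒pos : ∀ {x} → x ≢ 0ℤ → 0 < ∣ x ∣
  ≢0⇒pos {x} x≢0 = n≢0⇒n>0 (x≢0 ∘ ℤₚ.∣i∣≡0⇒i≡0)

  *-^ : ∀ k i j → (i ℤ.* j) ℤ.^ k ≡ i ℤ.^ k ℤ.* j ℤ.^ k
  *-^ zero i j = refl
  *-^ (suc k) i j = trans (cong ((i ℤ.* j) ℤ.*_) (*-^ k i j)) (l i j (i ℤ.^ k) (j ℤ.^ k))
    where
    l : ∀ i j x y → (i ℤ.* j) ℤ.* (x ℤ.* y) ≡ (i ℤ.* x) ℤ.* (j ℤ.* y)
    l = ℤSolver.solve-∀

  V-scale : ∀ a b g k → V (a ℤ.* pos g) (b ℤ.* pos g) k ≡ g ^ k * V a b k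
  V-scale a b g k = begin
    ∣ (a ℤ.* pos g) ℤ.^ k ℤ.- (b ℤ.* pos g) ℤ.^ k ∣  ≡⟨ cong ∣_∣
        (trans (cong₂ ℤ._-_ (*-^ k a (pos g)) (*-^ k b (pos g))) (l (a ℤ.^ k) (b ℤ.^ k) (pos g ℤ.^ k))) ⟩
    ∣ pos g ℤ.^ k ℤ.* (a ℤ.^ k ℤ.- b ℤ.^ k) ∣       ≡⟨ ℤₚ.abs-* (pos g ℤ.^ k) _ ⟩
    ∣ pos g ℤ.^ k ∣ * V a b k                        ≡⟨ cong (_* V a b k) (abs-^ (pos g) k) ⟩
    g ^ k * V a b k                                  ∎
    where
    open ≡-Reasoning
    l : ∀ x y z → x ℤ.* z ℤ.- y ℤ.* z ≡ z ℤ.* (x ℤ.- y)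
    l = ℤSolver.solve-∀

  V-^ : ∀ x y d k → V (x ℤ.^ d) (y ℤ.^ d) k ≡ V x y (d * k)
  V-^ x y d k = cong₂ (λ u v → ∣ u ℤ.- v ∣) (ℤₚ.^-*-assoc x d k) (ℤₚ.^-*-assoc y d k)

  commonFactor : ∀ x y → 0 < ∣ x ∣ → ∃ λ g → ∃₂ λ a b → 0 < g × x ≡ a ℤ.* pos g × y ≡ b ℤ.* pos g × Cop a b
  commonFactor x y X>0 = g , a , b , g>0 , S._∣_.equality dx , S._∣_.equality dy , cop
    where
    g = gcd ∣ x ∣ ∣ y ∣
    g>0 : 0 < g
    g>0 = ∣-pos X>0 (gcd[m,n]∣m ∣ x ∣ ∣ y ∣)
    dx : pos g S.∣ x
    dx = toS (gcd[m,n]∣m ∣ x ∣ ∣ y ∣)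
    dy : pos g S.∣ y
    dy = toS (gcd[m,n]∣n ∣ x ∣ ∣ y ∣)
    a = S._∣_.quotient dx
    b = S._∣_.quotient dy
    scaled : ∀ {p z} c → z ≡ c ℤ.* pos g → p ∣ ∣ c ∣ → p * g ∣ ∣ z ∣
    scaled {p} c e d = subst (p * g ∣_) (sym (trans (cong ∣_∣ e) (ℤₚ.abs-* c (pos g)))) (*-monoˡ-∣ g d)
    cop : Cop a b
    cop p pr pa pb = <⇒≱ (subst (g <_) (*-comm g p) (m<m*n g p {{>-nonZero g>0}} (prime>1 pr)))
        (∣⇒≤′ g>0 (gcd-greatest (scaled {p} a (S._∣_.equality dx) pa) (scaled {p} b (S._∣_.equality dy) pb)))

  -- The oddness is kept for `sum≢2′`, which later shows that the common divisor of the original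
  -- exponents is 1.
  record Power2Solution (x y : ℤ) (m n : ℕ) : Set where
    field
      K     : ℕ
      m≡2   : m ≡ 2
      n≡1   : n ≡ 1
      sum≡2 : ∣ x ℤ.+ y ∣ ≡ 2
      dif≡  : V x y 1 ≡ 2 ^ K
      x-odd : ¬ 2 ∣ ∣ x ∣
      y-odd : ¬ 2 ∣ ∣ y ∣

  reduced : ∀ x y m n → 0 < ∣ x ∣ → 0 < ∣ y ∣ → gcd m n ≡ 1 → 0 < n → n < m → 0 < V x y m →
    φ (V x y m) ≡ V x y n → Power2Solution x y m n
  reduced x y m n X>0 Y>0 gcd≡1 n>0 n<m Vm>0 eq = go (commonFactor x y X>0)
    where
    go : (∃ λ g → ∃₂ λ a b → 0 < g × x ≡ a ℤ.* pos g × y ≡ b ℤ.* pos g × Cop a b) → Power2Solution x y m n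
    go (g , a , b , g>0 , x≡ , y≡ , cop) = split (2 ∣? ∣ a ∣) (2 ∣? ∣ b ∣) (2 ∣? m) (2 ∣? n)
      where
      V≡ : ∀ k → V x y k ≡ g ^ k * V a b k
      V≡ k = trans (cong₂ (λ u v → V u v k) x≡ y≡) (V-scale a b g k)
      A>0 : 0 < ∣ a ∣
      A>0 = *-posˡ g (subst (0 <_) (trans (cong ∣_∣ x≡) (ℤₚ.abs-* a (pos g))) X>0)
      B>0 : 0 < ∣ b ∣
      B>0 = *-posˡ g (subst (0 <_) (trans (cong ∣_∣ y≡) (ℤₚ.abs-* b (pos g))) Y>0)
      V>0 : 0 < V a b m
      V>0 = *-posʳ (g ^ m) (subst (0 <_) (V≡ m) Vm>0)
      eq′ : φ (g ^ m * V a b m) ≡ g ^ n * V a b n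
      eq′ = trans (cong φ (sym (V≡ m))) (trans eq (V≡ n))
      Vn>0 : 0 < V a b n
      Vn>0 = *-posʳ (g ^ n) (subst (0 <_) eq′ (φ-pos (subst (0 <_) (V≡ m) Vm>0)))
      open Equation a b g m n A>0 B>0 cop g>0 gcd≡1 n>0 n<m V>0 eq′
      oddEven-impossible : ¬ 2 ∣ ∣ a ∣ → ¬ 2 ∣ ∣ b ∣ → ¬ 2 ∣ m → 2 ∣ n → ⊥
      oddEven-impossible a-odd b-odd m-odd n-even with <-cmp ∣ b ∣ ∣ a ∣
      ... | tri< B<A _ _ = OddEven.absurd a b g m n A>0 B>0 cop g>0 gcd≡1 n>0 n<m V>0 eq′ a-odd b-odd m-odd n-even B<A
      ... | tri> _ _ A<B = OddEven.absurd b a g m n B>0 A>0 (λ p pr db da → cop p pr da db) g>0 gcd≡1 n>0 n<m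
          (subst (0 <_) (V-comm a b m) V>0)
              (subst₂ (λ u v → φ (g ^ m * u) ≡ g ^ n * v) (V-comm a b m) (V-comm a b n) eq′) b-odd a-odd m-odd n-even
                  A<B
      ... | tri≈ _ e _ = <-irrefl (sym (V-zero a b n (sym e)
          (subst (λ z → V a b z + ∣ b ∣ ^ z ≡ ∣ a ∣ ^ z) (sym (proj₂ (even⇒2* n-even)))
              (V-even a b (proj₁ (even⇒2* n-even)) (≤-reflexive e))))) Vn>0
      split : Dec (2 ∣ ∣ a ∣) → Dec (2 ∣ ∣ b ∣) → Dec (2 ∣ m) → Dec (2 ∣ n) → Power2Solution x y m n
      split (yes a-even) _ _ _ = ⊥-elim (evenBase-impossible (inj₁ a-even))
      split (no _) (yes b-even) _ _ = ⊥-elim (evenBase-impossible (inj₂ b-even))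
      split (no a-odd) (no b-odd) (no m-odd) (no n-odd) = ⊥-elim
          (BothOdd.oddExponents-impossible a-odd b-odd m-odd n-odd)
      split (no a-odd) (no b-odd) (no m-odd) (yes n-even) = ⊥-elim (oddEven-impossible a-odd b-odd m-odd n-even)
      split (no a-odd) (no b-odd) (yes m-even) _ = finish (BothOdd.evenExponent a-odd b-odd m-even)
        where
        finish : (∃ λ K → g ≡ 1 × m ≡ 2 × n ≡ 1 × ∣ a ℤ.+ b ∣ ≡ 2 × V a b 1 ≡ 2 ^ K) → Power2Solution x y m n
        finish (K , g≡1 , m≡2 , n≡1 , sum≡2 , dif≡) = record
          { K = K ; m≡2 = m≡2 ; n≡1 = n≡1
          ; sum≡2 = subst₂ (λ u v → ∣ u ℤ.+ v ∣ ≡ 2) a≡x b≡y sum≡2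
          ; dif≡ = subst₂ (λ u v → V u v 1 ≡ 2 ^ K) a≡x b≡y dif≡
          ; x-odd = subst (λ u → ¬ 2 ∣ ∣ u ∣) a≡x a-odd
          ; y-odd = subst (λ u → ¬ 2 ∣ ∣ u ∣) b≡y b-odd }
          where
          a≡x : a ≡ x
          a≡x = sym (trans x≡ (trans (cong (λ z → a ℤ.* pos z) g≡1) (ℤₚ.*-identityʳ a)))
          b≡y : b ≡ y
          b≡y = sym (trans y≡ (trans (cong (λ z → b ℤ.* pos z) g≡1) (ℤₚ.*-identityʳ b)))

  -- Odd numbers of different absolute value are at least 2 apart, so `2Δ≤` bounds the sum of powers
  -- below by 4.
  sum≢2′ : ∀ x y d → 1 < d → ¬ 2 ∣ ∣ x ∣ → ¬ 2 ∣ ∣ y ∣ → 0 < ∣ y ∣ → ∣ y ∣ < ∣ x ∣ → ∣ x ℤ.^ d ℤ.+ y ℤ.^ d ∣ ≢ 2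
  sum≢2′ x y d d>1 x-odd y-odd Y>0 Y<X e = <⇒≱ 4≤ (subst (2 * (∣ x ∣ ∸ ∣ y ∣) ≤_) e (2Δ≤ d Y>0 Y<X d>1 lower))
    where
    l : ∀ u v → u ℤ.+ v ℤ.- v ≡ u
    l = ℤSolver.solve-∀
    lower : ∣ x ∣ ^ d ≤ ∣ x ℤ.^ d ℤ.+ y ℤ.^ d ∣ + ∣ y ∣ ^ d
    lower = subst₂ _≤_ (trans (cong ∣_∣ (l (x ℤ.^ d) (y ℤ.^ d))) (abs-^ x d))
        (cong (∣ x ℤ.^ d ℤ.+ y ℤ.^ d ∣ +_) (abs-^ y d))
      (ℤₚ.∣i-j∣≤∣i∣+∣j∣ (x ℤ.^ d ℤ.+ y ℤ.^ d) (y ℤ.^ d))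
    2≤Δ : 2 ≤ ∣ x ∣ ∸ ∣ y ∣
    2≤Δ = ≤∧≢⇒< (m<n⇒0<n∸m Y<X) λ 1≡Δ → gap (odd⇒suc y-odd)
        (trans (sym (m∸n+n≡m (<⇒≤ Y<X))) (cong (_+ ∣ y ∣) (sym 1≡Δ)))
      where
      gap : (∃ λ k → ∣ y ∣ ≡ suc (2 * k)) → ∣ x ∣ ≡ suc ∣ y ∣ → ⊥
      gap (k , e₁) e₂ = x-odd (divides (suc k) (trans e₂ (trans (cong suc e₁) (l₂ k))))
        where
        l₂ : ∀ k → suc (suc (2 * k)) ≡ suc k * 2
        l₂ = solve-∀
    4≤ : 2 < 2 * (∣ x ∣ ∸ ∣ y ∣)
    4≤ = ≤-trans (n≤1+n 3) (*-monoʳ-≤ 2 2≤Δ)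

  exponent-one : ∀ x y d → 0 < d → 0 < ∣ x ∣ → 0 < ∣ y ∣ → ¬ 2 ∣ ∣ x ∣ → ¬ 2 ∣ ∣ y ∣ → ∣ x ∣ ≢ ∣ y ∣ → ∣ x ℤ.^ d ℤ.+
      y ℤ.^ d ∣ ≡ 2 → d ≡ 1
  exponent-one x y (suc zero) _ _ _ _ _ _ _ = refl
  exponent-one x y d@(suc (suc _)) _ X>0 Y>0 x-odd y-odd X≢Y e with <-cmp ∣ y ∣ ∣ x ∣
  ... | tri< Y<X _ _ = ⊥-elim (sum≢2′ x y d (s≤s (s≤s z≤n)) x-odd y-odd Y>0 Y<X e)
  ... | tri≈ _ Y≡X _ = ⊥-elim (X≢Y (sym Y≡X))
  ... | tri> _ _ X<Y = ⊥-elim (sum≢2′ y x d (s≤s (s≤s z≤n)) y-odd x-odd X>0 X<Y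
      (trans (cong ∣_∣ (ℤₚ.+-comm (y ℤ.^ d) (x ℤ.^ d))) e))

  halves : ∀ x y e f → x ℤ.+ y ≡ pos 2 ℤ.* e → x ℤ.- y ≡ pos 2 ℤ.* f → x ≡ e ℤ.+ f × y ≡ e ℤ.- f
  halves x y e f s d = ℤₚ.*-cancelˡ-≡ (pos 2) _ _ (trans (l₁ x y) (trans (cong₂ ℤ._+_ s d) (l₂ e f)))
                     , ℤₚ.*-cancelˡ-≡ (pos 2) _ _ (trans (l₃ x y) (trans (cong₂ ℤ._-_ s d) (l₄ e f)))
    where
    l₁ : ∀ x y → pos 2 ℤ.* x ≡ (x ℤ.+ y) ℤ.+ (x ℤ.- y)
    l₁ = ℤSolver.solve-∀
    l₂ : ∀ e f → pos 2 ℤ.* e ℤ.+ pos 2 ℤ.* f ≡ pos 2 ℤ.* (e ℤ.+ f)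
    l₂ = ℤSolver.solve-∀
    l₃ : ∀ x y → pos 2 ℤ.* y ≡ (x ℤ.+ y) ℤ.- (x ℤ.- y)
    l₃ = ℤSolver.solve-∀
    l₄ : ∀ e f → pos 2 ℤ.* e ℤ.- pos 2 ℤ.* f ≡ pos 2 ℤ.* (e ℤ.- f)
    l₄ = ℤSolver.solve-∀

  Family : ℤ → ℤ → ℕ → Set
  Family x y t = (x ≡ τ ℤ.+ pos 1 × y ≡ ℤ.- (τ ℤ.- pos 1)) ⊎ (x ≡ τ ℤ.- pos 1 × y ≡ ℤ.- (τ ℤ.+ pos 1))
    ⊎ (x ≡ ℤ.- (τ ℤ.+ pos 1) × y ≡ τ ℤ.- pos 1) ⊎ (x ≡ ℤ.- (τ ℤ.- pos 1) × y ≡ τ ℤ.+ pos 1)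
    where τ = pos (2 ^ (t ∸ 1))

  family : ∀ x y K → 0 < K → ∣ x ℤ.+ y ∣ ≡ 2 → ∣ x ℤ.- y ∣ ≡ 2 ^ K → Family x y K
  family x y (suc K) _ s d with ∣∣-cases (x ℤ.+ y) s | ∣∣-cases (x ℤ.- y) d
  ... | inj₁ s′ | inj₁ d′ = inj₁ (conv (halves x y 1ℤ τ s′ (trans d′ (ℤₚ.pos-* 2 (2 ^ K)))))
    where
    τ = pos (2 ^ K)
    l₁ : ∀ τ → 1ℤ ℤ.+ τ ≡ τ ℤ.+ 1ℤ
    l₁ = ℤSolver.solve-∀
    l₂ : ∀ τ → 1ℤ ℤ.- τ ≡ ℤ.- (τ ℤ.- 1ℤ)
    l₂ = ℤSolver.solve-∀
    conv : x ≡ 1ℤ ℤ.+ τ × y ≡ 1ℤ ℤ.- τ → x ≡ τ ℤ.+ 1ℤ × y ≡ ℤ.- (τ ℤ.- 1ℤ)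
    conv (ex , ey) = trans ex (l₁ τ) , trans ey (l₂ τ)
  ... | inj₁ s′ | inj₂ d′ = inj₂ (inj₂ (inj₂ (conv (halves x y 1ℤ (ℤ.- τ) s′
      (trans d′ (trans (cong ℤ.-_ (ℤₚ.pos-* 2 (2 ^ K))) (ℤₚ.neg-distribʳ-* (pos 2) τ)))))))
    where
    τ = pos (2 ^ K)
    l₁ : ∀ τ → 1ℤ ℤ.+ ℤ.- τ ≡ ℤ.- (τ ℤ.- 1ℤ)
    l₁ = ℤSolver.solve-∀
    l₂ : ∀ τ → 1ℤ ℤ.- ℤ.- τ ≡ τ ℤ.+ 1ℤ
    l₂ = ℤSolver.solve-∀
    conv : x ≡ 1ℤ ℤ.+ ℤ.- τ × y ≡ 1ℤ ℤ.- ℤ.- τ → x ≡ ℤ.- (τ ℤ.- 1ℤ) × y ≡ τ ℤ.+ 1ℤ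
    conv (ex , ey) = trans ex (l₁ τ) , trans ey (l₂ τ)
  ... | inj₂ s′ | inj₁ d′ = inj₂ (inj₁ (conv (halves x y (ℤ.- 1ℤ) τ s′ (trans d′ (ℤₚ.pos-* 2 (2 ^ K))))))
    where
    τ = pos (2 ^ K)
    l₁ : ∀ τ → ℤ.- 1ℤ ℤ.+ τ ≡ τ ℤ.- 1ℤ
    l₁ = ℤSolver.solve-∀
    l₂ : ∀ τ → ℤ.- 1ℤ ℤ.- τ ≡ ℤ.- (τ ℤ.+ 1ℤ)
    l₂ = ℤSolver.solve-∀
    conv : x ≡ ℤ.- 1ℤ ℤ.+ τ × y ≡ ℤ.- 1ℤ ℤ.- τ → x ≡ τ ℤ.- 1ℤ × y ≡ ℤ.- (τ ℤ.+ 1ℤ)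
    conv (ex , ey) = trans ex (l₁ τ) , trans ey (l₂ τ)
  ... | inj₂ s′ | inj₂ d′ = inj₂ (inj₂ (inj₁ (conv (halves x y (ℤ.- 1ℤ) (ℤ.- τ) s′
      (trans d′ (trans (cong ℤ.-_ (ℤₚ.pos-* 2 (2 ^ K))) (ℤₚ.neg-distribʳ-* (pos 2) τ)))))))
    where
    τ = pos (2 ^ K)
    l₁ : ∀ τ → ℤ.- 1ℤ ℤ.+ ℤ.- τ ≡ ℤ.- (τ ℤ.+ 1ℤ)
    l₁ = ℤSolver.solve-∀
    l₂ : ∀ τ → ℤ.- 1ℤ ℤ.- ℤ.- τ ≡ τ ℤ.- 1ℤ
    l₂ = ℤSolver.solve-∀
    conv : x ≡ ℤ.- 1ℤ ℤ.+ ℤ.- τ × y ≡ ℤ.- 1ℤ ℤ.- ℤ.- τ → x ≡ ℤ.- (τ ℤ.+ 1ℤ) × y ≡ τ ℤ.- 1ℤ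
    conv (ex , ey) = trans ex (l₁ τ) , trans ey (l₂ τ)

  -- The origin of `t ≥ 2`: at `t = 1` the power of two is 1 and one coordinate vanishes.
  family₁⇒zero : ∀ x y → Family x y 1 → x ≡ 0ℤ ⊎ y ≡ 0ℤ
  family₁⇒zero x y (inj₁ (_ , e)) = inj₂ e
  family₁⇒zero x y (inj₂ (inj₁ (e , _))) = inj₁ e
  family₁⇒zero x y (inj₂ (inj₂ (inj₁ (_ , e)))) = inj₂ e
  family₁⇒zero x y (inj₂ (inj₂ (inj₂ (e , _)))) = inj₁ e

  -- The reduction replaces `x` and `y` by their d-th powers with `d = gcd m n`. Those would have to
  -- add up to 2 or -2, which forces `d = 1`, so the solution found belongs to `x` and `y`
  -- themselves.
  power2-family : ∀ x y m n → x ≢ 0ℤ → y ≢ 0ℤ → 0 < n → n < m → 0 < V x y m → φ (V x y m) ≡ V x y n →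
    ∃ λ t → 2 ≤ t × m ≡ 2 × n ≡ 1 × Family x y t
  power2-family x y m n x≢0 y≢0 n>0 n<m Vm>0 eq = conclude (reduced (x ℤ.^ d) (y ℤ.^ d) m′ n′
      (subst (0 <_) (sym (abs-^ x d)) (^-pos d X>0)) (subst (0 <_) (sym (abs-^ y d)) (^-pos d Y>0))
      gcd′ n′>0 n′<m′ (subst (0 <_) (V≡ m m′ m≡) Vm>0) (subst₂ (λ u v → φ u ≡ v) (V≡ m m′ m≡) (V≡ n n′ n≡) eq))
    where
    X>0 = ≢0⇒pos x≢0
    Y>0 = ≢0⇒pos y≢0
    d = gcd m n
    d>0 : 0 < d
    d>0 = ∣-pos n>0 (gcd[m,n]∣n m n)
    m′ = quotient (gcd[m,n]∣m m n)
    n′ = quotient (gcd[m,n]∣n m n)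
    m≡ : m ≡ d * m′
    m≡ = m∣n⇒n≡m*quotient (gcd[m,n]∣m m n)
    n≡ : n ≡ d * n′
    n≡ = m∣n⇒n≡m*quotient (gcd[m,n]∣n m n)
    gcd′ : gcd m′ n′ ≡ 1
    gcd′ = *-cancelˡ-≡ (gcd m′ n′) 1 d {{>-nonZero d>0}} (trans (c*gcd[m,n]≡gcd[cm,cn] d m′ n′)
        (trans (cong₂ gcd (sym m≡) (sym n≡)) (sym (*-identityʳ d))))
    n′>0 : 0 < n′
    n′>0 = *-posʳ d (subst (0 <_) n≡ n>0)
    n′<m′ : n′ < m′
    n′<m′ = *-cancelˡ-< d n′ m′ (subst₂ _<_ n≡ m≡ n<m)
    V≡ : ∀ k k′ → k ≡ d * k′ → V x y k ≡ V (x ℤ.^ d) (y ℤ.^ d) k′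
    V≡ k k′ e = trans (cong (V x y) e) (sym (V-^ x y d k′))
    conclude : Power2Solution (x ℤ.^ d) (y ℤ.^ d) m′ n′ → ∃ λ t → 2 ≤ t × m ≡ 2 × n ≡ 1 × Family x y t
    conclude sol = K , 2≤K , m≡2′ , n≡1′ , fam
      where
      open Power2Solution sol
      odd-root : ∀ z → ¬ 2 ∣ ∣ z ℤ.^ d ∣ → ¬ 2 ∣ ∣ z ∣
      odd-root z odd 2∣z = odd (subst (2 ∣_) (sym (abs-^ z d))
          (subst (λ k → 2 ∣ ∣ z ∣ ^ k) (m+[n∸m]≡n d>0) (∣m⇒∣m*n _ 2∣z)))
      X≢Y : ∣ x ∣ ≢ ∣ y ∣
      -- `m = d * 2` is even, so equal absolute values would make `V x y m` vanish.
      X≢Y e = <-irrefl (sym (V-zero x y m e (subst (λ k → V x y k + ∣ y ∣ ^ k ≡ ∣ x ∣ ^ k)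
          (sym (trans m≡ (trans (cong (d *_) m≡2) (*-comm d 2))))
        (V-even x y d (≤-reflexive (sym e)))))) Vm>0
      d≡1 : d ≡ 1
      d≡1 = exponent-one x y d d>0 X>0 Y>0 (odd-root x x-odd) (odd-root y y-odd) X≢Y sum≡2
      m≡2′ : m ≡ 2
      m≡2′ = trans m≡ (cong₂ _*_ d≡1 m≡2)
      n≡1′ : n ≡ 1
      n≡1′ = trans n≡ (cong₂ _*_ d≡1 n≡1)
      x^d : ∀ z → z ℤ.^ d ≡ z
      x^d z = trans (cong (z ℤ.^_) d≡1) (ℤₚ.^-identityʳ z)
      s₂ : ∣ x ℤ.+ y ∣ ≡ 2
      s₂ = subst₂ (λ u v → ∣ u ℤ.+ v ∣ ≡ 2) (x^d x) (x^d y) sum≡2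
      V1 : V x y 1 ≡ 2 ^ K
      V1 = subst₂ (λ u v → V u v 1 ≡ 2 ^ K) (x^d x) (x^d y) dif≡
      dif : ∣ x ℤ.- y ∣ ≡ 2 ^ K
      dif = trans (cong₂ (λ u v → ∣ u ℤ.- v ∣) (sym (ℤₚ.^-identityʳ x)) (sym (ℤₚ.^-identityʳ y))) V1
      K>0 : 0 < K
      K>0 = p^∣p^⇒≤ (prime>1 prime[2]) 1 K (subst (2 ∣_) V1 (2∣V x y 1 (odd-root x x-odd) (odd-root y y-odd)))
      fam : Family x y K
      fam = family x y K K>0 s₂ dif
      2≤K : 2 ≤ K
      2≤K = ≤∧≢⇒< K>0 λ e → [ x≢0 , y≢0 ]′ (family₁⇒zero x y (subst (Family x y) (sym e) fam))

  trivial : ∀ x y m n → x ≢ 0ℤ → y ≢ 0ℤ → 0 < m → m ≤ n → 0 < V x y m → φ (V x y m) ≡ V x y n →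
    (x ≡ y ℤ.+ pos 1 ⊎ x ≡ y ℤ.- pos 1) × m ≡ 1 × n ≡ 1
  trivial x y m n x≢0 y≢0 m>0 m≤n Vm>0 eq = sol , m≡1 , n≡1
    where
    X>0 = ≢0⇒pos x≢0
    Y>0 = ≢0⇒pos y≢0
    Vn>0 : 0 < V x y n
    Vn>0 = subst (0 <_) eq (φ-pos Vm>0)
    Vm≤1 : V x y m ≤ 1
    Vm≤1 = ≮⇒≥ λ 1<Vm → <⇒≱ (φ-< 1<Vm) (subst (V x y m ≤_) (sym eq) (V-mono x y X>0 Y>0 m>0 m≤n Vn>0))
    Vm≡1 : V x y m ≡ 1
    Vm≡1 = ≤-antisym Vm≤1 Vm>0
    Vn≡1 : V x y n ≡ 1
    Vn≡1 = trans (sym eq) (cong φ Vm≡1)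
    one : ∀ k → 0 < k → V x y k ≡ 1 → k ≡ 1
    one (suc zero) _ _ = refl
    one (suc (suc k)) _ e = ⊥-elim (V≢1 x y (suc (suc k)) X>0 Y>0 (s≤s (s≤s z≤n)) e)
    m≡1 = one m m>0 Vm≡1
    n≡1 = one n (<-≤-trans m>0 m≤n) Vn≡1
    l : ∀ x y → y ℤ.+ (x ℤ.- y) ≡ x
    l = ℤSolver.solve-∀
    dif : ∣ x ℤ.- y ∣ ≡ 1
    dif = trans (cong₂ (λ u v → ∣ u ℤ.- v ∣) (sym (ℤₚ.^-identityʳ x)) (sym (ℤₚ.^-identityʳ y)))
        (trans (cong (V x y) (sym m≡1)) Vm≡1)
    sol : x ≡ y ℤ.+ pos 1 ⊎ x ≡ y ℤ.- pos 1
    sol = [ (λ e → inj₁ (trans (sym (l x y)) (cong (λ z → y ℤ.+ z) e))) ,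
        (λ e → inj₂ (trans (sym (l x y)) (cong (λ z → y ℤ.+ z) e))) ]′ (∣∣-cases (x ℤ.- y) dif)

open import Data.Nat using (ℕ; _<_; _≤_; _∸_)
import Data.Nat.Properties as ℕₚ
open import Data.Integer using (ℤ; +_; -_; _+_; _-_; _^_; ∣_∣)

theorem1p1 : (x y : ℤ) (m n : ℕ) → x ≢ + 0 → y ≢ + 0 → 0 < m → 0 < n →
    x ^ m ≢ y ^ m →
    φ ∣ x ^ m - y ^ m ∣ ≡ ∣ x ^ n - y ^ n ∣ →
    (∃ λ (a : ℤ) → (x ≡ a + + 1 ⊎ x ≡ a - + 1) × y ≡ a × m ≡ 1 × n ≡ 1)
    ⊎ (Σ ℕ λ t → 2 ≤ t × m ≡ 2 × n ≡ 1 ×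
    ((x ≡ + (Data.Nat._^_ 2 (t ∸ 1)) + + 1 × y ≡ - (+ (Data.Nat._^_ 2 (t ∸ 1)) - + 1))
    ⊎ (x ≡ + (Data.Nat._^_ 2 (t ∸ 1)) - + 1 × y ≡ - (+ (Data.Nat._^_ 2 (t ∸ 1)) + + 1))
    ⊎ (x ≡ - (+ (Data.Nat._^_ 2 (t ∸ 1)) + + 1) × y ≡ + (Data.Nat._^_ 2 (t ∸ 1)) - + 1)
    ⊎ (x ≡ - (+ (Data.Nat._^_ 2 (t ∸ 1)) - + 1) × y ≡ + (Data.Nat._^_ 2 (t ∸ 1)) + + 1)))
theorem1p1 x y m n x≢0 y≢0 m>0 n>0 xᵐ≢yᵐ eq with ℕₚ.<-≤-connex n m
... | inj₁ n<m = inj₂ (Solutions.power2-family x y m n x≢0 y≢0 n>0 n<m Vm>0 eq)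
  where Vm>0 = Solutions.≢0⇒pos (xᵐ≢yᵐ ∘ ℤₚ.i-j≡0⇒i≡j (x ^ m) (y ^ m))
... | inj₂ m≤n with Solutions.trivial x y m n x≢0 y≢0 m>0 m≤n Vm>0 eq
  where Vm>0 = Solutions.≢0⇒pos (xᵐ≢yᵐ ∘ ℤₚ.i-j≡0⇒i≡j (x ^ m) (y ^ m))
...   | x≡ , m≡1 , n≡1 = inj₁ (y , x≡ , refl , m≡1 , n≡1)
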